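{- Let $n$ be a positive integer and write $8n+11=3^{\beta}n_1$ with $n_1$ a positive integer and $3\nmid n_1$. Then $$t(1,3,3,4;n)=\sigma(n_1)+a(8n+11).$$
   Context: $\sigma(n)=\sum_{d\mid n,\,d\ge1}d$. The integers $a(n)$ ($n\ge1$) are defined by $q\prod_{k=1}^{\infty}(1-q^{2k})(1-q^{4k})(1-q^{6k})(1-q^{12k})=\sum_{n=1}^{\infty}a(n)q^n$ for $|q|<1$. For positive integers $a,b,c,d$ and a nonnegative integer $n$, $t(a,b,c,d;n)$ denotes the number of $(x,y,z,w)\in\mathbb Z^4$ with $n=a\frac{x(x-1)}2+b\frac{y(y-1)}2+c\frac{z(z-1)}2+d\frac{w(w-1)}2$. -}

module Defs where

open import Data.Nat as ℕ using (ℕ; zero; suc; _≤ᵇ_; _∸_)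
open import Data.Nat.Divisibility using (_∣?_)
open import Data.Integer as ℤ using (ℤ; +_; _-_; _*_; _+_; _/_)
open import Data.List using (List; filter)
open import Data.Nat.ListAction using (sum)
open import Data.List.Base using (upTo)
open import Data.Bool using (if_then_else_)
open import Data.Product using (Σ; _×_)
open import Data.Fin using (Fin)
open import Function.Bundles using (_↔_)
open import Relation.Binary.PropositionalEquality using (_≡_)

σ : ℕ → ℕ
σ n = sum (filter (_∣? n) (Data.List.Base.map suc (upTo n)))

Series : Set
Series = ℕ → ℤ

one : Series
one zero    = + 1
one (suc _) = + 0

mul1m : ℕ → Series → Series
mul1m m f i = f i - (if m ≤ᵇ i then f (i ∸ m) else + 0)

partialProd : ℕ → Series
partialProd zero    = one
partialProd (suc k) =
  mul1m (2 ℕ.* suc k) (mul1m (4 ℕ.* suc k) (mul1m (6 ℕ.* suc k)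
    (mul1m (12 ℕ.* suc k) (partialProd k))))

-- a(n) = coefficient of q^n in q ∏_{k≥1} (1-q^{2k})(1-q^{4k})(1-q^{6k})(1-q^{12k}).
-- The coefficient of q^{n-1} in the infinite product only depends on the
-- factors with k ≤ n-1 (the others are ≡ 1 mod q^n), so truncating at k ≤ n is exact.
a : ℕ → ℤ
a zero    = + 0
a (suc m) = partialProd (suc m) m

tri : ℤ → ℤ
tri x = (x * (x - + 1)) / + 2

TRep : ℕ → ℕ → ℕ → ℕ → ℕ → Set
TRep a b c d n =
  Σ ℤ λ x → Σ ℤ λ y → Σ ℤ λ z → Σ ℤ λ w →
    + n ≡ + a * tri x + + b * tri y + + c * tri z + + d * tri w

tEquals : ℕ → ℕ → ℕ → ℕ → ℕ → ℕ → Set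
tEquals a b c d n m = Fin m ↔ TRep a b c d n

{-# OPTIONS --safe #-}
module Submission where

-- Write φ = Σ q^(x²), Ψ = Σ q^(x(x-1)/2) (sums over x ∈ ℤ), E = ∏ (1 - q^k), f⁻(q) = f(-q), f_k(q) = f(q^k)
-- and D = q d/dq. The number t(1,3,3,4;n) is the coefficient of q^n in Ψ Ψ₃² Ψ₄.
-- Divisor sums enter through DE = -E Σ σ(n) q^n. As φ⁻ E₂ = E², the Wronskian φ⁻ D(φ⁻₃) - φ⁻₃ D(φ⁻) is φ⁻ φ⁻₃
-- times a combination of the series of σ. It is also the theta series of -Re (x + y√-3)² with signs (-1)^(x + y),
-- and multiplication by cube roots of unity in ℤ[(1 + √-3)/2] turns this into 2 q E₂³ E₆³ by Jacobi's formula
-- for E³. Since φ⁻ Ψ² = 4 E₂³, it follows that q Ψ² Ψ₃² has the coefficient 16 σ(n₁) at every odd exponent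
-- 3^β n₁ with 3 ∤ n₁. Since Ψ⁻ φ⁻₂ = 2 E E₂, the series of a(n) is q (Ψ⁻ φ⁻₂)(q²) (Ψ⁻ φ⁻₂)(q⁶) / 4.
-- Both series are now products of φ's and Ψ's. Their parts with exponent ≡ 3 (mod 8) follow from
-- Ψ Ψ₃ = 2 (Ψ₄ φ₆ + q Ψ₁₂ φ₂), φ² = φ₂² + q Ψ₄² and φ = φ₄ + q Ψ₈, and they add up to Ψ Ψ₃² Ψ₄.

open import Defs
open import Data.Nat using (ℕ; _+_; _*_; _^_; _≥_)
open import Data.Nat.Divisibility using (_∣_)
open import Data.Integer using (ℤ; +_)
open import Data.Product using (Σ; _×_)
open import Relation.Nullary using (¬_)
open import Relation.Binary.PropositionalEquality using (_≡_)
import Data.Integer as ℤ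
import Data.Nat as ℕ
open import Data.Nat using (zero; suc; _≤ᵇ_; _∸_)
import Data.Nat.Properties as ℕₚ
open import Data.Integer using (-[1+_])
import Data.Integer.Properties as ℤₚ
open import Data.Integer.Tactic.RingSolver using (solve-∀)
open import Data.Maybe using (Maybe; just; nothing)
open import Data.Product using (_,_; ∃; proj₁; proj₂)
open import Relation.Nullary using (yes; no; Dec)
open import Relation.Binary.PropositionalEquality using (_≢_; refl; sym; trans; cong; cong₂; subst; module ≡-Reasoning)
open import Algebra.Bundles using (CommutativeRing)
open import Algebra.Solver.Ring.AlmostCommutativeRing using (fromCommutativeRing; _-Raw-AlmostCommutative⟶_; AlmostCommutativeRing)
import Algebra.Solver.Ring
import Relation.Binary.Reasoning.Setoid
open import Relation.Binary.Bundles using (Setoid)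
open import Data.Bool using (if_then_else_)
open import Data.Sum using (inj₁; inj₂; _⊎_; [_,_]′)
open import Data.Empty using (⊥-elim; ⊥)
open import Data.Nat.Divisibility using (divides; _∣?_; ∣⇒≤; ∣-trans; *-monoʳ-∣; *-cancelˡ-∣; m∣m*n; n∣m*n)
open import Data.Nat.DivMod using (_/_; _%_; m≡m%n+[m/n]*n; m%n<n; m*n/n≡m)
import Data.Nat.Tactic.RingSolver as ℕ-Solver
open import Data.Nat.ListAction using (sum)
open import Data.Nat.ListAction.Properties using (sum-++)
open import Data.List using (List; []; _∷_; _++_; filter; map; upTo; applyUpTo; cartesianProduct; length; lookup)
open import Data.List.Properties using (upTo-∷ʳ; map-++; filter-++; filter-accept; filter-reject; map-applyUpTo)
open import Data.Integer.DivMod using (div-pos-is-/ℕ)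
open import Data.Fin using (Fin)
open import Data.List.Membership.Propositional using (_∈_)
open import Data.List.Membership.Propositional.Properties
open import Data.List.Membership.Propositional.Properties.WithK using (unique∧set⇒bag)
open import Data.List.Relation.Binary.BagAndSetEquality using (∼bag⇒↭)
open import Data.List.Relation.Binary.Permutation.Propositional using (_↭_; prep; swap)
open import Data.List.Relation.Unary.Any using (here; there; index)
open import Data.List.Relation.Unary.Any.Properties using (lookup-index)
open import Data.List.Relation.Unary.Unique.Propositional using (Unique; []; _∷_)
import Data.List.Relation.Unary.All as All
import Data.List.Relation.Unary.Unique.Propositional.Properties as Uniqueₚ
open import Function.Bundles using (mk⇔; _↔_; mk↔ₛ′)
open import Axiom.UniquenessOfIdentityProofs.WithK using (uip)
import Algebra.Properties.AbelianGroup
open import Data.Nat.Primality using (prime?; prime⇒irreducible)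
open import Data.Nat.Coprimality using (Coprime; coprime-divisor)
open import Function.Construct.Composition using (_↔-∘_)
open import Relation.Nullary.Decidable using (¬?; from-yes)

-- The ring of formal power series

-- Multiplication by 8 and completion of squares turn a representation of n into 8n + 11 = X² + 3Y²
-- + 3Z² + 4W² with odd X, Y, Z, W; this explains 11 = 1 + 3 + 3 + 4 and the residue 3 modulo 8. The
-- series Ψ² Ψ₃² enters because it is a Lambert series: the logarithmic derivative of φ⁻₃/φ⁻ is 2 Σ
-- (σ(m) - σ(m/2) - 3σ(m/3) + 3σ(m/6)) q^m, and at odd m its coefficient is twice the sum of the
-- divisors of m prime to 3, which ignores powers of 3 in m. The series of a(n) is the correction.
-- In the residue class it leaves Ψ₃ φ₆ φ⁻², while the Lambert series leaves Ψ₃ φ₆ φ² among other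
-- terms, and the difference φ² - φ⁻² = 2q Ψ₄² supplies the factor Ψ₄. No analysis is involved:
-- theta identities are bijections of index sets, and identities with infinite products are
-- congruences modulo q^n between finite sums and products, for every n.

infixl 6 _⊕_
infixl 7 _⊗_
infix 8 ⊖_
infix 4 _≈_

record _≈_ (f g : Series) : Set where
  constructor pointwise
  field at : ∀ n → f n ≡ g n
open _≈_ public

C : ℤ → Series
C c zero    = c
C c (suc _) = + 0

_⊕_ : Series → Series → Series
(f ⊕ g) n = f n ℤ.+ g n

⊖_ : Series → Series
(⊖ f) n = ℤ.- f n

tail : Series → Series
tail f n = f (suc n)

-- The Cauchy product in the form (f₀ + q tail f) g = f₀ g + q (tail f) g, which makes the ring laws
-- inductions on the exponent.
_⊗_ : Series → Series → Series
(f ⊗ g) zero    = f 0 ℤ.* g 0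
(f ⊗ g) (suc n) = f 0 ℤ.* g (suc n) ℤ.+ (tail f ⊗ g) n

≈-refl : ∀ {f} → f ≈ f
≈-refl = pointwise λ _ → refl

≈-sym : ∀ {f g} → f ≈ g → g ≈ f
≈-sym p = pointwise λ n → sym (at p n)

≈-trans : ∀ {f g h} → f ≈ g → g ≈ h → f ≈ h
≈-trans p q = pointwise λ n → trans (at p n) (at q n)

⊗-cong-≤ : ∀ {f f′ g g′} n → (∀ i → i ℕ.≤ n → f i ≡ f′ i) → (∀ i → i ℕ.≤ n → g i ≡ g′ i) →
           (f ⊗ g) n ≡ (f′ ⊗ g′) n
⊗-cong-≤ zero    p q = cong₂ ℤ._*_ (p 0 ℕ.z≤n) (q 0 ℕ.z≤n)
⊗-cong-≤ (suc n) p q = cong₂ ℤ._+_ (cong₂ ℤ._*_ (p 0 ℕ.z≤n) (q (suc n) ℕₚ.≤-refl))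
  (⊗-cong-≤ n (λ i i≤n → p (suc i) (ℕ.s≤s i≤n)) (λ i i≤n → q i (ℕₚ.m≤n⇒m≤1+n i≤n)))

⊗-cong : ∀ {f f′ g g′} → f ≈ f′ → g ≈ g′ → f ⊗ g ≈ f′ ⊗ g′
⊗-cong p q = pointwise λ n → ⊗-cong-≤ n (λ i _ → at p i) (λ i _ → at q i)

⊕-cong : ∀ {f f′ g g′} → f ≈ f′ → g ≈ g′ → f ⊕ g ≈ f′ ⊕ g′
⊕-cong p q = pointwise λ n → cong₂ ℤ._+_ (at p n) (at q n)

⊗-congʳ : ∀ f {g g′} → g ≈ g′ → f ⊗ g ≈ f ⊗ g′
⊗-congʳ f q = ⊗-cong (≈-refl {f}) q

⊗-congˡ : ∀ g {f f′} → f ≈ f′ → f ⊗ g ≈ f′ ⊗ g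
⊗-congˡ g p = ⊗-cong p (≈-refl {g})

⊕-congʳ : ∀ f {g g′} → g ≈ g′ → f ⊕ g ≈ f ⊕ g′
⊕-congʳ f q = ⊕-cong (≈-refl {f}) q

⊕-congˡ : ∀ g {f f′} → f ≈ f′ → f ⊕ g ≈ f′ ⊕ g
⊕-congˡ g p = ⊕-cong p (≈-refl {g})

⊖-cong : ∀ {f f′} → f ≈ f′ → ⊖ f ≈ ⊖ f′
⊖-cong p = pointwise λ n → cong ℤ.-_ (at p n)

tail-cong : ∀ {f f′} → f ≈ f′ → tail f ≈ tail f′
tail-cong p = pointwise λ n → at p (suc n)

zeroˡ-at : ∀ f g → (∀ n → f n ≡ + 0) → ∀ n → (f ⊗ g) n ≡ + 0
zeroˡ-at f g p zero    rewrite p 0 = refl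
zeroˡ-at f g p (suc n) rewrite p 0 | zeroˡ-at (tail f) g (λ i → p (suc i)) n = refl

C-⊗-at : ∀ c g n → (C c ⊗ g) n ≡ c ℤ.* g n
C-⊗-at c g zero    = refl
C-⊗-at c g (suc n) rewrite zeroˡ-at (tail (C c)) g (λ _ → refl) n = ℤₚ.+-identityʳ _

-- The recursion of `_⊗_` peels off the constant term of the left factor; commutativity also needs
-- that of the right factor.
⊗-suc : ∀ f g n → (f ⊗ g) (suc n) ≡ (f ⊗ tail g) n ℤ.+ f (suc n) ℤ.* g 0
⊗-suc f g zero    = refl
⊗-suc f g (suc n) rewrite ⊗-suc (tail f) g n = sym (ℤₚ.+-assoc (f 0 ℤ.* g (suc (suc n))) ((tail f ⊗ tail g) n) (f (suc (suc n)) ℤ.* g 0))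

⊗-comm-at : ∀ f g n → (f ⊗ g) n ≡ (g ⊗ f) n
⊗-comm-at f g zero    = ℤₚ.*-comm (f 0) (g 0)
⊗-comm-at f g (suc n) rewrite ⊗-suc g f n | ⊗-comm-at (tail f) g n =
  lem (f 0) (g (suc n)) ((g ⊗ tail f) n)
  where
  lem : ∀ a b c → a ℤ.* b ℤ.+ c ≡ c ℤ.+ b ℤ.* a
  lem = solve-∀

⊗-distribʳ-at : ∀ h f g n → ((f ⊕ g) ⊗ h) n ≡ (f ⊗ h) n ℤ.+ (g ⊗ h) n
⊗-distribʳ-at h f g zero    = ℤₚ.*-distribʳ-+ (h 0) (f 0) (g 0)
⊗-distribʳ-at h f g (suc n) rewrite ⊗-distribʳ-at h (tail f) (tail g) n =
  lem (f 0) (g 0) (h (suc n)) ((tail f ⊗ h) n) ((tail g ⊗ h) n)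
  where
  lem : ∀ a b c x y → (a ℤ.+ b) ℤ.* c ℤ.+ (x ℤ.+ y) ≡ (a ℤ.* c ℤ.+ x) ℤ.+ (b ℤ.* c ℤ.+ y)
  lem = solve-∀

scale-⊗-at : ∀ c f g n → ((λ i → c ℤ.* f i) ⊗ g) n ≡ c ℤ.* (f ⊗ g) n
scale-⊗-at c f g zero    = ℤₚ.*-assoc c (f 0) (g 0)
scale-⊗-at c f g (suc n) rewrite scale-⊗-at c (tail f) g n =
  lem c (f 0) (g (suc n)) ((tail f ⊗ g) n)
  where
  lem : ∀ c a b x → c ℤ.* a ℤ.* b ℤ.+ c ℤ.* x ≡ c ℤ.* (a ℤ.* b ℤ.+ x)
  lem = solve-∀

⊗-assoc-at : ∀ f g h n → ((f ⊗ g) ⊗ h) n ≡ (f ⊗ (g ⊗ h)) n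
⊗-assoc-at f g h zero    = ℤₚ.*-assoc (f 0) (g 0) (h 0)
⊗-assoc-at f g h (suc n)
  rewrite ⊗-distribʳ-at h (λ i → f 0 ℤ.* g (suc i)) (tail f ⊗ g) n
        | scale-⊗-at (f 0) (tail g) h n
        | ⊗-assoc-at (tail f) g h n =
  lem (f 0) (g 0) (h (suc n)) ((tail g ⊗ h) n) ((tail f ⊗ (g ⊗ h)) n)
  where
  lem : ∀ a b c x y → a ℤ.* b ℤ.* c ℤ.+ (a ℤ.* x ℤ.+ y) ≡ a ℤ.* (b ℤ.* c ℤ.+ x) ℤ.+ y
  lem = solve-∀

C-⊕ : ∀ a b → C (a ℤ.+ b) ≈ C a ⊕ C b
C-⊕ a b = pointwise λ { zero → refl ; (suc _) → refl }

C-⊗ : ∀ a b → C (a ℤ.* b) ≈ C a ⊗ C b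
C-⊗ a b = pointwise λ { zero → refl ; (suc n) → sym (trans (C-⊗-at a (C b) (suc n)) (ℤₚ.*-zeroʳ a)) }

C-⊖ : ∀ a → C (ℤ.- a) ≈ ⊖ C a
C-⊖ a = pointwise λ { zero → refl ; (suc _) → refl }

seriesRing : CommutativeRing _ _
seriesRing = record
  { Carrier = Series ; _≈_ = _≈_ ; _+_ = _⊕_ ; _*_ = _⊗_ ; -_ = ⊖_ ; 0# = C (+ 0) ; 1# = C (+ 1)
  ; isCommutativeRing = record
    { isRing = record
      { +-isAbelianGroup = record
        { isGroup = record
          { isMonoid = record
            { isSemigroup = record
              { isMagma = record
                { isEquivalence = record { refl = ≈-refl ; sym = ≈-sym ; trans = ≈-trans }
                ; ∙-cong = ⊕-cong }
              ; assoc = λ f g h → pointwise λ n → ℤₚ.+-assoc (f n) (g n) (h n) }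
            ; identity = (λ f → pointwise λ { zero → ℤₚ.+-identityˡ _ ; (suc n) → ℤₚ.+-identityˡ _ })
                       , (λ f → pointwise λ { zero → ℤₚ.+-identityʳ _ ; (suc n) → ℤₚ.+-identityʳ _ }) }
          ; inverse = (λ f → pointwise λ { zero → ℤₚ.+-inverseˡ (f 0) ; (suc n) → ℤₚ.+-inverseˡ (f (suc n)) })
                    , (λ f → pointwise λ { zero → ℤₚ.+-inverseʳ (f 0) ; (suc n) → ℤₚ.+-inverseʳ (f (suc n)) })
          ; ⁻¹-cong = ⊖-cong }
        ; comm = λ f g → pointwise λ n → ℤₚ.+-comm (f n) (g n) }
      ; *-cong = ⊗-cong
      ; *-assoc = λ f g h → pointwise (⊗-assoc-at f g h)
      ; *-identity = (λ f → pointwise λ n → trans (C-⊗-at (+ 1) f n) (ℤₚ.*-identityˡ (f n)))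
                   , (λ f → pointwise λ n → trans (⊗-comm-at f (C (+ 1)) n) (trans (C-⊗-at (+ 1) f n) (ℤₚ.*-identityˡ (f n))))
      ; distrib = (λ h f g → pointwise λ n → trans (⊗-comm-at h (f ⊕ g) n)
                    (trans (⊗-distribʳ-at h f g n) (cong₂ ℤ._+_ (⊗-comm-at f h n) (⊗-comm-at g h n))))
                , (λ h f g → pointwise (⊗-distribʳ-at h f g)) }
    ; *-comm = λ f g → pointwise (⊗-comm-at f g) } }

-- Makes ℤ the coefficient ring of the solver, so that integer constants are computed and not
-- treated as variables.
C-homomorphism : AlmostCommutativeRing.rawRing (fromCommutativeRing ℤₚ.+-*-commutativeRing)
                 -Raw-AlmostCommutative⟶ fromCommutativeRing seriesRing
C-homomorphism = record
  { ⟦_⟧ = C ; +-homo = C-⊕ ; *-homo = C-⊗ ; -‿homo = C-⊖ ; 0-homo = ≈-refl ; 1-homo = ≈-refl }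

C-≟ : ∀ a b → Maybe (C a ≈ C b)
C-≟ a b with a ℤₚ.≟ b
... | yes refl = just ≈-refl
... | no _     = nothing

open Algebra.Solver.Ring (AlmostCommutativeRing.rawRing (fromCommutativeRing ℤₚ.+-*-commutativeRing))
  (fromCommutativeRing seriesRing) C-homomorphism C-≟ public
  using (solve; _:=_; _:+_; _:*_; :-_; con)

seriesSetoid : Setoid _ _
seriesSetoid = CommutativeRing.setoid seriesRing

module ≈-Reasoning = Relation.Binary.Reasoning.Setoid seriesSetoid

C-cong : ∀ {a b} → a ≡ b → C a ≈ C b
C-cong refl = ≈-refl

-- Powers of q and cancellation

shift : Series → Series
shift f zero    = + 0
shift f (suc n) = f n

xp : ℕ → Series
xp zero    = C (+ 1)
xp (suc m) = shift (xp m)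

shift-⊗ : ∀ f g → shift f ⊗ g ≈ shift (f ⊗ g)
shift-⊗ f g = pointwise λ { zero → refl ; (suc n) → ℤₚ.+-identityˡ _ }

shift-cong : ∀ {f g} → f ≈ g → shift f ≈ shift g
shift-cong p = pointwise λ { zero → refl ; (suc n) → at p n }

1⊗ : ∀ f → C (+ 1) ⊗ f ≈ f
1⊗ = solve 1 (λ f → con (+ 1) :* f := f) ≈-refl

xp-+ : ∀ m n → xp (m ℕ.+ n) ≈ xp m ⊗ xp n
xp-+ zero    n = ≈-sym (1⊗ (xp n))
xp-+ (suc m) n = ≈-trans (shift-cong (xp-+ m n)) (≈-sym (shift-⊗ (xp m) (xp n)))

xp-⊗-≥ : ∀ m f n → (xp m ⊗ f) (m ℕ.+ n) ≡ f n
xp-⊗-≥ zero    f n = at (1⊗ f) n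
xp-⊗-≥ (suc m) f n = trans (at (shift-⊗ (xp m) f) (suc (m ℕ.+ n))) (xp-⊗-≥ m f n)

xp-⊗-< : ∀ m f n → n ℕ.< m → (xp m ⊗ f) n ≡ + 0
xp-⊗-< (suc m) f zero    _         = refl
xp-⊗-< (suc m) f (suc n) (ℕ.s≤s p) = trans (at (shift-⊗ (xp m) f) (suc n)) (xp-⊗-< m f n p)

xp-⊗-mul1m : ∀ m f i → (xp m ⊗ f) i ≡ (if m ≤ᵇ i then f (i ∸ m) else + 0)
xp-⊗-mul1m zero          f i       = at (1⊗ f) i
xp-⊗-mul1m (suc m)       f zero    = refl
xp-⊗-mul1m (suc zero)    f (suc i) = trans (at (shift-⊗ (xp 0) f) (suc i)) (xp-⊗-mul1m 0 f i)
xp-⊗-mul1m (suc (suc m)) f (suc i) = trans (at (shift-⊗ (xp (suc m)) f) (suc i)) (xp-⊗-mul1m (suc m) f i)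

mul1m-≈ : ∀ m f → mul1m m f ≈ (C (+ 1) ⊕ ⊖ xp m) ⊗ f
mul1m-≈ m f = ≈-trans
  (pointwise λ i → cong (λ z → f i ℤ.- z) (sym (xp-⊗-mul1m m f i)))
  (solve 2 (λ x f → f :+ :- (x :* f) := (con (+ 1) :+ :- x) :* f) ≈-refl (xp m) f)

⊗-zero-at : ∀ f g n → (∀ i → i ℕ.≤ n → g i ≡ + 0) → (f ⊗ g) n ≡ + 0
⊗-zero-at f g n p = trans (⊗-cong-≤ {f} {f} {g} {C (+ 0)} n (λ _ _ → refl) (λ { zero q → p 0 q ; (suc i) q → p (suc i) q}))
  (trans (⊗-comm-at f (C (+ 0)) n) (zeroˡ-at (C (+ 0)) f (λ { zero → refl ; (suc _) → refl }) n))

-- ℤ has no zero divisors, and once g vanishes up to n, the coefficient of q^(n + 1) in f g is f₀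
-- g(n + 1).
annihilator-zero : ∀ f g → f 0 ≢ + 0 → f ⊗ g ≈ C (+ 0) → ∀ n i → i ℕ.≤ n → g i ≡ + 0
annihilator-zero f g f0 p zero zero ℕ.z≤n with ℤₚ.i*j≡0⇒i≡0∨j≡0 (f 0) (at p 0)
... | inj₁ q = ⊥-elim (f0 q)
... | inj₂ q = q
annihilator-zero f g f0 p (suc n) i i≤ with ℕₚ.m≤n⇒m<n∨m≡n i≤
... | inj₁ (ℕ.s≤s i≤n) = annihilator-zero f g f0 p n i i≤n
... | inj₂ refl with ℤₚ.i*j≡0⇒i≡0∨j≡0 (f 0) {g (suc n)}
       (trans (sym (ℤₚ.+-identityʳ _)) (trans (cong (λ z → f 0 ℤ.* g (suc n) ℤ.+ z)
         (sym (⊗-zero-at (tail f) g n (annihilator-zero f g f0 p n)))) (at p (suc n))))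
...   | inj₁ q = ⊥-elim (f0 q)
...   | inj₂ q = q

⊗-cancelˡ : ∀ f {g h} → f 0 ≢ + 0 → f ⊗ g ≈ f ⊗ h → g ≈ h
⊗-cancelˡ f {g} {h} f0 p = pointwise λ n →
  ℤₚ.i-j≡0⇒i≡j (g n) (h n) (annihilator-zero f (g ⊕ ⊖ h) f0 eq n n ℕₚ.≤-refl)
  where
  eq : f ⊗ (g ⊕ ⊖ h) ≈ C (+ 0)
  eq = ≈-trans (solve 3 (λ f g h → f :* (g :+ :- h) := f :* g :+ :- (f :* h)) ≈-refl f g h)
    (≈-trans (⊕-cong p ≈-refl) (solve 1 (λ x → x :+ :- x := con (+ 0)) ≈-refl (f ⊗ h)))

xp-cancel : ∀ m {g h} → xp m ⊗ g ≈ xp m ⊗ h → g ≈ h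
xp-cancel m {g} {h} p = pointwise λ n →
  trans (sym (xp-⊗-≥ m g n)) (trans (at p (m ℕ.+ n)) (xp-⊗-≥ m h n))

-- The substitution q ↦ q^k

-- The second argument counts the zeros still to come before the next coefficient of f. It is reset
-- to k after each coefficient, so the coefficients land k + 1 apart.
spread : ℕ → ℕ → Series → Series
spread k zero    f zero    = f 0
spread k zero    f (suc n) = spread k k (tail f) n
spread k (suc r) f zero    = + 0
spread k (suc r) f (suc n) = spread k r f n

-- dil k f is f(q^k); the case k = 0 is the constant term.
dil : ℕ → Series → Series
dil zero    f = C (f 0)
dil (suc k) f = spread k 0 f

spread-skip : ∀ k r f n → spread k r f (r ℕ.+ n) ≡ spread k 0 f n
spread-skip k zero    f n = refl
spread-skip k (suc r) f n = spread-skip k r f n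

spread-gap : ∀ k r f n → n ℕ.< r → spread k r f n ≡ + 0
spread-gap k (suc r) f zero    _         = refl
spread-gap k (suc r) f (suc n) (ℕ.s≤s p) = spread-gap k r f n p

dil-at-multiple : ∀ k f j → dil (suc k) f (j ℕ.* suc k) ≡ f j
dil-at-multiple k f zero    = refl
dil-at-multiple k f (suc j) = trans (spread-skip k k (tail f) (j ℕ.* suc k)) (dil-at-multiple k (tail f) j)

dil-at-nonmultiple : ∀ k f j s → s ℕ.< k → dil (suc k) f (j ℕ.* suc k ℕ.+ suc s) ≡ + 0
dil-at-nonmultiple k f zero    s p = spread-gap k k (tail f) s p
dil-at-nonmultiple k f (suc j) s p =
  trans (cong (spread k k (tail f)) (ℕₚ.+-assoc k (j ℕ.* suc k) (suc s)))
    (trans (spread-skip k k (tail f) (j ℕ.* suc k ℕ.+ suc s)) (dil-at-nonmultiple k (tail f) j s p))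

dil-at-∤ : ∀ k f n → ¬ (suc k ∣ n) → dil (suc k) f n ≡ + 0
dil-at-∤ k f n k∤n = go (n % suc k) (m≡m%n+[m/n]*n n (suc k)) (m%n<n n (suc k))
  where
  j : ℕ
  j = n / suc k
  go : ∀ r → n ≡ r ℕ.+ j ℕ.* suc k → r ℕ.< suc k → dil (suc k) f n ≡ + 0
  go zero    e _           = ⊥-elim (k∤n (divides j e))
  go (suc r) e (ℕ.s≤s r<k) = trans (cong (dil (suc k) f) (trans e (ℕₚ.+-comm (suc r) (j ℕ.* suc k))))
    (dil-at-nonmultiple k f j r r<k)

spread-≈ : ∀ k r f → spread k r f ≈ xp r ⊗ spread k 0 f
spread-≈ k zero    f = ≈-sym (1⊗ (spread k 0 f))
spread-≈ k (suc r) f = ≈-trans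
  (pointwise λ { zero → refl ; (suc n) → at (spread-≈ k r f) n })
  (≈-sym (shift-⊗ (xp r) (spread k 0 f)))

dil-unfold : ∀ k f → dil (suc k) f ≈ C (f 0) ⊕ xp (suc k) ⊗ dil (suc k) (tail f)
dil-unfold k f = pointwise λ
  { zero → sym (ℤₚ.+-identityʳ (f 0))
  ; (suc n) → sym (trans (ℤₚ.+-identityˡ _) (trans (at (shift-⊗ (xp k) (dil (suc k) (tail f))) (suc n))
                  (sym (at (spread-≈ k k (tail f)) n)))) }

-- The recursive equation determines Φ, because its right side uses Φ only at smaller exponents.
-- Identities for `dil` are then checked on this equation, without division of exponents by k + 1.
dil-unique : ∀ k (A Φ Φ′ : Series → Series) →
  (∀ f → Φ f ≈ A f ⊕ xp (suc k) ⊗ Φ (tail f)) →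
  (∀ f → Φ′ f ≈ A f ⊕ xp (suc k) ⊗ Φ′ (tail f)) → ∀ f → Φ f ≈ Φ′ f
dil-unique k A Φ Φ′ p p′ f = pointwise λ n → go n f n ℕₚ.≤-refl
  where
  go : ∀ N f n → n ℕ.≤ N → Φ f n ≡ Φ′ f n
  step : ∀ N f n → n ℕ.≤ N → (xp (suc k) ⊗ Φ (tail f)) n ≡ (xp (suc k) ⊗ Φ′ (tail f)) n
  go N f n n≤N = trans (at (p f) n) (trans (cong (λ z → A f n ℤ.+ z) (step N f n n≤N)) (sym (at (p′ f) n)))
  step N       f zero    _           = refl
  step (suc N) f (suc n) (ℕ.s≤s n≤N) = trans (at (shift-⊗ (xp k) (Φ (tail f))) (suc n))
    (trans (⊗-cong-≤ {xp k} {xp k} n (λ _ _ → refl) (λ i i≤n → go N (tail f) i (ℕₚ.≤-trans i≤n n≤N)))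
      (sym (at (shift-⊗ (xp k) (Φ′ (tail f))) (suc n))))

dil-cong : ∀ k {f g} → f ≈ g → dil k f ≈ dil k g
dil-cong zero    p = pointwise λ { zero → at p 0 ; (suc _) → refl }
dil-cong (suc k) p = pointwise (go 0 p)
  where
  go : ∀ r {f g} → f ≈ g → ∀ n → spread k r f n ≡ spread k r g n
  go zero    p zero    = at p 0
  go zero    p (suc n) = go k (tail-cong p) n
  go (suc r) p zero    = refl
  go (suc r) p (suc n) = go r p n

dil-C : ∀ k c → dil (suc k) (C c) ≈ C c
dil-C k c = pointwise λ { zero → refl ; (suc n) → go k n }
  where
  go : ∀ r n → spread k r (tail (C c)) n ≡ + 0
  go zero    zero    = refl
  go zero    (suc n) = go k n
  go (suc r) zero    = refl
  go (suc r) (suc n) = go r n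

dil-⊕ : ∀ k f g → dil (suc k) (f ⊕ g) ≈ dil (suc k) f ⊕ dil (suc k) g
dil-⊕ k f g = pointwise (go 0 f g)
  where
  go : ∀ r f g n → spread k r (f ⊕ g) n ≡ spread k r f n ℤ.+ spread k r g n
  go zero    f g zero    = refl
  go zero    f g (suc n) = go k (tail f) (tail g) n
  go (suc r) f g zero    = refl
  go (suc r) f g (suc n) = go r f g n

dil-⊖ : ∀ k f → dil (suc k) (⊖ f) ≈ ⊖ dil (suc k) f
dil-⊖ k f = pointwise (go 0 f)
  where
  go : ∀ r f n → spread k r (⊖ f) n ≡ ℤ.- spread k r f n
  go zero    f zero    = refl
  go zero    f (suc n) = go k (tail f) n
  go (suc r) f zero    = refl
  go (suc r) f (suc n) = go r f n

dil-shift : ∀ k f → dil (suc k) (shift f) ≈ xp (suc k) ⊗ dil (suc k) f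
dil-shift k f = ≈-trans (dil-unfold k (shift f))
  (solve 1 (λ x → con (+ 0) :+ x := x) ≈-refl (xp (suc k) ⊗ dil (suc k) f))

dil-xp : ∀ k m → dil (suc k) (xp m) ≈ xp (m ℕ.* suc k)
dil-xp k zero    = dil-C k (+ 1)
dil-xp k (suc m) = ≈-trans (dil-shift k (xp m))
  (≈-trans (⊗-cong ≈-refl (dil-xp k m)) (≈-sym (xp-+ (suc k) (m ℕ.* suc k))))

dil-scale : ∀ k c f → dil (suc k) (C c ⊗ f) ≈ C c ⊗ dil (suc k) f
dil-scale k c f = pointwise λ n → trans (at (dil-cong (suc k) {C c ⊗ f} {λ i → c ℤ.* f i} (pointwise (C-⊗-at c f))) n)
  (trans (go 0 f n) (sym (C-⊗-at c (dil (suc k) f) n)))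
  where
  go : ∀ r f n → spread k r (λ i → c ℤ.* f i) n ≡ c ℤ.* spread k r f n
  go zero    f zero    = refl
  go zero    f (suc n) = go k (tail f) n
  go (suc r) f zero    = sym (ℤₚ.*-zeroʳ c)
  go (suc r) f (suc n) = go r f n

tail-⊗ : ∀ f g → f ⊗ g ≈ C (f 0) ⊗ g ⊕ shift (tail f ⊗ g)
tail-⊗ f g = pointwise λ
  { zero → sym (ℤₚ.+-identityʳ _)
  ; (suc n) → cong (ℤ._+ (tail f ⊗ g) n) (sym (C-⊗-at (f 0) g (suc n))) }

dil-⊗ : ∀ k f g → dil (suc k) (f ⊗ g) ≈ dil (suc k) f ⊗ dil (suc k) g
dil-⊗ k f g = dil-unique k (λ f → C (f 0) ⊗ dil (suc k) g)
  (λ f → dil (suc k) (f ⊗ g)) (λ f → dil (suc k) f ⊗ dil (suc k) g)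
  (λ f → ≈-trans (dil-cong (suc k) (tail-⊗ f g)) (≈-trans (dil-⊕ k _ _)
     (⊕-cong (dil-scale k (f 0) g) (dil-shift k (tail f ⊗ g)))))
  (λ f → ≈-trans (⊗-cong (dil-unfold k f) ≈-refl)
     (solve 4 (λ c x t g → (c :+ x :* t) :* g := c :* g :+ x :* (t :* g)) ≈-refl
       (C (f 0)) (xp (suc k)) (dil (suc k) (tail f)) (dil (suc k) g))) f

dil-dil : ∀ k j f → dil (suc k) (dil (suc j) f) ≈ dil (suc j ℕ.* suc k) f
dil-dil k j f = dil-unique (k ℕ.+ j ℕ.* suc k) (λ f → C (f 0))
  (λ f → dil (suc k) (dil (suc j) f)) (λ f → dil (suc j ℕ.* suc k) f)
  (λ f → ≈-trans (dil-cong (suc k) (dil-unfold j f)) (≈-trans (dil-⊕ k _ _)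
     (⊕-cong (dil-C k (f 0)) (≈-trans (dil-⊗ k _ _) (⊗-cong (dil-xp k (suc j)) ≈-refl)))))
  (λ f → dil-unfold (k ℕ.+ j ℕ.* suc k) f) f

-- The substitution q ↦ -q

sgn : Series → Series
sgn f zero    = f 0
sgn f (suc n) = ℤ.- sgn (tail f) n

sgn-cong : ∀ {f g} → f ≈ g → sgn f ≈ sgn g
sgn-cong p = pointwise (go p)
  where
  go : ∀ {f g} → f ≈ g → ∀ n → sgn f n ≡ sgn g n
  go p zero    = at p 0
  go p (suc n) = cong ℤ.-_ (go (tail-cong p) n)

sgn-C : ∀ c → sgn (C c) ≈ C c
sgn-C c = pointwise λ { zero → refl ; (suc n) → cong ℤ.-_ (go n) }
  where
  go : ∀ n → sgn (tail (C c)) n ≡ + 0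
  go zero    = refl
  go (suc n) = cong ℤ.-_ (go n)

sgn-⊕-at : ∀ f g n → sgn (f ⊕ g) n ≡ sgn f n ℤ.+ sgn g n
sgn-⊕-at f g zero    = refl
sgn-⊕-at f g (suc n) = trans (cong ℤ.-_ (sgn-⊕-at (tail f) (tail g) n)) (ℤₚ.neg-distrib-+ (sgn (tail f) n) (sgn (tail g) n))

sgn-scale-at : ∀ c f n → sgn (λ i → c ℤ.* f i) n ≡ c ℤ.* sgn f n
sgn-scale-at c f zero    = refl
sgn-scale-at c f (suc n) = trans (cong ℤ.-_ (sgn-scale-at c (tail f) n)) (ℤₚ.neg-distribʳ-* c _)

neg-⊗-at : ∀ f g n → ((⊖ f) ⊗ g) n ≡ ℤ.- (f ⊗ g) n
neg-⊗-at f g = at (solve 2 (λ f g → (:- f) :* g := :- (f :* g)) ≈-refl f g)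

sgn-⊗-at : ∀ f g n → sgn (f ⊗ g) n ≡ (sgn f ⊗ sgn g) n
sgn-⊗-at f g zero    = refl
sgn-⊗-at f g (suc n) = trans
  (cong ℤ.-_ (trans (sgn-⊕-at (λ i → f 0 ℤ.* g (suc i)) (tail f ⊗ g) n)
    (cong₂ ℤ._+_ (sgn-scale-at (f 0) (tail g) n) (sgn-⊗-at (tail f) g n))))
  (trans (lem (f 0) (sgn (tail g) n) ((sgn (tail f) ⊗ sgn g) n))
    (cong (λ z → f 0 ℤ.* (ℤ.- sgn (tail g) n) ℤ.+ z) (sym (neg-⊗-at (sgn (tail f)) (sgn g) n))))
  where
  lem : ∀ a b c → ℤ.- (a ℤ.* b ℤ.+ c) ≡ a ℤ.* (ℤ.- b) ℤ.+ ℤ.- c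
  lem = solve-∀

sgn-⊕ : ∀ f g → sgn (f ⊕ g) ≈ sgn f ⊕ sgn g
sgn-⊕ f g = pointwise (sgn-⊕-at f g)

sgn-⊗ : ∀ f g → sgn (f ⊗ g) ≈ sgn f ⊗ sgn g
sgn-⊗ f g = pointwise (sgn-⊗-at f g)

sgn-dil-2 : ∀ f → sgn (dil 2 f) ≈ dil 2 f
sgn-dil-2 f = pointwise (go f)
  where
  go : ∀ f n → sgn (dil 2 f) n ≡ dil 2 f n
  go f zero          = refl
  go f (suc zero)    = refl
  go f (suc (suc n)) = trans (ℤₚ.neg-involutive _) (go (tail f) n)

sgn-dil-3 : ∀ f → sgn (dil 3 f) ≈ dil 3 (sgn f)
sgn-dil-3 f = pointwise (go f)
  where
  go : ∀ f n → sgn (dil 3 f) n ≡ dil 3 (sgn f) n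
  go f zero                = refl
  go f (suc zero)          = refl
  go f (suc (suc zero))    = refl
  go f (suc (suc (suc n))) = trans (cong ℤ.-_ (trans (ℤₚ.neg-involutive _) (go (tail f) n)))
    (sym (at (dil-⊖ 2 (sgn (tail f))) n))

-- The derivation q d/dq

D : Series → Series
D f n = + n ℤ.* f n

D-cong : ∀ {f g} → f ≈ g → D f ≈ D g
D-cong p = pointwise λ n → cong (+ n ℤ.*_) (at p n)

D-tail : ∀ f → tail (D f) ≈ D (tail f) ⊕ tail f
D-tail f = pointwise λ n → lem (+ n) (f (suc n))
  where
  lem : ∀ n x → (+ 1 ℤ.+ n) ℤ.* x ≡ n ℤ.* x ℤ.+ x
  lem = solve-∀

D-⊗-at : ∀ f g n → D (f ⊗ g) n ≡ (D f ⊗ g) n ℤ.+ (f ⊗ D g) n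
D-⊗-at f g zero    = lem (f 0) (g 0)
  where
  lem : ∀ a b → + 0 ℤ.* (a ℤ.* b) ≡ + 0 ℤ.* a ℤ.* b ℤ.+ a ℤ.* (+ 0 ℤ.* b)
  lem = solve-∀
D-⊗-at f g (suc n)
  rewrite at (⊗-cong {g = g} (D-tail f) ≈-refl) n | ⊗-distribʳ-at g (D (tail f)) (tail f) n =
  trans (lem₁ (+ n) (f 0) (g (suc n)) ((tail f ⊗ g) n))
    (trans (cong (λ z → (+ 1 ℤ.+ + n) ℤ.* (f 0 ℤ.* g (suc n)) ℤ.+ (tail f ⊗ g) n ℤ.+ z) (D-⊗-at (tail f) g n))
      (lem₂ (+ n) (f 0) (g (suc n)) ((tail f ⊗ g) n) ((D (tail f) ⊗ g) n) ((tail f ⊗ D g) n)))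
  where
  lem₁ : ∀ n a b x → (+ 1 ℤ.+ n) ℤ.* (a ℤ.* b ℤ.+ x) ≡ (+ 1 ℤ.+ n) ℤ.* (a ℤ.* b) ℤ.+ x ℤ.+ n ℤ.* x
  lem₁ = solve-∀
  lem₂ : ∀ n a b x y z → (+ 1 ℤ.+ n) ℤ.* (a ℤ.* b) ℤ.+ x ℤ.+ (y ℤ.+ z) ≡
         (+ 0 ℤ.* b ℤ.+ (y ℤ.+ x)) ℤ.+ (a ℤ.* ((+ 1 ℤ.+ n) ℤ.* b) ℤ.+ z)
  lem₂ = solve-∀

D-⊗ : ∀ f g → D (f ⊗ g) ≈ D f ⊗ g ⊕ f ⊗ D g
D-⊗ f g = pointwise (D-⊗-at f g)

D-⊕ : ∀ f g → D (f ⊕ g) ≈ D f ⊕ D g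
D-⊕ f g = pointwise λ n → ℤₚ.*-distribˡ-+ (+ n) (f n) (g n)

D-C : ∀ c → D (C c) ≈ C (+ 0)
D-C c = pointwise λ { zero → refl ; (suc n) → ℤₚ.*-zeroʳ (+ suc n) }

D-xp : ∀ m → D (xp m) ≈ C (+ m) ⊗ xp m
D-xp m = pointwise λ n → trans (go m n) (sym (C-⊗-at (+ m) (xp m) n))
  where
  lem : ∀ m n x → n ℤ.* x ≡ m ℤ.* x → (+ 1 ℤ.+ n) ℤ.* x ≡ (+ 1 ℤ.+ m) ℤ.* x
  lem m n x p = trans (l n x) (trans (cong (λ z → x ℤ.+ z) p) (sym (l m x)))
    where
    l : ∀ n x → (+ 1 ℤ.+ n) ℤ.* x ≡ x ℤ.+ n ℤ.* x
    l = solve-∀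
  go : ∀ m n → + n ℤ.* xp m n ≡ + m ℤ.* xp m n
  go zero    zero    = refl
  go zero    (suc n) = trans (ℤₚ.*-zeroʳ (+ suc n)) refl
  go (suc m) zero    = sym (ℤₚ.*-zeroʳ (+ suc m))
  go (suc m) (suc n) = lem (+ m) (+ n) (xp m n) (go m n)

D-dil : ∀ k f → D (dil (suc k) f) ≈ C (+ suc k) ⊗ dil (suc k) (D f)
D-dil k = dil-unique k (λ f → C (+ suc k) ⊗ (xp (suc k) ⊗ dil (suc k) (tail f)))
  (λ f → D (dil (suc k) f)) (λ f → C (+ suc k) ⊗ dil (suc k) (D f))
  (λ f → ≈-trans (D-cong (dil-unfold k f)) (≈-trans (D-⊕ _ _) (≈-trans
     (⊕-cong (D-C (f 0)) (≈-trans (D-⊗ _ _) (⊕-cong (⊗-cong (D-xp (suc k)) ≈-refl) ≈-refl)))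
     (solve 4 (λ c x d e → con (+ 0) :+ (c :* x :* d :+ x :* e) := c :* (x :* d) :+ x :* e) ≈-refl
       (C (+ suc k)) (xp (suc k)) (dil (suc k) (tail f)) (D (dil (suc k) (tail f)))))))
  (λ f → ≈-trans (⊗-congʳ (C (+ suc k)) (≈-trans (dil-unfold k (D f))
     (⊕-cong (C-cong (ℤₚ.*-zeroˡ (f 0))) (⊗-congʳ (xp (suc k))
       (≈-trans (dil-cong (suc k) (D-tail f)) (dil-⊕ k (D (tail f)) (tail f)))))))
     (solve 4 (λ c x d e → c :* (con (+ 0) :+ x :* (e :+ d)) := c :* (x :* d) :+ x :* (c :* e)) ≈-refl
       (C (+ suc k)) (xp (suc k)) (dil (suc k) (tail f)) (dil (suc k) (D (tail f)))))

-- Finite products and Gaussian binomial coefficients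

infix 4 _≈[_]_

-- Congruence modulo q^M, the substitute for convergence.
record _≈[_]_ (f : Series) (M : ℕ) (g : Series) : Set where
  constructor below
  field at< : ∀ n → n ℕ.< M → f n ≡ g n
open _≈[_]_ public

≈⇒≈[] : ∀ {f g M} → f ≈ g → f ≈[ M ] g
≈⇒≈[] p = below λ n _ → at p n

≈[]⇒≈ : ∀ {f g} → (∀ M → f ≈[ M ] g) → f ≈ g
≈[]⇒≈ p = pointwise λ n → at< (p (suc n)) n ℕₚ.≤-refl

[]-sym : ∀ {f g M} → f ≈[ M ] g → g ≈[ M ] f
[]-sym p = below λ n q → sym (at< p n q)

[]-trans : ∀ {f g h M} → f ≈[ M ] g → g ≈[ M ] h → f ≈[ M ] h
[]-trans p q = below λ n r → trans (at< p n r) (at< q n r)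

[]-weaken : ∀ {f g M N} → N ℕ.≤ M → f ≈[ M ] g → f ≈[ N ] g
[]-weaken N≤M p = below λ n q → at< p n (ℕₚ.≤-trans q N≤M)

[]-⊗ : ∀ {f f′ g g′ M} → f ≈[ M ] f′ → g ≈[ M ] g′ → f ⊗ g ≈[ M ] f′ ⊗ g′
[]-⊗ p q = below λ n n<M → ⊗-cong-≤ n
  (λ i i≤n → at< p i (ℕₚ.≤-<-trans i≤n n<M)) (λ i i≤n → at< q i (ℕₚ.≤-<-trans i≤n n<M))

[]-⊗ʳ : ∀ f {g g′ M} → g ≈[ M ] g′ → f ⊗ g ≈[ M ] f ⊗ g′
[]-⊗ʳ f q = []-⊗ (≈⇒≈[] (≈-refl {f})) q

[]-⊕ : ∀ {f f′ g g′ M} → f ≈[ M ] f′ → g ≈[ M ] g′ → f ⊕ g ≈[ M ] f′ ⊕ g′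
[]-⊕ p q = below λ n r → cong₂ ℤ._+_ (at< p n r) (at< q n r)

[]-sgn : ∀ {f g M} → f ≈[ M ] g → sgn f ≈[ M ] sgn g
[]-sgn p = below (go p)
  where
  go : ∀ {f g M} → f ≈[ M ] g → ∀ n → n ℕ.< M → sgn f n ≡ sgn g n
  go p zero    q         = at< p 0 q
  go p (suc n) (ℕ.s≤s q) = cong ℤ.-_ (go (below λ i r → at< p (suc i) (ℕ.s≤s r)) n q)

[]-dil : ∀ k {f g M} → f ≈[ M ] g → dil (suc k) f ≈[ M ] dil (suc k) g
[]-dil k p = below λ n n<M → go 0 n (λ i i≤n → at< p i (ℕₚ.≤-<-trans i≤n n<M))
  where
  go : ∀ r {f g} n → (∀ i → i ℕ.≤ n → f i ≡ g i) → spread k r f n ≡ spread k r g n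
  go zero    zero    p = p 0 ℕ.z≤n
  go zero    (suc n) p = go k n (λ i i≤n → p (suc i) (ℕ.s≤s i≤n))
  go (suc r) zero    p = refl
  go (suc r) (suc n) p = go r n (λ i i≤n → p i (ℕₚ.m≤n⇒m≤1+n i≤n))

[]-xp : ∀ m {f g M} → f ≈[ M ] g → xp m ⊗ f ≈[ m ℕ.+ M ] xp m ⊗ g
[]-xp zero    {f} {g} p = below λ n q → trans (at (1⊗ f) n) (trans (at< p n q) (sym (at (1⊗ g) n)))
[]-xp (suc m) {f} {g} p = below λ
  { zero    _         → refl
  ; (suc n) (ℕ.s≤s q) → trans (at (shift-⊗ (xp m) f) (suc n))
      (trans (at< ([]-xp m p) n q) (sym (at (shift-⊗ (xp m) g) (suc n)))) }

1- 1+ : ℕ → Series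
1- m = C (+ 1) ⊕ ⊖ xp m
1+ m = C (+ 1) ⊕ xp m

1--⊗ : ∀ m f → 1- m ⊗ f ≈[ m ] f
1--⊗ m f = below λ n n<m → trans
  (at (solve 2 (λ x f → (con (+ 1) :+ :- x) :* f := f :+ :- (x :* f)) ≈-refl (xp m) f) n)
  (trans (cong (λ z → f n ℤ.- z) (xp-⊗-< m f n n<m)) (ℤₚ.+-identityʳ (f n)))

dil-2-xp : ∀ m → dil 2 (xp m) ≈ xp m ⊗ xp m
dil-2-xp m = ≈-trans (dil-xp 1 m) (≈-trans (subst (λ j → xp (m ℕ.* 2) ≈ xp j) (lem m) ≈-refl) (xp-+ m m))
  where
  lem : ∀ m → m ℕ.* 2 ≡ m ℕ.+ m
  lem = ℕ-Solver.solve-∀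

dil-1- : ∀ k m → dil (suc k) (1- m) ≈ 1- (m ℕ.* suc k)
dil-1- k m = ≈-trans (dil-⊕ k (C (+ 1)) (⊖ xp m))
  (⊕-cong (dil-C k (+ 1)) (≈-trans (dil-⊖ k (xp m)) (⊖-cong (dil-xp k m))))

dil-2-1- : ∀ m → dil 2 (1- m) ≈ 1- m ⊗ 1+ m
dil-2-1- m = ≈-trans (dil-⊕ 1 (C (+ 1)) (⊖ xp m)) (≈-trans
  (⊕-cong (dil-C 1 (+ 1)) (≈-trans (dil-⊖ 1 (xp m)) (⊖-cong (dil-2-xp m))))
  (solve 1 (λ x → con (+ 1) :+ :- (x :* x) := (con (+ 1) :+ :- x) :* (con (+ 1) :+ x)) ≈-refl (xp m)))

E≤ : ℕ → Series
E≤ zero    = C (+ 1)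
E≤ (suc K) = 1- (suc K) ⊗ E≤ K

-- The diagonal is the limit: factors 1 - q^k with k > i do not affect the coefficient of q^i.
E : Series
E i = E≤ i i

E≤-stable : ∀ {m K} → m ℕ.≤ K → E≤ K ≈[ suc m ] E≤ m
E≤-stable {m} {zero}  ℕ.z≤n = ≈⇒≈[] ≈-refl
E≤-stable {m} {suc K} m≤    with ℕₚ.m≤n⇒m<n∨m≡n m≤
... | inj₂ refl          = ≈⇒≈[] ≈-refl
... | inj₁ (ℕ.s≤s m≤K) = []-trans ([]-weaken (ℕ.s≤s m≤K) (1--⊗ (suc K) (E≤ K))) (E≤-stable m≤K)

E≈E≤ : ∀ K → E ≈[ suc K ] E≤ K
E≈E≤ K = below λ n n<1+K → sym (at< (E≤-stable (ℕₚ.≤-pred n<1+K)) n ℕₚ.≤-refl)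

E≈[] : ∀ {M K} → M ℕ.≤ suc K → E ≈[ M ] E≤ K
E≈[] p = []-weaken p (E≈E≤ _)

-- The Gaussian binomial coefficient [a + b choose a].
H : ℕ → ℕ → Series
H zero    b       = C (+ 1)
H (suc a) zero    = C (+ 1)
H (suc a) (suc b) = H a (suc b) ⊕ xp (suc a) ⊗ H (suc a) b

H-zeroʳ : ∀ a → H a 0 ≈ C (+ 1)
H-zeroʳ zero    = ≈-refl
H-zeroʳ (suc a) = ≈-refl

-- Compares two adjacent entries of a row of the Pascal triangle. It takes the place of the
-- factorial formula, which would need division; the second Pascal rule, the symmetry and `E≤-⊗-H`
-- rest on it.
H-exchange : ∀ a b → 1- (suc b) ⊗ H a (suc b) ≈ 1- (suc a) ⊗ H (suc a) b
H-exchange zero zero    = ≈-refl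
H-exchange zero (suc b) = begin
  1- (suc (suc b)) ⊗ C (+ 1)
    ≈⟨ ⊗-congˡ (C (+ 1)) (⊕-congʳ (C (+ 1)) (⊖-cong (xp-+ 1 (suc b)))) ⟩
  (C (+ 1) ⊕ ⊖ (xp 1 ⊗ xp (suc b))) ⊗ C (+ 1)
    ≈⟨ solve 2 (λ x y → (con (+ 1) :+ :- (x :* y)) :* con (+ 1) :=
         (con (+ 1) :+ :- x) :* con (+ 1) :+ x :* ((con (+ 1) :+ :- y) :* con (+ 1))) ≈-refl (xp 1) (xp (suc b)) ⟩
  1- 1 ⊗ C (+ 1) ⊕ xp 1 ⊗ (1- (suc b) ⊗ C (+ 1))
    ≈⟨ ⊕-congʳ (1- 1 ⊗ C (+ 1)) (⊗-congʳ (xp 1) (H-exchange zero b)) ⟩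
  1- 1 ⊗ C (+ 1) ⊕ xp 1 ⊗ (1- 1 ⊗ H 1 b)
    ≈⟨ solve 2 (λ x h → (con (+ 1) :+ :- x) :* con (+ 1) :+ x :* ((con (+ 1) :+ :- x) :* h) :=
         (con (+ 1) :+ :- x) :* (con (+ 1) :+ x :* h)) ≈-refl (xp 1) (H 1 b) ⟩
  1- 1 ⊗ H 1 (suc b) ∎
  where open ≈-Reasoning
H-exchange (suc a) zero = begin
  1- 1 ⊗ (H a 1 ⊕ xp (suc a) ⊗ C (+ 1))
    ≈⟨ solve 3 (λ x h y → (con (+ 1) :+ :- x) :* (h :+ y :* con (+ 1)) :=
         (con (+ 1) :+ :- x) :* h :+ (con (+ 1) :+ :- x) :* y) ≈-refl (xp 1) (H a 1) (xp (suc a)) ⟩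
  1- 1 ⊗ H a 1 ⊕ 1- 1 ⊗ xp (suc a)
    ≈⟨ ⊕-congˡ (1- 1 ⊗ xp (suc a)) (H-exchange a zero) ⟩
  1- (suc a) ⊗ C (+ 1) ⊕ 1- 1 ⊗ xp (suc a)
    ≈⟨ solve 2 (λ x y → (con (+ 1) :+ :- y) :* con (+ 1) :+ (con (+ 1) :+ :- x) :* y :=
         (con (+ 1) :+ :- (x :* y)) :* con (+ 1)) ≈-refl (xp 1) (xp (suc a)) ⟩
  (C (+ 1) ⊕ ⊖ (xp 1 ⊗ xp (suc a))) ⊗ C (+ 1)
    ≈⟨ ⊗-congˡ (C (+ 1)) (⊕-congʳ (C (+ 1)) (⊖-cong (≈-sym (xp-+ 1 (suc a))))) ⟩
  1- (suc (suc a)) ⊗ C (+ 1) ∎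
  where open ≈-Reasoning
H-exchange (suc a) (suc b) = begin
  1- (2 ℕ.+ b) ⊗ (H a (2 ℕ.+ b) ⊕ xp (suc a) ⊗ h)
    ≈⟨ solve 4 (λ u k x h → u :* (k :+ x :* h) := u :* k :+ x :* (u :* h)) ≈-refl
         (1- (2 ℕ.+ b)) (H a (2 ℕ.+ b)) (xp (suc a)) h ⟩
  1- (2 ℕ.+ b) ⊗ H a (2 ℕ.+ b) ⊕ xp (suc a) ⊗ (1- (2 ℕ.+ b) ⊗ h)
    ≈⟨ ⊕-cong (H-exchange a (suc b)) (⊗-congʳ (xp (suc a)) (⊗-congˡ h (⊕-congʳ (C (+ 1)) (⊖-cong (xp-+ 1 (suc b)))))) ⟩
  1- (suc a) ⊗ h ⊕ xp (suc a) ⊗ ((C (+ 1) ⊕ ⊖ (xp 1 ⊗ xp (suc b))) ⊗ h)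
    -- Both sides equal (1 - q^(a + b + 3)) `h`; the new grouping exposes the left side of
    -- `H-exchange (suc a) b`.
    ≈⟨ solve 4 (λ q x y h → (con (+ 1) :+ :- x) :* h :+ x :* ((con (+ 1) :+ :- (q :* y)) :* h) :=
         (con (+ 1) :+ :- (q :* x)) :* h :+ (q :* x) :* ((con (+ 1) :+ :- y) :* h)) ≈-refl
         (xp 1) (xp (suc a)) (xp (suc b)) h ⟩
  (C (+ 1) ⊕ ⊖ (xp 1 ⊗ xp (suc a))) ⊗ h ⊕ (xp 1 ⊗ xp (suc a)) ⊗ (1- (suc b) ⊗ h)
    ≈⟨ ⊕-cong (⊗-congˡ h (⊕-congʳ (C (+ 1)) (⊖-cong (≈-sym (xp-+ 1 (suc a))))))
         (⊗-cong (≈-sym (xp-+ 1 (suc a))) (H-exchange (suc a) b)) ⟩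
  1- (2 ℕ.+ a) ⊗ h ⊕ xp (2 ℕ.+ a) ⊗ (1- (2 ℕ.+ a) ⊗ H (2 ℕ.+ a) b)
    ≈⟨ solve 4 (λ u h x k → u :* h :+ x :* (u :* k) := u :* (h :+ x :* k)) ≈-refl
         (1- (2 ℕ.+ a)) h (xp (2 ℕ.+ a)) (H (2 ℕ.+ a) b) ⟩
  1- (2 ℕ.+ a) ⊗ H (2 ℕ.+ a) (suc b) ∎
  where
  open ≈-Reasoning
  h : Series
  h = H (suc a) (suc b)

H-pascal′ : ∀ a b → H (suc a) (suc b) ≈ xp (suc b) ⊗ H a (suc b) ⊕ H (suc a) b
H-pascal′ a b = begin
  h ⊕ xp (suc a) ⊗ k
    ≈⟨ solve 4 (λ h x k y → h :+ x :* k := (con (+ 1) :+ :- y) :* h :+ (y :* h :+ x :* k)) ≈-refl h (xp (suc a)) k (xp (suc b)) ⟩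
  1- (suc b) ⊗ h ⊕ (xp (suc b) ⊗ h ⊕ xp (suc a) ⊗ k)
    ≈⟨ ⊕-congˡ (xp (suc b) ⊗ h ⊕ xp (suc a) ⊗ k) (H-exchange a b) ⟩
  1- (suc a) ⊗ k ⊕ (xp (suc b) ⊗ h ⊕ xp (suc a) ⊗ k)
    ≈⟨ solve 4 (λ h x k y → (con (+ 1) :+ :- x) :* k :+ (y :* h :+ x :* k) := y :* h :+ k) ≈-refl h (xp (suc a)) k (xp (suc b)) ⟩
  xp (suc b) ⊗ h ⊕ k ∎
  where
  open ≈-Reasoning
  h k : Series
  h = H a (suc b)
  k = H (suc a) b

H-sym : ∀ a b → H a b ≈ H b a
H-sym zero    b       = ≈-sym (H-zeroʳ b)
H-sym (suc a) zero    = ≈-refl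
H-sym (suc a) (suc b) = ≈-trans (H-pascal′ a b)
  (≈-trans (⊕-cong (⊗-congʳ (xp (suc b)) (H-sym a (suc b))) (H-sym (suc a) b))
    (solve 2 (λ x y → x :+ y := y :+ x) ≈-refl (xp (suc b) ⊗ H (suc b) a) (H b (suc a))))

qfac : ℕ → ℕ → Series
qfac i zero    = C (+ 1)
qfac i (suc p) = 1- (suc i) ⊗ qfac (suc i) p

-- The factorial formula for [p + i choose p] with its denominator cleared.
E≤-⊗-H : ∀ p i → E≤ p ⊗ H p i ≈ qfac i p
E≤-⊗-H zero    i = 1⊗ (C (+ 1))
E≤-⊗-H (suc p) i = begin
  1- (suc p) ⊗ E≤ p ⊗ H (suc p) i
    ≈⟨ solve 3 (λ u e h → u :* e :* h := e :* (u :* h)) ≈-refl (1- (suc p)) (E≤ p) (H (suc p) i) ⟩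
  E≤ p ⊗ (1- (suc p) ⊗ H (suc p) i)
    ≈⟨ ⊗-congʳ (E≤ p) (≈-sym (H-exchange p i)) ⟩
  E≤ p ⊗ (1- (suc i) ⊗ H p (suc i))
    ≈⟨ solve 3 (λ u e h → e :* (u :* h) := u :* (e :* h)) ≈-refl (1- (suc i)) (E≤ p) (H p (suc i)) ⟩
  1- (suc i) ⊗ (E≤ p ⊗ H p (suc i))
    ≈⟨ ⊗-congʳ (1- (suc i)) (E≤-⊗-H p (suc i)) ⟩
  1- (suc i) ⊗ qfac (suc i) p ∎
  where open ≈-Reasoning

qfac≈1 : ∀ i p → qfac i p ≈[ suc i ] C (+ 1)
qfac≈1 i zero    = ≈⇒≈[] ≈-refl
qfac≈1 i (suc p) = []-trans (1--⊗ (suc i) (qfac (suc i) p)) ([]-weaken (ℕₚ.n≤1+n _) (qfac≈1 (suc i) p))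

-- Modulo q^(m + 1) the products `E≤ n` and `E≤ p` agree, and `E≤ p ⊗ H p i` is (1 - q^(i + 1)) ⋯ (1
-- - q^(i + p)), all of whose factors are 1 there.
E≤-⊗-H≈1 : ∀ {m n p i} → m ℕ.≤ n → m ℕ.≤ p → m ℕ.≤ i → E≤ n ⊗ H p i ≈[ suc m ] C (+ 1)
E≤-⊗-H≈1 {m} {n} {p} {i} m≤n m≤p m≤i = []-trans
  ([]-⊗ ([]-trans (E≤-stable m≤n) ([]-sym (E≤-stable m≤p))) (≈⇒≈[] ≈-refl))
  ([]-trans (≈⇒≈[] (E≤-⊗-H p i)) ([]-weaken (ℕ.s≤s m≤i) (qfac≈1 i p)))

-- anti p i f = f p i + f (p - 1) (i + 1) + ⋯ + f 0 (p + i)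
anti : ℕ → ℕ → (ℕ → ℕ → Series) → Series
anti zero    i f = f 0 i
anti (suc p) i f = f (suc p) i ⊕ anti p (suc i) f

anti-cong : ∀ {N} p i {f g} → p ℕ.+ i ≡ N → (∀ p i → p ℕ.+ i ≡ N → f p i ≈ g p i) → anti p i f ≈ anti p i g
anti-cong zero    i e q = q 0 i e
anti-cong (suc p) i e q = ⊕-cong (q (suc p) i e) (anti-cong p (suc i) (trans (ℕₚ.+-suc p i) e) q)

anti-cong[] : ∀ {N M} p i {f g} → p ℕ.+ i ≡ N → (∀ p i → p ℕ.+ i ≡ N → f p i ≈[ M ] g p i) → anti p i f ≈[ M ] anti p i g
anti-cong[] zero    i e q = q 0 i e
anti-cong[] (suc p) i e q = []-⊕ (q (suc p) i e) (anti-cong[] p (suc i) (trans (ℕₚ.+-suc p i) e) q)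

anti-⊗ : ∀ c p i f → anti p i (λ p i → c ⊗ f p i) ≈ c ⊗ anti p i f
anti-⊗ c zero    i f = ≈-refl
anti-⊗ c (suc p) i f = ≈-trans (⊕-congʳ (c ⊗ f (suc p) i) (anti-⊗ c p (suc i) f))
  (solve 3 (λ c x y → c :* x :+ c :* y := c :* (x :+ y)) ≈-refl c (f (suc p) i) (anti p (suc i) f))

anti-⊕ : ∀ p i f g → anti p i (λ p i → f p i ⊕ g p i) ≈ anti p i f ⊕ anti p i g
anti-⊕ zero    i f g = ≈-refl
anti-⊕ (suc p) i f g = ≈-trans (⊕-congʳ (f (suc p) i ⊕ g (suc p) i) (anti-⊕ p (suc i) f g))
  (solve 4 (λ a b c d → (a :+ b) :+ (c :+ d) := (a :+ c) :+ (b :+ d)) ≈-refl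
    (f (suc p) i) (g (suc p) i) (anti p (suc i) f) (anti p (suc i) g))

anti-reindex : ∀ p i f → anti p (suc i) f ≈ anti p i (λ p i → f p (suc i))
anti-reindex zero    i f = ≈-refl
anti-reindex (suc p) i f = ⊕-congʳ (f (suc p) (suc i)) (anti-reindex p (suc i) f)

anti-snoc : ∀ p i f → anti (suc p) i f ≈ anti p i (λ p i → f (suc p) i) ⊕ f 0 (suc p ℕ.+ i)
anti-snoc zero    i f = ≈-refl
anti-snoc (suc p) i f = ≈-trans (⊕-congʳ (f (2 ℕ.+ p) i) (anti-snoc p (suc i) f))
  (≈-trans (solve 3 (λ a b c → a :+ (b :+ c) := (a :+ b) :+ c) ≈-refl
      (f (2 ℕ.+ p) i) (anti p (suc i) (λ p i → f (suc p) i)) (f 0 (suc p ℕ.+ suc i)))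
    (⊕-congʳ (anti (suc p) i (λ p i → f (suc p) i)) (≈-reflexive (cong (λ j → f 0 (suc j)) (ℕₚ.+-suc p i)))))
  where
  ≈-reflexive : ∀ {f g} → f ≡ g → f ≈ g
  ≈-reflexive refl = ≈-refl

anti-flip : ∀ n f → anti n 0 f ≈ anti n 0 (λ p i → f i p)
anti-flip zero    f = ≈-refl
anti-flip (suc n) f = begin
  f (suc n) 0 ⊕ anti n 1 f
    ≈⟨ ⊕-congʳ (f (suc n) 0) (≈-trans (anti-reindex n 0 f) (anti-flip n (λ p i → f p (suc i)))) ⟩
  f (suc n) 0 ⊕ anti n 0 (λ p i → f i (suc p))
    ≈⟨ solve 2 (λ x y → x :+ y := y :+ x) ≈-refl (f (suc n) 0) (anti n 0 (λ p i → f i (suc p))) ⟩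
  anti n 0 (λ p i → f i (suc p)) ⊕ f (suc n) 0
    ≡⟨ cong (λ j → anti n 0 (λ p i → f i (suc p)) ⊕ f (suc j) 0) (sym (ℕₚ.+-identityʳ n)) ⟩
  anti n 0 (λ p i → f i (suc p)) ⊕ f (suc n ℕ.+ 0) 0
    ≈⟨ anti-snoc n 0 (λ p i → f i p) ⟨
  anti (suc n) 0 (λ p i → f i p) ∎
  where open ≈-Reasoning

-- Weighted sums of Gaussian binomial coefficients

B : ℕ → ℕ → (ℕ → Series) → Series
B p i ω = anti p i (λ p i → ω i ⊗ H p i)

-- Pascal's rule on the whole antidiagonal. The first summand is a boundary term that vanishes for i
-- = 0 and is carried along because the induction moves i.
B-suc : ∀ p i ω → B (suc p) i ω ≈
  ω i ⊗ (H (suc p) i ⊕ ⊖ H p i) ⊕ (B p i ω ⊕ anti p i (λ p i → ω (suc i) ⊗ xp p ⊗ H p i))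
B-suc zero    i ω = solve 3 (λ a h b → a :* h :+ b :* con (+ 1) :=
    a :* (h :+ :- con (+ 1)) :+ (a :* con (+ 1) :+ b :* con (+ 1) :* con (+ 1))) ≈-refl (ω i) (H 1 i) (ω (suc i))
B-suc (suc p) i ω = begin
  ω i ⊗ H (2 ℕ.+ p) i ⊕ B (suc p) (suc i) ω
    ≈⟨ ⊕-congʳ (ω i ⊗ H (2 ℕ.+ p) i) (B-suc p (suc i) ω) ⟩
  ω i ⊗ H (2 ℕ.+ p) i ⊕ (ω (suc i) ⊗ (k ⊕ xp (suc p) ⊗ H (suc p) i ⊕ ⊖ k) ⊕ (b ⊕ r))
    ≈⟨ solve 8 (λ a h′ h a′ k x b r → a :* h′ :+ (a′ :* (k :+ x :* h :+ :- k) :+ (b :+ r)) :=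
         a :* (h′ :+ :- h) :+ ((a :* h :+ b) :+ (a′ :* x :* h :+ r))) ≈-refl
         (ω i) (H (2 ℕ.+ p) i) (H (suc p) i) (ω (suc i)) k (xp (suc p)) b r ⟩
  ω i ⊗ (H (2 ℕ.+ p) i ⊕ ⊖ H (suc p) i) ⊕ ((ω i ⊗ H (suc p) i ⊕ b) ⊕ (ω (suc i) ⊗ xp (suc p) ⊗ H (suc p) i ⊕ r)) ∎
  where
  open ≈-Reasoning
  k b r : Series
  k = H p (suc i)
  b = B p (suc i) ω
  r = anti p (suc i) (λ p i → ω (suc i) ⊗ xp p ⊗ H p i)

-- For ω′ = ω this is multiplication by 1 + τ, one factor of the q-binomial theorem. A different ω′
-- is needed for weights with a factor linear in i.
B-recurrence : ∀ N τ ω ω′ → (∀ p i → p ℕ.+ i ≡ N → ω (suc i) ⊗ xp p ≈ τ ⊗ ω′ i) →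
  B (suc N) 0 ω ≈ B N 0 ω ⊕ τ ⊗ B N 0 ω′
B-recurrence N τ ω ω′ e = begin
  B (suc N) 0 ω
    ≈⟨ B-suc N 0 ω ⟩
  ω 0 ⊗ (C (+ 1) ⊕ ⊖ H N 0) ⊕ (b ⊕ anti N 0 (λ p i → ω (suc i) ⊗ xp p ⊗ H p i))
    ≈⟨ ⊕-cong (⊗-congʳ (ω 0) (⊕-congʳ (C (+ 1)) (⊖-cong (H-zeroʳ N))))
         (⊕-congʳ b (≈-trans (anti-cong N 0 (ℕₚ.+-identityʳ N)
           (λ p i q → ≈-trans (⊗-congˡ (H p i) (e p i q))
             (solve 3 (λ t w h → t :* w :* h := t :* (w :* h)) ≈-refl τ (ω′ i) (H p i))))
           (anti-⊗ τ N 0 (λ p i → ω′ i ⊗ H p i)))) ⟩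
  ω 0 ⊗ (C (+ 1) ⊕ ⊖ C (+ 1)) ⊕ (b ⊕ τ ⊗ B N 0 ω′)
    ≈⟨ solve 2 (λ a r → a :* (con (+ 1) :+ :- con (+ 1)) :+ r := r) ≈-refl (ω 0) (b ⊕ τ ⊗ B N 0 ω′) ⟩
  b ⊕ τ ⊗ B N 0 ω′ ∎
  where
  open ≈-Reasoning
  b : Series
  b = B N 0 ω

B-cong : ∀ N {ω ω′} → (∀ i → ω i ≈ ω′ i) → B N 0 ω ≈ B N 0 ω′
B-cong N e = anti-cong N 0 (ℕₚ.+-identityʳ N) (λ p i _ → ⊗-congˡ (H p i) (e i))

-- Triangular numbers and signs

T : ℕ → ℕ
T zero    = 0
T (suc n) = suc n ℕ.+ T n

-- triAt n i is the triangular number (i - n)(i - n - 1)/2.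
triAt : ℕ → ℕ → ℕ
triAt zero    zero    = 0
triAt zero    (suc i) = T i
triAt (suc n) zero    = T (suc n)
triAt (suc n) (suc i) = triAt n i

triAt-suc : ∀ n i → triAt n (suc i) ℕ.+ n ≡ triAt n i ℕ.+ i
triAt-suc zero    zero    = refl
triAt-suc zero    (suc i) = trans (ℕₚ.+-identityʳ _) (ℕₚ.+-comm (suc i) (T i))
triAt-suc (suc zero)    zero = refl
triAt-suc (suc (suc n)) zero = trans (ℕₚ.+-comm (T (suc n)) (2 ℕ.+ n)) (sym (ℕₚ.+-identityʳ _))
triAt-suc (suc n) (suc i) = trans (ℕₚ.+-suc _ n) (trans (cong suc (triAt-suc n i)) (sym (ℕₚ.+-suc _ i)))

-- Consecutive values differ by i - n, which is m - p on this antidiagonal. The factor τ = ± q^m in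
-- `B-recurrence` is therefore the same for all i.
triAt-shift : ∀ n m p i → p ℕ.+ i ≡ n ℕ.+ m → triAt n (suc i) ℕ.+ p ≡ triAt n i ℕ.+ m
triAt-shift n m p i e = ℕₚ.+-cancelʳ-≡ (n ℕ.+ i) _ _ (begin
  triAt n (suc i) ℕ.+ p ℕ.+ (n ℕ.+ i)   ≡⟨ lem₁ (triAt n (suc i)) p n i ⟩
  (triAt n (suc i) ℕ.+ n) ℕ.+ (p ℕ.+ i) ≡⟨ cong₂ ℕ._+_ (triAt-suc n i) e ⟩
  (triAt n i ℕ.+ i) ℕ.+ (n ℕ.+ m)       ≡⟨ lem₂ (triAt n i) i n m ⟩
  triAt n i ℕ.+ m ℕ.+ (n ℕ.+ i)         ∎)
  where
  open ≡-Reasoning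
  lem₁ : ∀ a p n i → a ℕ.+ p ℕ.+ (n ℕ.+ i) ≡ (a ℕ.+ n) ℕ.+ (p ℕ.+ i)
  lem₁ = ℕ-Solver.solve-∀
  lem₂ : ∀ b i n m → (b ℕ.+ i) ℕ.+ (n ℕ.+ m) ≡ b ℕ.+ m ℕ.+ (n ℕ.+ i)
  lem₂ = ℕ-Solver.solve-∀

triAt-≤ : ∀ p i → triAt (p ℕ.+ i) i ≡ T p
triAt-≤ zero    zero    = refl
triAt-≤ (suc p) zero    = cong (λ k → T (suc k)) (ℕₚ.+-identityʳ p)
triAt-≤ p       (suc i) = trans (cong (λ k → triAt k (suc i)) (ℕₚ.+-suc p i)) (triAt-≤ p i)

n≤Tn : ∀ n → n ℕ.≤ T n
n≤Tn zero    = ℕ.z≤n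
n≤Tn (suc n) = ℕₚ.m≤m+n (suc n) (T n)

triAt-boundˡ : ∀ n i → n ℕ.≤ triAt n i ℕ.+ suc i
triAt-boundˡ zero    i       = ℕ.z≤n
triAt-boundˡ (suc n) zero    = ℕₚ.≤-trans (n≤Tn (suc n)) (ℕₚ.m≤m+n _ 1)
triAt-boundˡ (suc n) (suc i) = subst (suc n ℕ.≤_) (sym (ℕₚ.+-suc _ (suc i))) (ℕ.s≤s (triAt-boundˡ n i))

triAt-boundʳ : ∀ n i → i ℕ.≤ triAt n i ℕ.+ suc n
triAt-boundʳ n       zero    = ℕ.z≤n
triAt-boundʳ zero    (suc i) = subst (suc i ℕ.≤_) (ℕₚ.+-comm 1 (T i)) (ℕ.s≤s (n≤Tn i))
triAt-boundʳ (suc n) (suc i) = subst (suc i ℕ.≤_) (sym (ℕₚ.+-suc _ (suc n))) (ℕ.s≤s (triAt-boundʳ n i))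

alt : ℕ → ℤ
alt zero    = + 1
alt (suc n) = ℤ.- alt n

alt-+ : ∀ m n → alt (m ℕ.+ n) ≡ alt m ℤ.* alt n
alt-+ zero    n = sym (ℤₚ.*-identityˡ (alt n))
alt-+ (suc m) n = trans (cong ℤ.-_ (alt-+ m n)) (ℤₚ.neg-distribˡ-* (alt m) (alt n))

alt² : ∀ n → alt n ℤ.* alt n ≡ + 1
alt² zero    = refl
alt² (suc n) = trans (lem (alt n)) (alt² n)
  where
  lem : ∀ a → (ℤ.- a) ℤ.* (ℤ.- a) ≡ a ℤ.* a
  lem = solve-∀

-- Finite forms of the theta series

1+≤ : ℕ → Series
1+≤ zero    = C (+ 1)
1+≤ (suc K) = 1+ (suc K) ⊗ 1+≤ K

-- The summands of the finite forms of Σ q^{x(x-1)/2}, Σ (-1)^x q^{x(x-1)/2} and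
-- Σ (-1)^x x q^{x(x-1)/2}, where x = i - n and the sign (-1)^n is dropped.
ω⁺ ω⁻ ωʲ : ℕ → ℕ → Series
ω⁺ n i = xp (triAt n i)
ω⁻ n i = C (alt i) ⊗ xp (triAt n i)
ωʲ n i = C (alt i ℤ.* (+ i ℤ.- + n)) ⊗ xp (triAt n i)

xp-shift : ∀ n m p i → p ℕ.+ i ≡ n ℕ.+ m → xp (triAt n (suc i)) ⊗ xp p ≈ xp m ⊗ xp (triAt n i)
xp-shift n m p i e = ≈-trans (≈-sym (xp-+ (triAt n (suc i)) p)) (≈-trans
  (subst (λ k → xp (triAt n (suc i) ℕ.+ p) ≈ xp k) (trans (triAt-shift n m p i e) (ℕₚ.+-comm (triAt n i) m)) ≈-refl)
  (xp-+ m (triAt n i)))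

C-neg-⊗ : ∀ c f → C (ℤ.- c) ⊗ f ≈ ⊖ (C c ⊗ f)
C-neg-⊗ c f = ≈-trans (⊗-congˡ f (C-⊖ c)) (solve 2 (λ c f → (:- c) :* f := :- (c :* f)) ≈-refl (C c) f)

B⁺-suc : ∀ n m → B (suc (n ℕ.+ m)) 0 (ω⁺ n) ≈ 1+ m ⊗ B (n ℕ.+ m) 0 (ω⁺ n)
B⁺-suc n m = ≈-trans (B-recurrence (n ℕ.+ m) (xp m) (ω⁺ n) (ω⁺ n) (xp-shift n m))
  (solve 2 (λ x b → b :+ x :* b := (con (+ 1) :+ x) :* b) ≈-refl (xp m) (B (n ℕ.+ m) 0 (ω⁺ n)))

ω⁻-shift : ∀ n m p i → p ℕ.+ i ≡ n ℕ.+ m → ω⁻ n (suc i) ⊗ xp p ≈ (⊖ xp m) ⊗ ω⁻ n i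
ω⁻-shift n m p i e = begin
  C (ℤ.- alt i) ⊗ w′ ⊗ xp p    ≈⟨ ⊗-congˡ (xp p) (C-neg-⊗ (alt i) w′) ⟩
  ⊖ (C (alt i) ⊗ w′) ⊗ xp p    ≈⟨ solve 3 (λ c w x → (:- (c :* w)) :* x := (:- c) :* (w :* x)) ≈-refl (C (alt i)) w′ (xp p) ⟩
  ⊖ C (alt i) ⊗ (w′ ⊗ xp p)    ≈⟨ ⊗-congʳ (⊖ C (alt i)) (xp-shift n m p i e) ⟩
  ⊖ C (alt i) ⊗ (xp m ⊗ w)     ≈⟨ solve 3 (λ c w x → (:- c) :* (x :* w) := (:- x) :* (c :* w)) ≈-refl (C (alt i)) w (xp m) ⟩
  (⊖ xp m) ⊗ (C (alt i) ⊗ w)   ∎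
  where
  open ≈-Reasoning
  w′ w : Series
  w′ = xp (triAt n (suc i))
  w = xp (triAt n i)

B⁻-suc : ∀ n m → B (suc (n ℕ.+ m)) 0 (ω⁻ n) ≈ 1- m ⊗ B (n ℕ.+ m) 0 (ω⁻ n)
B⁻-suc n m = ≈-trans (B-recurrence (n ℕ.+ m) (⊖ xp m) (ω⁻ n) (ω⁻ n) (ω⁻-shift n m))
  (solve 2 (λ x b → b :+ (:- x) :* b := (con (+ 1) :+ :- x) :* b) ≈-refl (xp m) (B (n ℕ.+ m) 0 (ω⁻ n)))

-- A shift of i raises the factor i - n by 1, which produces the term without that factor, as in the
-- product rule.
Bʲ-suc : ∀ n m → B (suc (n ℕ.+ m)) 0 (ωʲ n) ≈
  1- m ⊗ B (n ℕ.+ m) 0 (ωʲ n) ⊕ ⊖ (xp m ⊗ B (n ℕ.+ m) 0 (ω⁻ n))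
Bʲ-suc n m = ≈-trans (B-recurrence (n ℕ.+ m) (⊖ xp m) (ωʲ n) (λ i → ωʲ n i ⊕ ω⁻ n i) shifted)
  (≈-trans (⊕-congʳ (B (n ℕ.+ m) 0 (ωʲ n)) (⊗-congʳ (⊖ xp m) additive))
    (solve 3 (λ x b c → b :+ (:- x) :* (b :+ c) := (con (+ 1) :+ :- x) :* b :+ :- (x :* c)) ≈-refl
      (xp m) (B (n ℕ.+ m) 0 (ωʲ n)) (B (n ℕ.+ m) 0 (ω⁻ n))))
  where
  open ≈-Reasoning
  additive : B (n ℕ.+ m) 0 (λ i → ωʲ n i ⊕ ω⁻ n i) ≈ B (n ℕ.+ m) 0 (ωʲ n) ⊕ B (n ℕ.+ m) 0 (ω⁻ n)
  additive = ≈-trans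
    (anti-cong (n ℕ.+ m) 0 refl (λ p i _ → solve 3 (λ a b h → (a :+ b) :* h := a :* h :+ b :* h) ≈-refl (ωʲ n i) (ω⁻ n i) (H p i)))
    (anti-⊕ (n ℕ.+ m) 0 (λ p i → ωʲ n i ⊗ H p i) (λ p i → ω⁻ n i ⊗ H p i))
  lem : ∀ a i n → (ℤ.- a) ℤ.* (+ 1 ℤ.+ i ℤ.- n) ≡ (i ℤ.- n ℤ.+ + 1) ℤ.* (ℤ.- a)
  lem = solve-∀
  lem′ : ∀ a x → a ℤ.* x ≡ x ℤ.* a
  lem′ = solve-∀
  shifted : ∀ p i → p ℕ.+ i ≡ n ℕ.+ m → ωʲ n (suc i) ⊗ xp p ≈ (⊖ xp m) ⊗ (ωʲ n i ⊕ ω⁻ n i)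
  shifted p i e = begin
    C ((ℤ.- alt i) ℤ.* (+ suc i ℤ.- + n)) ⊗ w′ ⊗ xp p
      ≈⟨ ⊗-congˡ (xp p) (⊗-congˡ w′ (≈-trans (C-cong (lem (alt i) (+ i) (+ n)))
           (≈-trans (C-⊗ (x ℤ.+ + 1) (ℤ.- alt i)) (⊗-congˡ (C (ℤ.- alt i)) (C-⊕ x (+ 1)))))) ⟩
    (C x ⊕ C (+ 1)) ⊗ C (ℤ.- alt i) ⊗ w′ ⊗ xp p
      ≈⟨ solve 4 (λ c d w x → c :* d :* w :* x := c :* (d :* w :* x)) ≈-refl (C x ⊕ C (+ 1)) (C (ℤ.- alt i)) w′ (xp p) ⟩
    (C x ⊕ C (+ 1)) ⊗ (ω⁻ n (suc i) ⊗ xp p)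
      ≈⟨ ⊗-congʳ (C x ⊕ C (+ 1)) (ω⁻-shift n m p i e) ⟩
    (C x ⊕ C (+ 1)) ⊗ ((⊖ xp m) ⊗ (C (alt i) ⊗ w))
      ≈⟨ solve 4 (λ c x a w → (c :+ con (+ 1)) :* ((:- x) :* (a :* w)) := (:- x) :* (c :* a :* w :+ a :* w)) ≈-refl
           (C x) (xp m) (C (alt i)) w ⟩
    (⊖ xp m) ⊗ (C x ⊗ C (alt i) ⊗ w ⊕ C (alt i) ⊗ w)
      ≈⟨ ⊗-congʳ (⊖ xp m) (⊕-congˡ (C (alt i) ⊗ w) (⊗-congˡ w
           (≈-trans (≈-sym (C-⊗ x (alt i))) (C-cong (lem′ x (alt i)))))) ⟩
    (⊖ xp m) ⊗ (ωʲ n i ⊕ ω⁻ n i) ∎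
    where
    w′ w : Series
    w′ = xp (triAt n (suc i))
    w = xp (triAt n i)
    x : ℤ
    x = + i ℤ.- + n

T-shift : ∀ N p i → p ℕ.+ i ≡ N → xp (T (suc i)) ⊗ xp p ≈ xp (suc N) ⊗ xp (T i)
T-shift N p i e = ≈-trans (≈-sym (xp-+ (T (suc i)) p)) (≈-trans
  (subst (λ k → xp (T (suc i) ℕ.+ p) ≈ xp k) (trans (lem p i (T i)) (cong (λ k → suc k ℕ.+ T i) e)) ≈-refl)
  (xp-+ (suc N) (T i)))
  where
  lem : ∀ p i t → suc i ℕ.+ t ℕ.+ p ≡ suc (p ℕ.+ i) ℕ.+ t
  lem = ℕ-Solver.solve-∀

B-T⁺ : ∀ N → B N 0 (λ i → xp (T i)) ≈ 1+≤ N
B-T⁺ zero    = 1⊗ (C (+ 1))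
B-T⁺ (suc N) = ≈-trans (B-recurrence N (xp (suc N)) _ (λ i → xp (T i)) (T-shift N))
  (≈-trans (solve 2 (λ x b → b :+ x :* b := (con (+ 1) :+ x) :* b) ≈-refl (xp (suc N)) (B N 0 (λ i → xp (T i))))
    (⊗-congʳ (1+ (suc N)) (B-T⁺ N)))

B-T⁻ : ∀ N → B N 0 (λ i → C (alt i) ⊗ xp (T i)) ≈ E≤ N
B-T⁻ zero    = solve 0 (con (+ 1) :* con (+ 1) :* con (+ 1) := con (+ 1)) ≈-refl
B-T⁻ (suc N) = ≈-trans (B-recurrence N (⊖ xp (suc N)) _ (λ i → C (alt i) ⊗ xp (T i)) shifted)
  (≈-trans (solve 2 (λ x b → b :+ (:- x) :* b := (con (+ 1) :+ :- x) :* b) ≈-refl (xp (suc N)) (B N 0 (λ i → C (alt i) ⊗ xp (T i))))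
    (⊗-congʳ (1- (suc N)) (B-T⁻ N)))
  where
  shifted : ∀ p i → p ℕ.+ i ≡ N → C (alt (suc i)) ⊗ xp (T (suc i)) ⊗ xp p ≈ (⊖ xp (suc N)) ⊗ (C (alt i) ⊗ xp (T i))
  shifted p i e = begin
    C (ℤ.- alt i) ⊗ w′ ⊗ xp p       ≈⟨ ⊗-congˡ (xp p) (C-neg-⊗ (alt i) w′) ⟩
    ⊖ (C (alt i) ⊗ w′) ⊗ xp p       ≈⟨ solve 3 (λ c w x → (:- (c :* w)) :* x := (:- c) :* (w :* x)) ≈-refl (C (alt i)) w′ (xp p) ⟩
    ⊖ C (alt i) ⊗ (w′ ⊗ xp p)       ≈⟨ ⊗-congʳ (⊖ C (alt i)) (T-shift N p i e) ⟩
    ⊖ C (alt i) ⊗ (xp (suc N) ⊗ w)  ≈⟨ solve 3 (λ c w x → (:- c) :* (x :* w) := (:- x) :* (c :* w)) ≈-refl (C (alt i)) w (xp (suc N)) ⟩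
    (⊖ xp (suc N)) ⊗ (C (alt i) ⊗ w) ∎
    where
    open ≈-Reasoning
    w′ w : Series
    w′ = xp (T (suc i))
    w = xp (T i)

-- For p + i = n the exponent `triAt n i` is T(p), so the reversed antidiagonal is the sum in the
-- q-binomial theorem `B-T⁺`.
B⁺-base : ∀ n → B n 0 (ω⁺ n) ≈ 1+≤ n
B⁺-base n = ≈-trans (anti-cong n 0 (ℕₚ.+-identityʳ n) lem)
  (≈-trans (anti-flip n (λ p i → xp (T p) ⊗ H i p)) (B-T⁺ n))
  where
  lem : ∀ p i → p ℕ.+ i ≡ n → xp (triAt n i) ⊗ H p i ≈ xp (T p) ⊗ H i p
  lem p i refl rewrite triAt-≤ p i = ⊗-congʳ (xp (T p)) (H-sym p i)

B⁻-base : ∀ n → B n 0 (ω⁻ n) ≈ C (alt n) ⊗ E≤ n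
B⁻-base n = begin
  B n 0 (ω⁻ n)                                               ≈⟨ anti-cong n 0 (ℕₚ.+-identityʳ n) lem ⟩
  anti n 0 (λ p i → C (alt n) ⊗ (C (alt p) ⊗ xp (T p) ⊗ H i p)) ≈⟨ anti-⊗ (C (alt n)) n 0 (λ p i → C (alt p) ⊗ xp (T p) ⊗ H i p) ⟩
  C (alt n) ⊗ anti n 0 (λ p i → C (alt p) ⊗ xp (T p) ⊗ H i p) ≈⟨ ⊗-congʳ (C (alt n)) (anti-flip n (λ p i → C (alt p) ⊗ xp (T p) ⊗ H i p)) ⟩
  C (alt n) ⊗ B n 0 (λ i → C (alt i) ⊗ xp (T i))             ≈⟨ ⊗-congʳ (C (alt n)) (B-T⁻ n) ⟩
  C (alt n) ⊗ E≤ n ∎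
  where
  open ≈-Reasoning
  sign : ∀ a b → a ℤ.* a ≡ + 1 → b ≡ a ℤ.* b ℤ.* a
  sign a b e = trans (sym (ℤₚ.*-identityˡ b)) (trans (cong (ℤ._* b) (sym e)) (l a b))
    where
    l : ∀ a b → a ℤ.* a ℤ.* b ≡ a ℤ.* b ℤ.* a
    l = solve-∀
  lem : ∀ p i → p ℕ.+ i ≡ n → C (alt i) ⊗ xp (triAt n i) ⊗ H p i ≈ C (alt n) ⊗ (C (alt p) ⊗ xp (T p) ⊗ H i p)
  lem p i refl rewrite triAt-≤ p i = begin
    C (alt i) ⊗ xp (T p) ⊗ H p i
      ≈⟨ ⊗-cong (⊗-congˡ (xp (T p)) (≈-trans (C-cong (trans (sign (alt p) (alt i) (alt² p)) (cong (ℤ._* alt p) (sym (alt-+ p i)))))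
           (C-⊗ (alt (p ℕ.+ i)) (alt p)))) (H-sym p i) ⟩
    C (alt (p ℕ.+ i)) ⊗ C (alt p) ⊗ xp (T p) ⊗ H i p
      ≈⟨ solve 4 (λ a b c d → a :* b :* c :* d := a :* (b :* c :* d)) ≈-refl (C (alt (p ℕ.+ i))) (C (alt p)) (xp (T p)) (H i p) ⟩
    C (alt (p ℕ.+ i)) ⊗ (C (alt p) ⊗ xp (T p) ⊗ H i p) ∎

-- A finite form of the Jacobi triple product. `B⁺-base` gives the factors 1 + q^k with k ≤ n,
-- repeated use of `B⁺-suc` gives those with k ≤ m, and 2 is the factor 1 + q^0.
B⁺-eval : ∀ n m → B (suc (n ℕ.+ m)) 0 (ω⁺ n) ≈ C (+ 2) ⊗ (1+≤ m ⊗ 1+≤ n)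
B⁺-eval n zero    = ≈-trans (B⁺-suc n 0) (≈-trans
  (⊗-congʳ (1+ 0) (subst (λ k → B k 0 (ω⁺ n) ≈ 1+≤ n) (sym (ℕₚ.+-identityʳ n)) (B⁺-base n)))
  (solve 1 (λ x → (con (+ 1) :+ con (+ 1)) :* x := con (+ 2) :* (con (+ 1) :* x)) ≈-refl (1+≤ n)))
B⁺-eval n (suc m) = ≈-trans (B⁺-suc n (suc m)) (≈-trans
  (⊗-congʳ (1+ (suc m)) (subst (λ k → B k 0 (ω⁺ n) ≈ C (+ 2) ⊗ (1+≤ m ⊗ 1+≤ n)) (sym (ℕₚ.+-suc n m)) (B⁺-eval n m)))
  (solve 3 (λ u x y → u :* (con (+ 2) :* (x :* y)) := con (+ 2) :* (u :* x :* y)) ≈-refl (1+ (suc m)) (1+≤ m) (1+≤ n)))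

-- The factor 1 - q^0 is among the factors collected by `B⁻-suc`.
B⁻-eval : ∀ n m → B (suc (n ℕ.+ m)) 0 (ω⁻ n) ≈ C (+ 0)
B⁻-eval n zero    = ≈-trans (B⁻-suc n 0)
  (solve 1 (λ x → (con (+ 1) :+ :- con (+ 1)) :* x := con (+ 0)) ≈-refl (B (n ℕ.+ 0) 0 (ω⁻ n)))
B⁻-eval n (suc m) = ≈-trans (B⁻-suc n (suc m)) (≈-trans
  (⊗-congʳ (1- (suc m)) (subst (λ k → B k 0 (ω⁻ n) ≈ C (+ 0)) (sym (ℕₚ.+-suc n m)) (B⁻-eval n m)))
  (solve 1 (λ u → u :* con (+ 0) := con (+ 0)) ≈-refl (1- (suc m))))

-- This is the derivative of a product at a zero: only the term in which the vanishing factor 1 -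
-- q^0 is differentiated survives. That term enters at m = 0, and `B⁻-eval` removes the
-- inhomogeneous part of all later steps.
Bʲ-eval : ∀ n m → B (suc (n ℕ.+ m)) 0 (ωʲ n) ≈ ⊖ (C (alt n) ⊗ (E≤ m ⊗ E≤ n))
Bʲ-eval n zero    = ≈-trans (Bʲ-suc n 0) (≈-trans
  (⊕-congʳ (1- 0 ⊗ B (n ℕ.+ 0) 0 (ωʲ n)) (⊖-cong (⊗-congʳ (xp 0)
    (subst (λ k → B k 0 (ω⁻ n) ≈ C (alt n) ⊗ E≤ n) (sym (ℕₚ.+-identityʳ n)) (B⁻-base n)))))
  (solve 3 (λ b a e → (con (+ 1) :+ :- con (+ 1)) :* b :+ :- (con (+ 1) :* (a :* e)) := :- (a :* (con (+ 1) :* e)))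
    ≈-refl (B (n ℕ.+ 0) 0 (ωʲ n)) (C (alt n)) (E≤ n)))
Bʲ-eval n (suc m) = ≈-trans (Bʲ-suc n (suc m)) (≈-trans
  (⊕-cong
    (⊗-congʳ (1- (suc m)) (subst (λ k → B k 0 (ωʲ n) ≈ ⊖ (C (alt n) ⊗ (E≤ m ⊗ E≤ n))) (sym (ℕₚ.+-suc n m)) (Bʲ-eval n m)))
    (⊖-cong (⊗-congʳ (xp (suc m)) (subst (λ k → B k 0 (ω⁻ n) ≈ C (+ 0)) (sym (ℕₚ.+-suc n m)) (B⁻-eval n m)))))
  (solve 5 (λ u x a e f → u :* (:- (a :* (e :* f))) :+ :- (x :* con (+ 0)) := :- (a :* (u :* e :* f))) ≈-refl
    (1- (suc m)) (xp (suc m)) (C (alt n)) (E≤ m) (E≤ n)))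

-- Limits of the finite forms

-- With m the smaller of p and i, `E≤ n ⊗ H p i` is 1 modulo q^(m + 1). Towards the ends of the
-- antidiagonal m is small, but there `triAt n i` is at least n - m - 1, so no error appears below
-- q^n.
weighted-limit : ∀ n (c : ℕ → ℤ) → E≤ n ⊗ B (suc (n ℕ.+ n)) 0 (λ i → C (c i) ⊗ xp (triAt n i))
                 ≈[ n ] anti (suc (n ℕ.+ n)) 0 (λ p i → C (c i) ⊗ xp (triAt n i))
weighted-limit n c = []-trans (≈⇒≈[] (≈-sym (anti-⊗ (E≤ n) N 0 (λ p i → C (c i) ⊗ xp (triAt n i) ⊗ H p i))))
  (anti-cong[] N 0 (ℕₚ.+-identityʳ N) term)
  where
  N : ℕ
  N = suc (n ℕ.+ n)
  core : ∀ p i m → m ℕ.≤ n → m ℕ.≤ p → m ℕ.≤ i → n ℕ.≤ triAt n i ℕ.+ suc m →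
         E≤ n ⊗ (C (c i) ⊗ xp (triAt n i) ⊗ H p i) ≈[ n ] C (c i) ⊗ xp (triAt n i)
  core p i m m≤n m≤p m≤i bound = []-trans
    (≈⇒≈[] (solve 4 (λ e c x h → e :* (c :* x :* h) := c :* (x :* (e :* h))) ≈-refl (E≤ n) (C (c i)) (xp (triAt n i)) (H p i)))
    ([]-trans ([]-⊗ʳ (C (c i)) ([]-weaken bound ([]-xp (triAt n i) (E≤-⊗-H≈1 m≤n m≤p m≤i))))
      (≈⇒≈[] (solve 2 (λ c x → c :* (x :* con (+ 1)) := c :* x) ≈-refl (C (c i)) (xp (triAt n i)))))
  term : ∀ p i → p ℕ.+ i ≡ N →
         E≤ n ⊗ (C (c i) ⊗ xp (triAt n i) ⊗ H p i) ≈[ n ] C (c i) ⊗ xp (triAt n i)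
  term p i e with ℕₚ.≤-total i n
  ... | inj₁ i≤n = core p i i i≤n i≤p ℕₚ.≤-refl (triAt-boundˡ n i)
    where
    i≤p : i ℕ.≤ p
    i≤p = ℕₚ.+-cancelʳ-≤ n i p (ℕₚ.≤-trans (ℕₚ.+-monoˡ-≤ n i≤n) (ℕₚ.≤-trans (ℕₚ.n≤1+n (n ℕ.+ n))
      (ℕₚ.≤-trans (ℕₚ.≤-reflexive (sym e)) (ℕₚ.+-monoʳ-≤ p i≤n))))
  ... | inj₂ n≤i with ℕₚ.m≤n⇒m<n∨m≡n n≤i
  ...   | inj₂ refl = core p n n ℕₚ.≤-refl
            (ℕₚ.+-cancelʳ-≤ n n p (ℕₚ.≤-trans (ℕₚ.n≤1+n (n ℕ.+ n)) (ℕₚ.≤-reflexive (sym e)))) ℕₚ.≤-refl (triAt-boundˡ n n)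
  ...   | inj₁ n<i = core p i p p≤n ℕₚ.≤-refl (ℕₚ.≤-trans p≤n n≤i)
            (ℕₚ.≤-trans (ℕₚ.n≤1+n n) (ℕₚ.+-cancelʳ-≤ (suc n) (suc n) (triAt n i ℕ.+ suc p)
              (ℕₚ.≤-trans (ℕₚ.≤-reflexive (trans (cong suc (ℕₚ.+-suc n n)) (cong suc (sym e))))
              (ℕₚ.≤-trans (ℕₚ.≤-reflexive (cong suc (ℕₚ.+-comm p i)))
              (ℕₚ.≤-trans (ℕₚ.≤-reflexive (sym (ℕₚ.+-suc i p)))
              (ℕₚ.≤-trans (ℕₚ.+-monoˡ-≤ (suc p) (triAt-boundʳ n i)) (ℕₚ.≤-reflexive (lem (triAt n i) n p))))))))
    where
    lem : ∀ a n p → a ℕ.+ suc n ℕ.+ suc p ≡ a ℕ.+ suc p ℕ.+ suc n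
    lem = ℕ-Solver.solve-∀
    p≤n : p ℕ.≤ n
    p≤n = ℕₚ.+-cancelʳ-≤ (suc n) p n (ℕₚ.≤-trans (ℕₚ.+-monoʳ-≤ p n<i) (ℕₚ.≤-reflexive (trans e (sym (ℕₚ.+-suc n n)))))

E≤-⊗-1+≤ : ∀ K → E≤ K ⊗ 1+≤ K ≈ dil 2 (E≤ K)
E≤-⊗-1+≤ zero    = ≈-trans (1⊗ (C (+ 1))) (≈-sym (dil-C 1 (+ 1)))
E≤-⊗-1+≤ (suc K) = begin
  1- k ⊗ E≤ K ⊗ (1+ k ⊗ 1+≤ K)
    ≈⟨ solve 4 (λ u e v p → u :* e :* (v :* p) := (u :* v) :* (e :* p)) ≈-refl (1- k) (E≤ K) (1+ k) (1+≤ K) ⟩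
  (1- k ⊗ 1+ k) ⊗ (E≤ K ⊗ 1+≤ K)
    ≈⟨ ⊗-cong (≈-sym (dil-2-1- k)) (E≤-⊗-1+≤ K) ⟩
  dil 2 (1- k) ⊗ dil 2 (E≤ K)
    ≈⟨ dil-⊗ 1 (1- k) (E≤ K) ⟨
  dil 2 (1- k ⊗ E≤ K) ∎
  where
  open ≈-Reasoning
  k : ℕ
  k = suc K

-- The hypothesis compares Ψ modulo q^n with its terms for x ∈ [-n, n + 1].
Ψ-product : ∀ Ψ → (∀ n → Ψ ≈[ n ] anti (suc (n ℕ.+ n)) 0 (λ p i → C (+ 1) ⊗ xp (triAt n i))) →
            Ψ ⊗ E ≈ C (+ 2) ⊗ (dil 2 E ⊗ dil 2 E)
Ψ-product Ψ h = ≈[]⇒≈ λ n → []-trans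
  ([]-⊗ ([]-trans (h n) ([]-sym (weighted-limit n (λ _ → + 1)))) (E≈[] (ℕₚ.n≤1+n n)))
  ([]-trans (≈⇒≈[] (exact n))
    ([]-⊗ʳ (C (+ 2)) ([]-⊗ ([]-dil 1 ([]-sym (E≈[] (ℕₚ.n≤1+n n)))) ([]-dil 1 ([]-sym (E≈[] (ℕₚ.n≤1+n n)))))))
  where
  open ≈-Reasoning
  exact : ∀ n → E≤ n ⊗ B (suc (n ℕ.+ n)) 0 (λ i → C (+ 1) ⊗ xp (triAt n i)) ⊗ E≤ n ≈ C (+ 2) ⊗ (dil 2 (E≤ n) ⊗ dil 2 (E≤ n))
  exact n = begin
    E≤ n ⊗ B (suc (n ℕ.+ n)) 0 (λ i → C (+ 1) ⊗ xp (triAt n i)) ⊗ E≤ n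
      ≈⟨ ⊗-congˡ (E≤ n) (⊗-congʳ (E≤ n) (≈-trans (B-cong (suc (n ℕ.+ n)) (λ i → 1⊗ (xp (triAt n i)))) (B⁺-eval n n))) ⟩
    E≤ n ⊗ (C (+ 2) ⊗ (1+≤ n ⊗ 1+≤ n)) ⊗ E≤ n
      ≈⟨ solve 2 (λ e p → e :* (con (+ 2) :* (p :* p)) :* e := con (+ 2) :* ((e :* p) :* (e :* p))) ≈-refl (E≤ n) (1+≤ n) ⟩
    C (+ 2) ⊗ ((E≤ n ⊗ 1+≤ n) ⊗ (E≤ n ⊗ 1+≤ n))
      ≈⟨ ⊗-congʳ (C (+ 2)) (⊗-cong (E≤-⊗-1+≤ n) (E≤-⊗-1+≤ n)) ⟩
    C (+ 2) ⊗ (dil 2 (E≤ n) ⊗ dil 2 (E≤ n)) ∎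

-- Jacobi's formula, with x over all integers and weight (-1)^x x; pairing x with 1 - x gives the
-- usual weight (-1)^x (2x - 1) over x ≥ 1. The sign (-1)^n of the weights cancels the one in
-- `Bʲ-eval`.
E³-series : ∀ J → (∀ n → J ≈[ n ] anti (suc (n ℕ.+ n)) 0 (λ p i → C (alt n ℤ.* (alt i ℤ.* (+ i ℤ.- + n))) ⊗ xp (triAt n i))) →
            J ≈ ⊖ (E ⊗ E ⊗ E)
E³-series J h = ≈[]⇒≈ λ n → []-trans
  ([]-trans (h n) ([]-sym (weighted-limit n (λ i → alt n ℤ.* (alt i ℤ.* (+ i ℤ.- + n))))))
  ([]-trans (≈⇒≈[] (exact n)) (≈[]-⊖ n (E³ n)))
  where
  open ≈-Reasoning
  ≈[]-⊖ : ∀ n {f g} → f ≈[ n ] g → ⊖ f ≈[ n ] ⊖ g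
  ≈[]-⊖ n p = below λ i q → cong ℤ.-_ (at< p i q)
  E³ : ∀ n → E≤ n ⊗ E≤ n ⊗ E≤ n ≈[ n ] E ⊗ E ⊗ E
  E³ n = []-⊗ ([]-⊗ e e) e
    where
    e : E≤ n ≈[ n ] E
    e = []-sym (E≈[] (ℕₚ.n≤1+n n))
  exact : ∀ n → E≤ n ⊗ B (suc (n ℕ.+ n)) 0 (λ i → C (alt n ℤ.* (alt i ℤ.* (+ i ℤ.- + n))) ⊗ xp (triAt n i)) ≈ ⊖ (E≤ n ⊗ E≤ n ⊗ E≤ n)
  exact n = begin
    E≤ n ⊗ B N 0 (λ i → C (alt n ℤ.* (alt i ℤ.* (+ i ℤ.- + n))) ⊗ xp (triAt n i))
      ≈⟨ ⊗-congʳ (E≤ n) (≈-trans (anti-cong N 0 (ℕₚ.+-identityʳ N) (λ p i _ → term p i)) (anti-⊗ (C (alt n)) N 0 (λ p i → ωʲ n i ⊗ H p i))) ⟩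
    E≤ n ⊗ (C (alt n) ⊗ B N 0 (ωʲ n))
      ≈⟨ ⊗-congʳ (E≤ n) (⊗-congʳ (C (alt n)) (Bʲ-eval n n)) ⟩
    E≤ n ⊗ (C (alt n) ⊗ ⊖ (C (alt n) ⊗ (E≤ n ⊗ E≤ n)))
      ≈⟨ solve 2 (λ e a → e :* (a :* (:- (a :* (e :* e)))) := :- (a :* a :* (e :* e :* e))) ≈-refl (E≤ n) (C (alt n)) ⟩
    ⊖ (C (alt n) ⊗ C (alt n) ⊗ (E≤ n ⊗ E≤ n ⊗ E≤ n))
      ≈⟨ ⊖-cong (≈-trans (⊗-congˡ (E≤ n ⊗ E≤ n ⊗ E≤ n) (≈-trans (≈-sym (C-⊗ (alt n) (alt n))) (C-cong (alt² n)))) (1⊗ (E≤ n ⊗ E≤ n ⊗ E≤ n))) ⟩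
    ⊖ (E≤ n ⊗ E≤ n ⊗ E≤ n) ∎
    where
    N : ℕ
    N = suc (n ℕ.+ n)
    term : ∀ p i → C (alt n ℤ.* (alt i ℤ.* (+ i ℤ.- + n))) ⊗ xp (triAt n i) ⊗ H p i ≈ C (alt n) ⊗ (ωʲ n i ⊗ H p i)
    term p i = ≈-trans (⊗-congˡ (H p i) (⊗-congˡ (xp (triAt n i)) (C-⊗ (alt n) (alt i ℤ.* (+ i ℤ.- + n)))))
      (solve 4 (λ a b x h → a :* b :* x :* h := a :* (b :* x :* h)) ≈-refl (C (alt n)) (C (alt i ℤ.* (+ i ℤ.- + n))) (xp (triAt n i)) (H p i))

-- The logarithmic derivative of ∏(1 - q^k) and the series a(n)

double : ℕ → ℕ
double zero    = zero
double (suc n) = suc (suc (double n))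

double-+ : ∀ n → double n ≡ n ℕ.+ n
double-+ zero    = refl
double-+ (suc n) = cong suc (trans (cong suc (double-+ n)) (sym (ℕₚ.+-suc n n)))

odd≤ : ℕ → Series
odd≤ zero    = C (+ 1)
odd≤ (suc n) = 1- (suc (double n)) ⊗ odd≤ n

E≤-double : ∀ n → E≤ (double n) ≈ odd≤ n ⊗ dil 2 (E≤ n)
E≤-double zero    = ≈-sym (≈-trans (1⊗ (dil 2 (C (+ 1)))) (dil-C 1 (+ 1)))
E≤-double (suc n) = begin
  1- (2 ℕ.+ double n) ⊗ (1- (suc (double n)) ⊗ E≤ (double n))
    ≈⟨ ⊗-cong (subst (λ j → 1- (2 ℕ.+ double n) ≈ 1- j) (trans (cong (2 ℕ.+_) (double-+ n)) (lem n)) ≈-refl)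
         (⊗-congʳ (1- (suc (double n))) (E≤-double n)) ⟩
  1- (suc n ℕ.* 2) ⊗ (1- (suc (double n)) ⊗ (odd≤ n ⊗ dil 2 (E≤ n)))
    ≈⟨ ⊗-congˡ (1- (suc (double n)) ⊗ (odd≤ n ⊗ dil 2 (E≤ n))) (≈-sym (dil-1- 1 (suc n))) ⟩
  dil 2 (1- (suc n)) ⊗ (1- (suc (double n)) ⊗ (odd≤ n ⊗ dil 2 (E≤ n)))
    ≈⟨ solve 4 (λ a b o e → a :* (b :* (o :* e)) := b :* o :* (a :* e)) ≈-refl
         (dil 2 (1- (suc n))) (1- (suc (double n))) (odd≤ n) (dil 2 (E≤ n)) ⟩
  1- (suc (double n)) ⊗ odd≤ n ⊗ (dil 2 (1- (suc n)) ⊗ dil 2 (E≤ n))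
    ≈⟨ ⊗-congʳ (1- (suc (double n)) ⊗ odd≤ n) (dil-⊗ 1 (1- (suc n)) (E≤ n)) ⟨
  odd≤ (suc n) ⊗ dil 2 (E≤ (suc n)) ∎
  where
  open ≈-Reasoning
  lem : ∀ n → 2 ℕ.+ (n ℕ.+ n) ≡ (1 ℕ.+ n) ℕ.* 2
  lem = ℕ-Solver.solve-∀

sgn-⊖ : ∀ f → sgn (⊖ f) ≈ ⊖ sgn f
sgn-⊖ f = pointwise (go f)
  where
  go : ∀ f n → sgn (⊖ f) n ≡ ℤ.- sgn f n
  go f zero    = refl
  go f (suc n) = cong ℤ.-_ (go (tail f) n)

sgn-shift : ∀ f → sgn (shift f) ≈ ⊖ shift (sgn f)
sgn-shift f = pointwise λ { zero → refl ; (suc n) → refl }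

sgn-xp-double : ∀ n → sgn (xp (double n)) ≈ xp (double n)
sgn-xp-double zero    = sgn-C (+ 1)
sgn-xp-double (suc n) = pointwise λ
  { zero → refl ; (suc zero) → refl
  ; (suc (suc i)) → trans (ℤₚ.neg-involutive _) (at (sgn-xp-double n) i) }

sgn-1--odd : ∀ n → sgn (1- (suc (double n))) ≈ 1+ (suc (double n))
sgn-1--odd n = ≈-trans (sgn-⊕ (C (+ 1)) (⊖ x)) (⊕-cong (sgn-C (+ 1))
  (≈-trans (sgn-⊖ x) (≈-trans (⊖-cong (≈-trans (sgn-shift (xp (double n))) (⊖-cong (shift-cong (sgn-xp-double n)))))
    (solve 1 (λ x → :- (:- x) := x) ≈-refl x))))
  where
  x : Series
  x = xp (suc (double n))

odd≤-sgn : ∀ n → odd≤ n ⊗ sgn (odd≤ n) ≈ dil 2 (odd≤ n)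
odd≤-sgn zero    = ≈-trans (1⊗ (sgn (C (+ 1)))) (≈-trans (sgn-C (+ 1)) (≈-sym (dil-C 1 (+ 1))))
odd≤-sgn (suc n) = begin
  1- k ⊗ odd≤ n ⊗ sgn (1- k ⊗ odd≤ n)
    ≈⟨ ⊗-congʳ (1- k ⊗ odd≤ n) (≈-trans (sgn-⊗ (1- k) (odd≤ n)) (⊗-congˡ (sgn (odd≤ n)) (sgn-1--odd n))) ⟩
  1- k ⊗ odd≤ n ⊗ (1+ k ⊗ sgn (odd≤ n))
    ≈⟨ solve 4 (λ a o b s → a :* o :* (b :* s) := a :* b :* (o :* s)) ≈-refl (1- k) (odd≤ n) (1+ k) (sgn (odd≤ n)) ⟩
  1- k ⊗ 1+ k ⊗ (odd≤ n ⊗ sgn (odd≤ n))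
    ≈⟨ ⊗-cong (≈-sym (dil-2-1- k)) (odd≤-sgn n) ⟩
  dil 2 (1- k) ⊗ dil 2 (odd≤ n)
    ≈⟨ dil-⊗ 1 (1- k) (odd≤ n) ⟨
  dil 2 (odd≤ (suc n)) ∎
  where
  open ≈-Reasoning
  k : ℕ
  k = suc (double n)

-- With O the product of 1 - q^k over odd k, E = O E₂ and O(q) O(-q) = O(q²). Hence E(-q) E E₄ is
-- E₂² times (O E₂)(q²), and the last factor is E₂ again.
E-sgn : sgn E ⊗ E ⊗ dil 4 E ≈ dil 2 E ⊗ dil 2 E ⊗ dil 2 E
E-sgn = ≈[]⇒≈ λ n → []-trans
  ([]-⊗ ([]-⊗ ([]-sgn (big n)) (big n)) ([]-dil 3 (small n)))
  ([]-trans (≈⇒≈[] (exact n))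
    ([]-sym ([]-⊗ ([]-⊗ ([]-dil 1 (small n)) ([]-dil 1 (small n))) ([]-dil 1 (big n)))))
  where
  open ≈-Reasoning
  -- The splitting into odd and even exponents turns 2n factors of E into n factors of E₂, so two
  -- truncations of the same series are in use.
  big : ∀ n → E ≈[ n ] E≤ (double n)
  big n = E≈[] (ℕₚ.≤-trans (ℕₚ.≤-trans (ℕₚ.m≤m+n n n) (ℕₚ.≤-reflexive (sym (double-+ n)))) (ℕₚ.n≤1+n _))
  small : ∀ n → E ≈[ n ] E≤ n
  small n = E≈[] (ℕₚ.n≤1+n n)
  exact : ∀ n → sgn (E≤ (double n)) ⊗ E≤ (double n) ⊗ dil 4 (E≤ n) ≈ dil 2 (E≤ n) ⊗ dil 2 (E≤ n) ⊗ dil 2 (E≤ (double n))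
  exact n = begin
    sgn (E≤ (double n)) ⊗ E≤ (double n) ⊗ dil 4 (E≤ n)
      ≈⟨ ⊗-cong (⊗-cong (≈-trans (sgn-cong (E≤-double n)) (≈-trans (sgn-⊗ (odd≤ n) e₂)
           (⊗-congʳ (sgn (odd≤ n)) (sgn-dil-2 (E≤ n))))) (E≤-double n)) (≈-sym (dil-dil 1 1 (E≤ n))) ⟩
    sgn (odd≤ n) ⊗ e₂ ⊗ (odd≤ n ⊗ e₂) ⊗ dil 2 e₂
      ≈⟨ solve 4 (λ s e o f → s :* e :* (o :* e) :* f := e :* e :* ((o :* s) :* f)) ≈-refl (sgn (odd≤ n)) e₂ (odd≤ n) (dil 2 e₂) ⟩
    e₂ ⊗ e₂ ⊗ (odd≤ n ⊗ sgn (odd≤ n) ⊗ dil 2 e₂)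
      ≈⟨ ⊗-congʳ (e₂ ⊗ e₂) (≈-trans (⊗-congˡ (dil 2 e₂) (odd≤-sgn n)) (≈-trans (≈-sym (dil-⊗ 1 (odd≤ n) e₂))
           (dil-cong 2 (≈-sym (E≤-double n))))) ⟩
    e₂ ⊗ e₂ ⊗ dil 2 (E≤ (double n)) ∎
    where
    e₂ : Series
    e₂ = dil 2 (E≤ n)

-- Divisor sums as Lambert series

positives : Series
positives = shift (λ _ → + 1)

-- For k ≥ 1 this is q^k / (1 - q^k).
multiples : ℕ → Series
multiples k = dil k positives

1--multiples : ∀ k → 1- (suc k) ⊗ multiples (suc k) ≈ xp (suc k)
1--multiples k = begin
  1- (suc k) ⊗ multiples (suc k)
    ≈⟨ ⊗-congˡ (multiples (suc k)) (subst (λ j → 1- (suc k) ≈ 1- j) (sym (ℕₚ.*-identityˡ (suc k))) ≈-refl) ⟩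
  1- (1 ℕ.* suc k) ⊗ multiples (suc k)
    ≈⟨ ⊗-congˡ (multiples (suc k)) (dil-1- k 1) ⟨
  dil (suc k) (1- 1) ⊗ multiples (suc k)
    ≈⟨ dil-⊗ k (1- 1) positives ⟨
  dil (suc k) (1- 1 ⊗ positives)
    ≈⟨ dil-cong (suc k) base ⟩
  dil (suc k) (xp 1)
    ≈⟨ dil-xp k 1 ⟩
  xp (1 ℕ.* suc k)
    ≈⟨ subst (λ j → xp j ≈ xp (suc k)) (sym (ℕₚ.*-identityˡ (suc k))) ≈-refl ⟩
  xp (suc k) ∎
  where
  open ≈-Reasoning
  base : 1- 1 ⊗ positives ≈ xp 1
  base = ≈-trans (solve 2 (λ x p → (con (+ 1) :+ :- x) :* p := p :+ :- (x :* p)) ≈-refl (xp 1) positives)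
    (pointwise λ
      { zero → refl
      ; (suc zero) → refl
      ; (suc (suc n)) → cong (λ z → + 1 ℤ.- z) (xp-⊗-≥ 1 positives (suc n)) })

Σ-multiples : ℕ → Series
Σ-multiples zero    = C (+ 0)
Σ-multiples (suc K) = C (+ suc K) ⊗ multiples (suc K) ⊕ Σ-multiples K

-- The factor 1 - q^k contributes -k q^k / (1 - q^k) to the logarithmic derivative.
D-E≤ : ∀ K → D (E≤ K) ≈ ⊖ (E≤ K ⊗ Σ-multiples K)
D-E≤ zero    = ≈-trans (D-C (+ 1)) (solve 0 (con (+ 0) := :- (con (+ 1) :* con (+ 0))) ≈-refl)
D-E≤ (suc K) = begin
  D (1- k ⊗ E≤ K)
    ≈⟨ D-⊗ (1- k) (E≤ K) ⟩
  D (1- k) ⊗ E≤ K ⊕ 1- k ⊗ D (E≤ K)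
    ≈⟨ ⊕-cong (⊗-congˡ (E≤ K) D-1-) (⊗-congʳ (1- k) (D-E≤ K)) ⟩
  ⊖ (C (+ k) ⊗ (1- k ⊗ multiples k)) ⊗ E≤ K ⊕ 1- k ⊗ (⊖ (E≤ K ⊗ Σ-multiples K))
    ≈⟨ solve 5 (λ c u g e s → (:- (c :* (u :* g))) :* e :+ u :* (:- (e :* s)) := :- (u :* e :* (c :* g :+ s))) ≈-refl
         (C (+ k)) (1- k) (multiples k) (E≤ K) (Σ-multiples K) ⟩
  ⊖ (1- k ⊗ E≤ K ⊗ Σ-multiples k) ∎
  where
  open ≈-Reasoning
  k : ℕ
  k = suc K
  D-1- : D (1- k) ≈ ⊖ (C (+ k) ⊗ (1- k ⊗ multiples k))
  D-1- = begin
    D (1- k)                          ≈⟨ D-⊕ (C (+ 1)) (⊖ xp k) ⟩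
    D (C (+ 1)) ⊕ D (⊖ xp k)         ≈⟨ ⊕-cong (D-C (+ 1)) (pointwise λ n → sym (ℤₚ.neg-distribʳ-* (+ n) (xp k n))) ⟩
    C (+ 0) ⊕ ⊖ D (xp k)             ≈⟨ ⊕-congʳ (C (+ 0)) (⊖-cong (≈-trans (D-xp k) (⊗-congʳ (C (+ k)) (≈-sym (1--multiples K))))) ⟩
    C (+ 0) ⊕ ⊖ (C (+ k) ⊗ (1- k ⊗ multiples k)) ≈⟨ solve 1 (λ x → con (+ 0) :+ x := x) ≈-refl (⊖ (C (+ k) ⊗ (1- k ⊗ multiples k))) ⟩
    ⊖ (C (+ k) ⊗ (1- k ⊗ multiples k)) ∎

multiples-∣ : ∀ k j → multiples (suc k) (suc j ℕ.* suc k) ≡ + 1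
multiples-∣ k j = dil-at-multiple k positives (suc j)

divisorSum≤ : ℕ → ℕ → ℕ
divisorSum≤ K n = sum (filter (_∣? n) (map suc (upTo K)))

divisorSum≤-suc : ∀ K n → divisorSum≤ (suc K) n ≡ divisorSum≤ K n ℕ.+ sum (filter (_∣? n) (suc K ∷ []))
divisorSum≤-suc K n = trans
  (cong (λ l → sum (filter (_∣? n) l)) (trans (cong (map suc) (sym (upTo-∷ʳ K))) (map-++ suc (upTo K) (K ∷ []))))
  (trans (cong sum (filter-++ (_∣? n) (map suc (upTo K)) (suc K ∷ [])))
    (sum-++ (filter (_∣? n) (map suc (upTo K))) _))

Σ-multiples-at : ∀ K n → Σ-multiples K (suc n) ≡ + divisorSum≤ K (suc n)
Σ-multiples-at zero    n = refl
Σ-multiples-at (suc K) n = trans (cong₂ ℤ._+_ (C-⊗-at (+ suc K) (multiples (suc K)) (suc n)) (Σ-multiples-at K n))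
  (trans (ℤₚ.+-comm (+ suc K ℤ.* multiples (suc K) (suc n)) _)
    (trans (cong (λ z → + divisorSum≤ K (suc n) ℤ.+ z) summand) (cong +_ (sym (divisorSum≤-suc K (suc n))))))
  where
  summand : + suc K ℤ.* multiples (suc K) (suc n) ≡ + sum (filter (_∣? suc n) (suc K ∷ []))
  summand with suc K ∣? suc n
  ... | yes p@(divides (suc j) e) = trans (cong (+ suc K ℤ.*_) (trans (cong (multiples (suc K)) e) (multiples-∣ K j)))
        (trans (ℤₚ.*-identityʳ (+ suc K)) (cong +_ (trans (sym (ℕₚ.+-identityʳ (suc K)))
          (cong sum (sym (filter-accept (_∣? suc n) {suc K} {[]} p))))))
  ... | no ¬p = trans (cong (+ suc K ℤ.*_) (dil-at-∤ K positives (suc n) ¬p)) (trans (ℤₚ.*-zeroʳ (+ suc K))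
        (cong (λ l → + sum l) (sym (filter-reject (_∣? suc n) {suc K} {[]} ¬p))))

-- No number above `suc n` divides `suc n`.
divisorSum≤-stable : ∀ n d → divisorSum≤ (d ℕ.+ suc n) (suc n) ≡ σ (suc n)
divisorSum≤-stable n zero    = refl
divisorSum≤-stable n (suc d) = trans (divisorSum≤-suc (d ℕ.+ suc n) (suc n))
  (trans (cong₂ ℕ._+_ (divisorSum≤-stable n d) (cong sum (filter-reject (_∣? suc n) {suc (d ℕ.+ suc n)} {[]}
    (λ p → ℕₚ.<-irrefl refl (ℕₚ.≤-trans (ℕ.s≤s (ℕₚ.m≤n+m (suc n) d)) (∣⇒≤ p))))))
    (ℕₚ.+-identityʳ _))

S : Series
S n = + σ n

Σ-multiples-0 : ∀ K → Σ-multiples K 0 ≡ + 0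
Σ-multiples-0 zero    = refl
Σ-multiples-0 (suc K) = trans (cong₂ ℤ._+_ (ℤₚ.*-zeroʳ (+ suc K)) (Σ-multiples-0 K)) refl

Σ-multiples≈S : ∀ K → Σ-multiples K ≈[ suc K ] S
Σ-multiples≈S K = below λ
  { zero    _         → Σ-multiples-0 K
  ; (suc n) (ℕ.s≤s n<K) → trans (Σ-multiples-at K n) (cong +_
      (trans (cong (λ k → divisorSum≤ k (suc n)) (sym (ℕₚ.m∸n+n≡m n<K))) (divisorSum≤-stable n (K ℕ.∸ suc n)))) }

D-E : D E ≈ ⊖ (E ⊗ S)
D-E = pointwise λ n → trans (cong (+ n ℤ.*_) (at< (E≈E≤ n) n ℕₚ.≤-refl))
  (trans (at (D-E≤ n) n) (cong ℤ.-_ (at< ([]-⊗ ([]-sym (E≈E≤ n)) (Σ-multiples≈S n)) n ℕₚ.≤-refl)))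

-- The product in the definition of a(n)

partialProd≈ : ∀ k → partialProd k ≈ dil 2 (E≤ k) ⊗ (dil 4 (E≤ k) ⊗ (dil 6 (E≤ k) ⊗ dil 12 (E≤ k)))
partialProd≈ zero = ≈-sym (≈-trans (⊗-cong (dil-C 1 (+ 1)) (⊗-cong (dil-C 3 (+ 1)) (⊗-cong (dil-C 5 (+ 1)) (dil-C 11 (+ 1)))))
  (≈-trans (solve 0 (con (+ 1) :* (con (+ 1) :* (con (+ 1) :* con (+ 1))) := con (+ 1)) ≈-refl)
    (pointwise λ { zero → refl ; (suc _) → refl })))
partialProd≈ (suc k) = begin
  mul1m (2 ℕ.* K) (mul1m (4 ℕ.* K) (mul1m (6 ℕ.* K) (mul1m (12 ℕ.* K) (partialProd k))))
    ≈⟨ ≈-trans (mul1m-≈ (2 ℕ.* K) _) (⊗-congʳ (1- (2 ℕ.* K))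
       (≈-trans (mul1m-≈ (4 ℕ.* K) _) (⊗-congʳ (1- (4 ℕ.* K))
       (≈-trans (mul1m-≈ (6 ℕ.* K) _) (⊗-congʳ (1- (6 ℕ.* K))
       (≈-trans (mul1m-≈ (12 ℕ.* K) (partialProd k)) (⊗-congʳ (1- (12 ℕ.* K)) (partialProd≈ k)))))))) ⟩
  1- (2 ℕ.* K) ⊗ (1- (4 ℕ.* K) ⊗ (1- (6 ℕ.* K) ⊗ (1- (12 ℕ.* K) ⊗ (e 1 ⊗ (e 3 ⊗ (e 5 ⊗ e 11))))))
    ≈⟨ solve 8 (λ a b c d w x y z → a :* (b :* (c :* (d :* (w :* (x :* (y :* z)))))) :=
         (a :* w) :* ((b :* x) :* ((c :* y) :* (d :* z)))) ≈-refl
         (1- (2 ℕ.* K)) (1- (4 ℕ.* K)) (1- (6 ℕ.* K)) (1- (12 ℕ.* K)) (e 1) (e 3) (e 5) (e 11) ⟩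
  (1- (2 ℕ.* K) ⊗ e 1) ⊗ ((1- (4 ℕ.* K) ⊗ e 3) ⊗ ((1- (6 ℕ.* K) ⊗ e 5) ⊗ (1- (12 ℕ.* K) ⊗ e 11)))
    ≈⟨ ⊗-cong (step 1) (⊗-cong (step 3) (⊗-cong (step 5) (step 11))) ⟩
  dil 2 (E≤ K) ⊗ (dil 4 (E≤ K) ⊗ (dil 6 (E≤ K) ⊗ dil 12 (E≤ K))) ∎
  where
  open ≈-Reasoning
  K : ℕ
  K = suc k
  e : ℕ → Series
  e j = dil (suc j) (E≤ k)
  step : ∀ j → 1- (suc j ℕ.* K) ⊗ e j ≈ dil (suc j) (E≤ K)
  step j = ≈-sym (≈-trans (dil-⊗ j (1- K) (E≤ k)) (⊗-congˡ (e j) (≈-trans (dil-1- j K)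
    (subst (λ i → 1- (K ℕ.* suc j) ≈ 1- i) (ℕₚ.*-comm K (suc j)) ≈-refl))))

-- The factor q in front of the product lowers the exponent from `suc m` to `m`, and the truncation
-- at `suc m` is exact there.
a≈ : ∀ m → a (suc m) ≡ (dil 2 E ⊗ (dil 4 E ⊗ (dil 6 E ⊗ dil 12 E))) m
a≈ m = trans (at (partialProd≈ (suc m)) m)
  (at< ([]-sym ([]-⊗ ([]-dil 1 e) ([]-⊗ ([]-dil 3 e) ([]-⊗ ([]-dil 5 e) ([]-dil 11 e))))) m (ℕₚ.n<1+n m))
  where
  e : E ≈[ suc m ] E≤ (suc m)
  e = E≈[] (ℕₚ.n≤1+n (suc m))

-- Theta series of graded sets

module ℤ+ = Algebra.Properties.AbelianGroup ℤₚ.+-0-abelianGroup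

private variable
  A A₁ A₂ : Set
  e e₁ e₂ : A → ℤ

Σ[_] : (A → ℤ) → List A → ℤ
Σ[ c ] []       = + 0
Σ[ c ] (a ∷ as) = c a ℤ.+ Σ[ c ] as

Σ-↭ : ∀ (c : A → ℤ) {xs ys} → xs ↭ ys → Σ[ c ] xs ≡ Σ[ c ] ys
Σ-↭ c _↭_.refl       = refl
Σ-↭ c (prep x p)     = cong (λ z → c x ℤ.+ z) (Σ-↭ c p)
Σ-↭ c (swap x y p)   = trans (cong (λ z → c x ℤ.+ (c y ℤ.+ z)) (Σ-↭ c p)) (lem (c x) (c y) _)
  where
  lem : ∀ a b z → a ℤ.+ (b ℤ.+ z) ≡ b ℤ.+ (a ℤ.+ z)
  lem = solve-∀
Σ-↭ c (_↭_.trans p q) = trans (Σ-↭ c p) (Σ-↭ c q)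

-- Duplicate-free lists with the same members are permutations of each other. The reindexings of
-- theta series reduce to this.
Σ-unique : ∀ (c : A → ℤ) {xs ys} → Unique xs → Unique ys →
           (∀ {a} → a ∈ xs → a ∈ ys) → (∀ {a} → a ∈ ys → a ∈ xs) → Σ[ c ] xs ≡ Σ[ c ] ys
Σ-unique c u v p q = Σ-↭ c (∼bag⇒↭ (unique∧set⇒bag u v (mk⇔ p q)))

Σ-cong : ∀ {c d : A → ℤ} xs → (∀ {a} → a ∈ xs → c a ≡ d a) → Σ[ c ] xs ≡ Σ[ d ] xs
Σ-cong []       p = refl
Σ-cong (a ∷ xs) p = cong₂ ℤ._+_ (p (here refl)) (Σ-cong xs (λ q → p (there q)))

Σ-map : ∀ (c : A₂ → ℤ) (h : A₁ → A₂) xs → Σ[ c ] (map h xs) ≡ Σ[ (λ a → c (h a)) ] xs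
Σ-map c h []       = refl
Σ-map c h (a ∷ xs) = cong (λ z → c (h a) ℤ.+ z) (Σ-map c h xs)

Σ-++ : ∀ (c : A → ℤ) xs ys → Σ[ c ] (xs ++ ys) ≡ Σ[ c ] xs ℤ.+ Σ[ c ] ys
Σ-++ c []       ys = sym (ℤₚ.+-identityˡ _)
Σ-++ c (x ∷ xs) ys = trans (cong (λ z → c x ℤ.+ z) (Σ-++ c xs ys)) (sym (ℤₚ.+-assoc (c x) _ _))

Σ-+ : ∀ (c d : A → ℤ) xs → Σ[ (λ a → c a ℤ.+ d a) ] xs ≡ Σ[ c ] xs ℤ.+ Σ[ d ] xs
Σ-+ c d []       = refl
Σ-+ c d (x ∷ xs) = trans (cong (λ z → c x ℤ.+ d x ℤ.+ z) (Σ-+ c d xs)) (lem (c x) (d x) _ _)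
  where
  lem : ∀ a b x y → (a ℤ.+ b) ℤ.+ (x ℤ.+ y) ≡ (a ℤ.+ x) ℤ.+ (b ℤ.+ y)
  lem = solve-∀

Σ-* : ∀ k (c : A → ℤ) xs → Σ[ (λ a → k ℤ.* c a) ] xs ≡ k ℤ.* Σ[ c ] xs
Σ-* k c []       = sym (ℤₚ.*-zeroʳ k)
Σ-* k c (x ∷ xs) = trans (cong (λ z → k ℤ.* c x ℤ.+ z) (Σ-* k c xs)) (sym (ℤₚ.*-distribˡ-+ k (c x) _))

Σ-zero : ∀ (c : A → ℤ) xs → (∀ {a} → a ∈ xs → c a ≡ + 0) → Σ[ c ] xs ≡ + 0
Σ-zero c xs p = trans (Σ-cong xs p) (go xs)
  where
  go : ∀ (xs : List A) → Σ[ (λ _ → + 0) ] xs ≡ + 0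
  go []       = refl
  go (x ∷ xs) = trans (ℤₚ.+-identityˡ _) (go xs)

Σ-product : ∀ (c : A₁ → ℤ) (d : A₂ → ℤ) xs ys →
            Σ[ (λ ab → c (proj₁ ab) ℤ.* d (proj₂ ab)) ] (cartesianProduct xs ys) ≡ Σ[ c ] xs ℤ.* Σ[ d ] ys
Σ-product c d []       ys = sym (ℤₚ.*-zeroˡ (Σ[ d ] ys))
Σ-product c d (x ∷ xs) ys = trans (Σ-++ _ (map (x ,_) ys) (cartesianProduct xs ys))
  (trans (cong₂ ℤ._+_ (trans (Σ-map _ (x ,_) ys) (Σ-* (c x) d ys)) (Σ-product c d xs ys))
    (sym (ℤₚ.*-distribʳ-+ (Σ[ d ] ys) (c x) (Σ[ c ] xs))))

-- A grading with finite fibers, listed without repetition. Grades are integers, with `nonneg` on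
-- the side, so that the ring solver can prove identities between them.
record Graded {A : Set} (e : A → ℤ) : Set where
  field
    fiber    : ℕ → List A
    unique   : ∀ n → Unique (fiber n)
    sound    : ∀ n {a} → a ∈ fiber n → e a ≡ + n
    complete : ∀ n a → e a ≡ + n → a ∈ fiber n
    nonneg   : ∀ a → ∃ λ m → e a ≡ + m
open Graded public

-- The theta series Σ_a c(a) q^(e a).
θ : Graded e → (_ → ℤ) → Series
θ G c n = Σ[ c ] (fiber G n)

θ-cong : ∀ (G : Graded e) {c d} → (∀ a → c a ≡ d a) → θ G c ≈ θ G d
θ-cong G p = pointwise λ n → Σ-cong (fiber G n) (λ {a} _ → p a)

θ-+ : ∀ (G : Graded e) c d → θ G (λ a → c a ℤ.+ d a) ≈ θ G c ⊕ θ G d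
θ-+ G c d = pointwise λ n → Σ-+ c d (fiber G n)

θ-* : ∀ (G : Graded e) k c → θ G (λ a → k ℤ.* c a) ≈ C k ⊗ θ G c
θ-* G k c = pointwise λ n → trans (Σ-* k c (fiber G n)) (sym (C-⊗-at k (θ G c) n))

θ-D : ∀ (G : Graded e) c → D (θ G c) ≈ θ G (λ a → e a ℤ.* c a)
θ-D {e = e} G c = pointwise λ n → trans (sym (Σ-* (+ n) c (fiber G n)))
  (Σ-cong (fiber G n) (λ {a} p → cong (ℤ._* c a) (sym (sound G n p))))

altℤ : ℤ → ℤ
altℤ x = alt ℤ.∣ x ∣

sgn-at : ∀ f n → sgn f n ≡ alt n ℤ.* f n
sgn-at f zero    = sym (ℤₚ.*-identityˡ (f 0))
sgn-at f (suc n) = trans (cong ℤ.-_ (sgn-at (tail f) n)) (ℤₚ.neg-distribˡ-* (alt n) (f (suc n)))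

θ-sgn : ∀ (G : Graded e) c → sgn (θ G c) ≈ θ G (λ a → altℤ (e a) ℤ.* c a)
θ-sgn {e = e} G c = pointwise λ n → trans (sgn-at (θ G c) n) (trans (sym (Σ-* (alt n) c (fiber G n)))
  (Σ-cong (fiber G n) (λ {a} p → cong (λ z → altℤ z ℤ.* c a) (sym (sound G n p)))))

θ-dil : ∀ k (G : Graded {A} e) (G′ : Graded {A} e₁) → (∀ a → e₁ a ≡ + suc k ℤ.* e a) → ∀ c →
        θ G′ c ≈ dil (suc k) (θ G c)
θ-dil {e = e} {e₁ = e₁} k G G′ p c = pointwise go
  where
  pos-scale : ∀ m → + suc k ℤ.* + m ≡ + (m ℕ.* suc k)
  pos-scale m = trans (ℤₚ.*-comm (+ suc k) (+ m)) (sym (ℤₚ.pos-* m (suc k)))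
  go : ∀ n → θ G′ c n ≡ dil (suc k) (θ G c) n
  go n with suc k ∣? n
  ... | yes (divides j refl) = trans
        (Σ-unique c (unique G′ n) (unique G j)
          (λ {a} q → complete G j a (ℤₚ.*-cancelˡ-≡ (+ suc k) (e a) (+ j)
            (trans (sym (p a)) (trans (sound G′ n q) (sym (pos-scale j))))))
          (λ {a} q → complete G′ n a (trans (p a) (trans (cong (λ z → + suc k ℤ.* z) (sound G j q)) (pos-scale j)))))
        (sym (dil-at-multiple k (θ G c) j))
  ... | no ∤n = trans (Σ-zero c (fiber G′ n) (λ {a} q → ⊥-elim (∤n (multiple q))))
        (sym (dil-at-∤ k (θ G c) n ∤n))
    where
    multiple : ∀ {a} → a ∈ fiber G′ n → suc k ∣ n
    multiple {a} q with nonneg G a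
    ... | m , r = divides m (ℤₚ.+-injective (trans (sym (sound G′ n q))
            (trans (p a) (trans (cong (λ z → + suc k ℤ.* z) r) (pos-scale m)))))

θ-shift : ∀ m (G : Graded {A} e) (G′ : Graded {A} e₁) → (∀ a → e₁ a ≡ + m ℤ.+ e a) → ∀ c →
          θ G′ c ≈ xp m ⊗ θ G c
θ-shift {e = e} {e₁ = e₁} m G G′ p c = pointwise go
  where
  go : ∀ n → θ G′ c n ≡ (xp m ⊗ θ G c) n
  go n with m ℕ.≤? n
  ... | yes m≤n with ℕₚ.m≤n⇒∃[o]m+o≡n m≤n
  ...   | j , refl = trans
        (Σ-unique c (unique G′ n) (unique G j)
          (λ {a} q → complete G j a (ℤ+.∙-cancelˡ (+ m) _ _ (trans (sym (p a)) (sound G′ n q))))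
          (λ {a} q → complete G′ n a (trans (p a) (cong (λ z → + m ℤ.+ z) (sound G j q)))))
        (sym (xp-⊗-≥ m (θ G c) j))
  go n | no m≰n = trans (Σ-zero c (fiber G′ n) (λ {a} q → ⊥-elim (m≰n (small q))))
        (sym (xp-⊗-< m (θ G c) n (ℕₚ.≰⇒> m≰n)))
    where
    small : ∀ {a} → a ∈ fiber G′ n → m ℕ.≤ n
    small {a} q with nonneg G a
    ... | j , r = ℕₚ.≤-trans (ℕₚ.m≤m+n m j) (ℕₚ.≤-reflexive (ℤₚ.+-injective (trans (cong (λ z → + m ℤ.+ z) (sym r))
            (trans (sym (p a)) (sound G′ n q)))))

graded-⊎ : Graded {A₁} e₁ → Graded {A₂} e₂ → Graded {A₁ ⊎ A₂} [ e₁ , e₂ ]′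
graded-⊎ G₁ G₂ = record
  { fiber    = λ n → map inj₁ (fiber G₁ n) ++ map inj₂ (fiber G₂ n)
  ; unique   = λ n → Uniqueₚ.++⁺ (Uniqueₚ.map⁺ (λ { refl → refl }) (unique G₁ n)) (Uniqueₚ.map⁺ (λ { refl → refl }) (unique G₂ n)) disjoint
  ; sound    = λ n p → [ (λ q → sound₁ n q) , (λ q → sound₂ n q) ]′ (∈-++⁻ (map inj₁ (fiber G₁ n)) p)
  ; complete = λ { n (inj₁ a) p → ∈-++⁺ˡ (∈-map⁺ inj₁ (complete G₁ n a p))
                 ; n (inj₂ a) p → ∈-++⁺ʳ (map inj₁ (fiber G₁ n)) (∈-map⁺ inj₂ (complete G₂ n a p)) }
  ; nonneg   = λ { (inj₁ a) → nonneg G₁ a ; (inj₂ a) → nonneg G₂ a } }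
  where
  disjoint : ∀ {xs ys a} → (a ∈ map inj₁ xs × a ∈ map inj₂ ys) → ⊥
  disjoint (p , q) with ∈-map⁻ inj₁ p | ∈-map⁻ inj₂ q
  ... | _ , _ , refl | _ , _ , ()
  sound₁ : ∀ n {a} → a ∈ map inj₁ (fiber G₁ n) → [ _ , _ ]′ a ≡ + n
  sound₁ n q with ∈-map⁻ inj₁ q
  ... | _ , r , refl = sound G₁ n r
  sound₂ : ∀ n {a} → a ∈ map inj₂ (fiber G₂ n) → [ _ , _ ]′ a ≡ + n
  sound₂ n q with ∈-map⁻ inj₂ q
  ... | _ , r , refl = sound G₂ n r

θ-⊎ : ∀ (G₁ : Graded {A₁} e₁) (G₂ : Graded {A₂} e₂) c →
      θ (graded-⊎ G₁ G₂) c ≈ θ G₁ (λ a → c (inj₁ a)) ⊕ θ G₂ (λ a → c (inj₂ a))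
θ-⊎ G₁ G₂ c = pointwise λ n → trans (Σ-++ c (map inj₁ (fiber G₁ n)) _)
  (cong₂ ℤ._+_ (Σ-map c inj₁ (fiber G₁ n)) (Σ-map c inj₂ (fiber G₂ n)))

θ-reindex : ∀ (G : Graded {A} e) (G₁ : Graded {A₁} e₁) (h : A₁ → A) → (∀ b → e (h b) ≡ e₁ b) →
            (∀ {b b′} → h b ≡ h b′ → b ≡ b′) → (∀ a → ∃ λ b → h b ≡ a) → ∀ c →
            θ G c ≈ θ G₁ (λ b → c (h b))
θ-reindex G G₁ h p injective surjective c = pointwise λ n → trans
  (Σ-unique c (unique G n) (Uniqueₚ.map⁺ injective (unique G₁ n)) (to n) (from n))
  (Σ-map c h (fiber G₁ n))
  where
  to : ∀ n {a} → a ∈ fiber G n → a ∈ map h (fiber G₁ n)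
  to n {a} q with surjective a
  ... | b , refl = ∈-map⁺ h (complete G₁ n b (trans (sym (p b)) (sound G n q)))
  from : ∀ n {a} → a ∈ map h (fiber G₁ n) → a ∈ fiber G n
  from n q with ∈-map⁻ h q
  ... | b , r , refl = complete G n (h b) (trans (p b) (sound G₁ n r))

convolve : (ℕ → List A₁) → (ℕ → List A₂) → ℕ → List (A₁ × A₂)
convolve L K zero    = cartesianProduct (L 0) (K 0)
convolve L K (suc n) = cartesianProduct (L 0) (K (suc n)) ++ convolve (λ i → L (suc i)) K n

convolve-⁻ : ∀ (L : ℕ → List A₁) (K : ℕ → List A₂) n {ab} → ab ∈ convolve L K n →
             ∃ λ i → ∃ λ j → i ℕ.+ j ≡ n × proj₁ ab ∈ L i × proj₂ ab ∈ K j
convolve-⁻ L K zero p with ∈-cartesianProduct⁻ (L 0) (K 0) p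
... | q , r = 0 , 0 , refl , q , r
convolve-⁻ L K (suc n) p with ∈-++⁻ (cartesianProduct (L 0) (K (suc n))) p
... | inj₁ p₁ with ∈-cartesianProduct⁻ (L 0) (K (suc n)) p₁
...   | q , r = 0 , suc n , refl , q , r
convolve-⁻ L K (suc n) p | inj₂ p₂ with convolve-⁻ (λ i → L (suc i)) K n p₂
... | i , j , s , q , r = suc i , j , cong suc s , q , r

convolve-⁺ : ∀ (L : ℕ → List A₁) (K : ℕ → List A₂) i j {a b} → a ∈ L i → b ∈ K j → (a , b) ∈ convolve L K (i ℕ.+ j)
convolve-⁺ L K zero    zero    p q = ∈-cartesianProduct⁺ p q
convolve-⁺ L K zero    (suc j) p q = ∈-++⁺ˡ (∈-cartesianProduct⁺ p q)
convolve-⁺ L K (suc i) j       p q = ∈-++⁺ʳ (cartesianProduct (L 0) (K (suc i ℕ.+ j))) (convolve-⁺ (λ i → L (suc i)) K i j p q)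

convolve-unique : ∀ (L : ℕ → List A₁) (K : ℕ → List A₂) → (∀ n → Unique (L n)) → (∀ n → Unique (K n)) →
                  (∀ {i j a} → a ∈ L i → a ∈ L j → i ≡ j) → ∀ n → Unique (convolve L K n)
convolve-unique L K u v d zero    = Uniqueₚ.cartesianProduct⁺ (u 0) (v 0)
convolve-unique L K u v d (suc n) = Uniqueₚ.++⁺ (Uniqueₚ.cartesianProduct⁺ (u 0) (v (suc n)))
  (convolve-unique (λ i → L (suc i)) K (λ i → u (suc i)) v (λ p q → ℕₚ.suc-injective (d p q)) n)
  (λ { (p , q) → 0≢suc (d (proj₁ (∈-cartesianProduct⁻ (L 0) (K (suc n)) p))
                         (proj₁ (proj₂ (proj₂ (proj₂ (convolve-⁻ (λ i → L (suc i)) K n q)))))) })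
  where
  0≢suc : ∀ {i} → 0 ≢ suc i
  0≢suc ()

graded-× : Graded {A₁} e₁ → Graded {A₂} e₂ → Graded {A₁ × A₂} (λ ab → e₁ (proj₁ ab) ℤ.+ e₂ (proj₂ ab))
graded-× {e₁ = e₁} {e₂ = e₂} G₁ G₂ = record
  { fiber    = convolve (fiber G₁) (fiber G₂)
  ; unique   = convolve-unique (fiber G₁) (fiber G₂) (unique G₁) (unique G₂)
                 (λ p q → ℤₚ.+-injective (trans (sym (sound G₁ _ p)) (sound G₁ _ q)))
  ; sound    = λ n p → sound′ n (convolve-⁻ (fiber G₁) (fiber G₂) n p)
  ; complete = complete′
  ; nonneg   = λ { (a , b) → proj₁ (nonneg G₁ a) ℕ.+ proj₁ (nonneg G₂ b)
                           , cong₂ ℤ._+_ (proj₂ (nonneg G₁ a)) (proj₂ (nonneg G₂ b)) } }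
  where
  sound′ : ∀ n {ab} → (∃ λ i → ∃ λ j → i ℕ.+ j ≡ n × proj₁ ab ∈ fiber G₁ i × proj₂ ab ∈ fiber G₂ j) →
           e₁ (proj₁ ab) ℤ.+ e₂ (proj₂ ab) ≡ + n
  sound′ n (i , j , refl , q , r) = cong₂ ℤ._+_ (sound G₁ i q) (sound G₂ j r)
  complete′ : ∀ n ab → e₁ (proj₁ ab) ℤ.+ e₂ (proj₂ ab) ≡ + n → ab ∈ convolve (fiber G₁) (fiber G₂) n
  complete′ n (a , b) p with nonneg G₁ a | nonneg G₂ b
  ... | i , q | j , r = subst (λ k → (a , b) ∈ convolve (fiber G₁) (fiber G₂) k)
        (ℤₚ.+-injective (trans (sym (cong₂ ℤ._+_ q r)) p))
        (convolve-⁺ (fiber G₁) (fiber G₂) i j (complete G₁ i a q) (complete G₂ j b r))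

θ-× : ∀ (G₁ : Graded {A₁} e₁) (G₂ : Graded {A₂} e₂) c d →
      θ (graded-× G₁ G₂) (λ ab → c (proj₁ ab) ℤ.* d (proj₂ ab)) ≈ θ G₁ c ⊗ θ G₂ d
θ-× G₁ G₂ c d = pointwise (go (fiber G₁) (fiber G₂))
  where
  go : ∀ L K n → Σ[ (λ ab → c (proj₁ ab) ℤ.* d (proj₂ ab)) ] (convolve L K n) ≡ ((λ i → Σ[ c ] (L i)) ⊗ (λ i → Σ[ d ] (K i))) n
  go L K zero    = Σ-product c d (L 0) (K 0)
  go L K (suc n) = trans (Σ-++ _ (cartesianProduct (L 0) (K (suc n))) (convolve (λ i → L (suc i)) K n))
    (cong₂ ℤ._+_ (Σ-product c d (L 0) (K (suc n))) (go (λ i → L (suc i)) K n))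

graded-shift : ∀ m → Graded {A} e → Graded {A} (λ a → + m ℤ.+ e a)
graded-shift {A = A} {e = e} m G = record
  { fiber    = fiber′ m
  ; unique   = unique′ m
  ; sound    = λ n p → sound′ m n p
  ; complete = λ n a p → complete′ m n a p
  ; nonneg   = λ a → m ℕ.+ proj₁ (nonneg G a) , cong (λ z → + m ℤ.+ z) (proj₂ (nonneg G a)) }
  where
  fiber′ : ℕ → ℕ → List A
  fiber′ zero    n       = fiber G n
  fiber′ (suc m) zero    = []
  fiber′ (suc m) (suc n) = fiber′ m n
  unique′ : ∀ m n → Unique (fiber′ m n)
  unique′ zero    n       = unique G n
  unique′ (suc m) zero    = []
  unique′ (suc m) (suc n) = unique′ m n
  1+ᶻ : ∀ m z → + suc m ℤ.+ z ≡ + 1 ℤ.+ (+ m ℤ.+ z)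
  1+ᶻ m z = ℤₚ.+-assoc (+ 1) (+ m) z
  sound′ : ∀ m n {a} → a ∈ fiber′ m n → + m ℤ.+ e a ≡ + n
  sound′ zero    n       {a} p = trans (ℤₚ.+-identityˡ (e a)) (sound G n p)
  sound′ (suc m) (suc n) {a} p = trans (1+ᶻ m (e a)) (cong (λ z → + 1 ℤ.+ z) (sound′ m n p))
  complete′ : ∀ m n a → + m ℤ.+ e a ≡ + n → a ∈ fiber′ m n
  complete′ zero    n       a p = complete G n a (trans (sym (ℤₚ.+-identityˡ (e a))) p)
  complete′ (suc m) zero    a p with nonneg G a
  ... | j , q with trans (sym (cong (λ z → + suc m ℤ.+ z) q)) p
  ...   | ()
  complete′ (suc m) (suc n) a p = complete′ m n a (ℤ+.∙-cancelˡ (+ 1) _ _ (trans (sym (1+ᶻ m (e a))) p))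

-- Gradings of ℤ by squares and triangular numbers

-- The interval [-n, n + 1] is symmetric under x ↦ 1 - x, as x(x - 1)/2 is, and has the 2n + 2
-- entries x = i - n of the antidiagonal p + i = 2n + 1.
InWindow : ℤ → ℕ → Set
InWindow (+ j)      n = j ℕ.≤ suc n
InWindow (-[1+ j ]) n = suc j ℕ.≤ n

window : ℕ → List ℤ
window n = applyUpTo (λ i → i ℤ.⊖ n) (suc (suc (n ℕ.+ n)))

window-complete : ∀ x n → InWindow x n → x ∈ window n
window-complete (+ j) n p = subst (_∈ window n) (trans (ℤₚ.⊖-≥ (ℕₚ.m≤m+n n j)) (cong +_ (ℕₚ.m+n∸m≡n n j)))
  (∈-applyUpTo⁺ (λ i → i ℤ.⊖ n) (ℕₚ.≤-<-trans (ℕₚ.+-monoʳ-≤ n p) (ℕₚ.≤-reflexive (cong suc (ℕₚ.+-suc n n)))))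
window-complete -[1+ j ] n p with ℕₚ.m≤n⇒∃[o]m+o≡n p
... | i , refl = subst (_∈ window n) (lem i) (∈-applyUpTo⁺ (λ i → i ℤ.⊖ n)
        (ℕₚ.≤-<-trans (ℕₚ.≤-trans (ℕₚ.m≤n+m i (suc j)) (ℕₚ.m≤m+n n n)) (ℕₚ.m<n⇒m<1+n (ℕₚ.n<1+n (n ℕ.+ n)))))
  where
  lem : ∀ i → i ℤ.⊖ (suc j ℕ.+ i) ≡ -[1+ j ]
  lem i = trans (ℤₚ.⊖-< (ℕₚ.m<n+m i (ℕ.s≤s ℕ.z≤n))) (cong (λ k → ℤ.- + k) (ℕₚ.m+n∸n≡m (suc j) i))

window-unique : ∀ n → Unique (window n)
window-unique n = Uniqueₚ.applyUpTo⁺₁ _ _ (λ {i} {j} i<j _ p → ℕₚ.<⇒≢ i<j (ℤₚ.+-injective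
  (ℤ+.∙-cancelʳ (ℤ.- + n) (+ i) (+ j) (trans (ℤₚ.m-n≡m⊖n i n) (trans p (sym (ℤₚ.m-n≡m⊖n j n)))))))

-- Every x lies in the window of its own value, and the factor k + 1 can only raise that value; a
-- search through `window n` therefore finds the whole fiber over n.
line : (f : ℤ → ℤ) → (∀ x → ∃ λ m → f x ≡ + m × InWindow x m) → ∀ k → Graded (λ x → + suc k ℤ.* f x)
line f h k = record
  { fiber    = λ n → filter (λ x → + suc k ℤ.* f x ℤₚ.≟ + n) (window n)
  ; unique   = λ n → Uniqueₚ.filter⁺ (λ x → + suc k ℤ.* f x ℤₚ.≟ + n) (window-unique n)
  ; sound    = λ n p → proj₂ (∈-filter⁻ (λ x → + suc k ℤ.* f x ℤₚ.≟ + n) {xs = window n} p)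
  ; complete = λ n x p → ∈-filter⁺ (λ x → + suc k ℤ.* f x ℤₚ.≟ + n) (window-complete x n (bound n x p)) p
  ; nonneg   = λ x → suc k ℕ.* proj₁ (h x)
      , trans (cong (λ z → + suc k ℤ.* z) (proj₁ (proj₂ (h x)))) (sym (ℤₚ.pos-* (suc k) (proj₁ (h x)))) }
  where
  widen : ∀ x {m n} → m ℕ.≤ n → InWindow x m → InWindow x n
  widen (+ j)      p q = ℕₚ.≤-trans q (ℕ.s≤s p)
  widen (-[1+ j ]) p q = ℕₚ.≤-trans q p
  bound : ∀ n x → + suc k ℤ.* f x ≡ + n → InWindow x n
  bound n x p with h x
  ... | m , q , w = widen x (ℕₚ.≤-trans (ℕₚ.m≤m+n m (k ℕ.* m)) (ℕₚ.≤-reflexive (ℤₚ.+-injective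
        (trans (ℤₚ.pos-* (suc k) m) (trans (cong (λ z → + suc k ℤ.* z) (sym q)) p))))) w

triℕ : ℤ → ℕ
triℕ (+ zero)   = 0
triℕ (+ suc i)  = T i
triℕ (-[1+ i ]) = T (suc i)

triℕ-⊖ : ∀ i n → triℕ (i ℤ.⊖ n) ≡ triAt n i
triℕ-⊖ zero    zero    = refl
triℕ-⊖ (suc i) zero    = refl
triℕ-⊖ zero    (suc n) = refl
triℕ-⊖ (suc i) (suc n) = trans (cong triℕ (ℤₚ.[1+m]⊖[1+n]≡m⊖n i n)) (triℕ-⊖ i n)

2T : ∀ n → 2 ℕ.* T n ≡ suc n ℕ.* n
2T zero    = refl
2T (suc n) = trans (ℕₚ.*-distribˡ-+ 2 (suc n) (T n)) (trans (cong (2 ℕ.* suc n ℕ.+_) (2T n)) (lem n))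
  where
  lem : ∀ n → 2 ℕ.* (1 ℕ.+ n) ℕ.+ (1 ℕ.+ n) ℕ.* n ≡ (2 ℕ.+ n) ℕ.* (1 ℕ.+ n)
  lem = ℕ-Solver.solve-∀

triℕ-double : ∀ x → x ℤ.* (x ℤ.- + 1) ≡ + 2 ℤ.* + triℕ x
triℕ-double (+ zero)   = refl
triℕ-double (+ suc i)  = trans (sym (ℤₚ.pos-* (suc i) i)) (trans (cong +_ (sym (2T i))) (ℤₚ.pos-* 2 (T i)))
triℕ-double (-[1+ i ]) = trans (lem (+ i)) (trans (sym (ℤₚ.pos-* (2 ℕ.+ i) (suc i)))
  (trans (cong +_ (sym (2T (suc i)))) (ℤₚ.pos-* 2 (T (suc i)))))
  where
  lem : ∀ i → (ℤ.- (+ 1 ℤ.+ i)) ℤ.* (ℤ.- (+ 1 ℤ.+ i) ℤ.- + 1) ≡ (+ 2 ℤ.+ i) ℤ.* (+ 1 ℤ.+ i)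
  lem = solve-∀

tri-triℕ : ∀ x → tri x ≡ + triℕ x
tri-triℕ x = trans (cong (ℤ._/ + 2) (trans (triℕ-double x) (trans (sym (ℤₚ.pos-* 2 (triℕ x))) (cong +_ (ℕₚ.*-comm 2 (triℕ x))))))
  (trans (div-pos-is-/ℕ (+ (triℕ x ℕ.* 2)) 2) (cong +_ (m*n/n≡m (triℕ x) 2)))

tri-double : ∀ x → + 2 ℤ.* tri x ≡ x ℤ.* (x ℤ.- + 1)
tri-double x = trans (cong (λ z → + 2 ℤ.* z) (tri-triℕ x)) (sym (triℕ-double x))

sq : ℤ → ℤ
sq x = x ℤ.* x

n≤n*n : ∀ n → n ℕ.≤ n ℕ.* n
n≤n*n zero    = ℕ.z≤n
n≤n*n (suc n) = ℕₚ.m≤m*n (suc n) (suc n)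

-- The index k stands for the coefficient k + 1.
square : ∀ k → Graded (λ x → + suc k ℤ.* sq x)
square = line sq λ
  { (+ j)      → j ℕ.* j , sym (ℤₚ.pos-* j j) , ℕₚ.m≤n⇒m≤1+n (n≤n*n j)
  ; (-[1+ j ]) → suc j ℕ.* suc j , refl , n≤n*n (suc j) }

triangle : ∀ k → Graded (λ x → + suc k ℤ.* tri x)
triangle = line tri λ x → triℕ x , tri-triℕ x , inWindow x
  where
  inWindow : ∀ x → InWindow x (triℕ x)
  inWindow (+ zero)   = ℕ.z≤n
  inWindow (+ suc i)  = ℕ.s≤s (n≤Tn i)
  inWindow (-[1+ i ]) = n≤Tn (suc i)

xp-diagonal : ∀ m → xp m m ≡ + 1
xp-diagonal zero    = refl
xp-diagonal (suc m) = xp-diagonal m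

xp-offdiagonal : ∀ m k → m ≢ k → xp m k ≡ + 0
xp-offdiagonal zero    zero    p = ⊥-elim (p refl)
xp-offdiagonal zero    (suc k) p = refl
xp-offdiagonal (suc m) zero    p = refl
xp-offdiagonal (suc m) (suc k) p = xp-offdiagonal m k (λ q → p (cong suc q))

anti-at : ∀ p i (f : ℕ → Series) k (g : ℕ → ℕ) → (∀ j → g j ≡ i ℕ.+ j) →
          anti p i (λ _ i → f i) k ≡ Σ[ (λ j → f j k) ] (applyUpTo g (suc p))
anti-at zero    i f k g h = trans (cong (λ j → f j k) (sym (trans (h 0) (ℕₚ.+-identityʳ i)))) (sym (ℤₚ.+-identityʳ _))
anti-at (suc p) i f k g h = cong₂ ℤ._+_ (cong (λ j → f j k) (sym (trans (h 0) (ℕₚ.+-identityʳ i))))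
  (anti-at p (suc i) f k (λ j → g (suc j)) (λ j → trans (h (suc j)) (ℕₚ.+-suc i j)))

-- Brings a theta series into the form of `weighted-limit`. For k < n the fiber over k lies inside
-- the window, and the rest of the window adds zeros to the coefficient of q^k.
θ-triangle-window : ∀ c n → θ (triangle 0) c ≈[ n ]
  anti (suc (n ℕ.+ n)) 0 (λ p i → C (c (i ℤ.⊖ n)) ⊗ xp (triAt n i))
θ-triangle-window c n = below λ k k<n → begin
  Σ[ c ] (fiber (triangle 0) k)
    ≡⟨ Σ-cong (fiber (triangle 0) k) (λ {x} p → sym (on k x (level k p))) ⟩
  Σ[ F k ] (fiber (triangle 0) k)
    ≡⟨ Σ-unique (F k) (unique (triangle 0) k) (Uniqueₚ.filter⁺ (λ x → triℕ x ℕₚ.≟ k) (window-unique n))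
         (λ {x} p → ∈-filter⁺ (λ x → triℕ x ℕₚ.≟ k) (window-complete x n (inside x (ℕₚ.≤-trans (ℕₚ.≤-reflexive (level k p)) (ℕₚ.<⇒≤ k<n)))) (level k p))
         (λ {x} p → complete (triangle 0) k x (trans (ℤₚ.*-identityˡ (tri x)) (trans (tri-triℕ x)
           (cong +_ (proj₂ (∈-filter⁻ (λ x → triℕ x ℕₚ.≟ k) {xs = window n} p)))))) ⟩
  Σ[ F k ] (filter (λ x → triℕ x ℕₚ.≟ k) (window n))
    ≡⟨ drop-zeros k (window n) ⟩
  Σ[ F k ] (window n)
    ≡⟨ cong Σ[ F k ] (sym (map-applyUpTo (λ i → i) (λ i → i ℤ.⊖ n) (suc (suc (n ℕ.+ n))))) ⟩
  Σ[ F k ] (map (λ i → i ℤ.⊖ n) (upTo (suc (suc (n ℕ.+ n)))))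
    ≡⟨ Σ-map (F k) (λ i → i ℤ.⊖ n) (upTo (suc (suc (n ℕ.+ n)))) ⟩
  Σ[ (λ i → F k (i ℤ.⊖ n)) ] (upTo (suc (suc (n ℕ.+ n))))
    ≡⟨ Σ-cong (upTo (suc (suc (n ℕ.+ n)))) (λ {i} _ → trans (cong (λ t → c (i ℤ.⊖ n) ℤ.* xp t k) (triℕ-⊖ i n))
         (sym (C-⊗-at (c (i ℤ.⊖ n)) (xp (triAt n i)) k))) ⟩
  Σ[ (λ i → (C (c (i ℤ.⊖ n)) ⊗ xp (triAt n i)) k) ] (upTo (suc (suc (n ℕ.+ n))))
    ≡⟨ anti-at (suc (n ℕ.+ n)) 0 (λ i → C (c (i ℤ.⊖ n)) ⊗ xp (triAt n i)) k (λ i → i) (λ _ → refl) ⟨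
  anti (suc (n ℕ.+ n)) 0 (λ p i → C (c (i ℤ.⊖ n)) ⊗ xp (triAt n i)) k ∎
  where
  open ≡-Reasoning
  F : ℕ → ℤ → ℤ
  F k x = c x ℤ.* xp (triℕ x) k
  on : ∀ k x → triℕ x ≡ k → F k x ≡ c x
  on k x refl = trans (cong (λ z → c x ℤ.* z) (xp-diagonal (triℕ x))) (ℤₚ.*-identityʳ (c x))
  off : ∀ k x → triℕ x ≢ k → F k x ≡ + 0
  off k x p = trans (cong (λ z → c x ℤ.* z) (xp-offdiagonal (triℕ x) k p)) (ℤₚ.*-zeroʳ (c x))
  level : ∀ k {x} → x ∈ fiber (triangle 0) k → triℕ x ≡ k
  level k {x} p = ℤₚ.+-injective (trans (sym (tri-triℕ x)) (trans (sym (ℤₚ.*-identityˡ (tri x))) (sound (triangle 0) k p)))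
  inside : ∀ x → triℕ x ℕ.≤ n → InWindow x n
  inside (+ zero)   p = ℕ.z≤n
  inside (+ suc i)  p = ℕ.s≤s (ℕₚ.≤-trans (n≤Tn i) p)
  inside (-[1+ i ]) p = ℕₚ.≤-trans (n≤Tn (suc i)) p
  drop-zeros : ∀ k xs → Σ[ F k ] (filter (λ x → triℕ x ℕₚ.≟ k) xs) ≡ Σ[ F k ] xs
  drop-zeros k []       = refl
  drop-zeros k (x ∷ xs) with triℕ x ℕₚ.≟ k
  ... | yes p = trans (cong Σ[ F k ] (filter-accept (λ x → triℕ x ℕₚ.≟ k) {x} {xs} p)) (cong (λ z → F k x ℤ.+ z) (drop-zeros k xs))
  ... | no ¬p = trans (cong Σ[ F k ] (filter-reject (λ x → triℕ x ℕₚ.≟ k) {x} {xs} ¬p)) (trans (drop-zeros k xs)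
        (sym (trans (cong (λ z → z ℤ.+ Σ[ F k ] xs) (off k x ¬p)) (ℤₚ.+-identityˡ _))))

-- Coefficients as cardinalities

lookup-injective : ∀ {xs : List A} → Unique xs → ∀ i j → lookup xs i ≡ lookup xs j → i ≡ j
lookup-injective (_ ∷ _) Fin.zero    Fin.zero    p = refl
lookup-injective (q ∷ _) Fin.zero    (Fin.suc j) p = ⊥-elim (All.lookup q (∈-lookup j) p)
lookup-injective (q ∷ _) (Fin.suc i) Fin.zero    p = ⊥-elim (All.lookup q (∈-lookup i) (sym p))
lookup-injective (_ ∷ u) (Fin.suc i) (Fin.suc j) p = cong Fin.suc (lookup-injective u i j p)

θ-count : ∀ (G : Graded {A} e) n → θ G (λ _ → + 1) n ≡ + length (fiber G n)
θ-count G n = go (fiber G n)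
  where
  go : ∀ (xs : List _) → Σ[ (λ _ → + 1) ] xs ≡ + length xs
  go []       = refl
  go (x ∷ xs) = cong (λ z → + 1 ℤ.+ z) (go xs)

fiber-↔ : ∀ (G : Graded {A} e) n → Fin (length (fiber G n)) ↔ Σ A (λ a → + n ≡ e a)
fiber-↔ {A = A} {e = e} G n = mk↔ₛ′ to from to∘from
  (λ i → lookup-injective (unique G n) _ i (sym (lookup-index (position (to i)))))
  where
  position : (a : Σ A (λ a → + n ≡ e a)) → proj₁ a ∈ fiber G n
  position (a , p) = complete G n a (sym p)
  to : Fin (length (fiber G n)) → Σ A (λ a → + n ≡ e a)
  to i = lookup (fiber G n) i , sym (sound G n (∈-lookup i))
  from : Σ A (λ a → + n ≡ e a) → Fin (length (fiber G n))
  from a = index (position a)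
  Σ-≡ : ∀ {a b} (p : + n ≡ e a) (q : + n ≡ e b) → a ≡ b → (a , p) ≡ (b , q)
  Σ-≡ p q refl = cong (_ ,_) (uip p q)
  to∘from : ∀ a → to (from a) ≡ a
  to∘from (a , p) = Σ-≡ _ p (sym (lookup-index (position (a , p))))

-- Reindexing of binary theta series

1ᶜ : {A : Set} → A → ℤ
1ᶜ _ = + 1

φ Ψ : Series
φ = θ (square 0) 1ᶜ
Ψ = θ (triangle 0) 1ᶜ

θ-square : ∀ k c → θ (square k) c ≈ dil (suc k) (θ (square 0) c)
θ-square k = θ-dil k (square 0) (square k) (λ x → cong (λ z → + suc k ℤ.* z) (sym (ℤₚ.*-identityˡ (sq x))))

θ-triangle : ∀ k c → θ (triangle k) c ≈ dil (suc k) (θ (triangle 0) c)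
θ-triangle k = θ-dil k (triangle 0) (triangle k) (λ x → cong (λ z → + suc k ℤ.* z) (sym (ℤₚ.*-identityˡ (tri x))))

-- Odd numbers are written 2k - 1 because (2k - 1)² = 1 + 8 k(k - 1)/2 then has the argument of
-- `tri`.
parity : ∀ z → (∃ λ k → z ≡ + 2 ℤ.* k) ⊎ (∃ λ k → z ≡ + 2 ℤ.* k ℤ.- + 1)
parity (+ n) = nonnegative n
  where
  1+even : ∀ k → + 1 ℤ.+ (+ 2 ℤ.* k) ≡ + 2 ℤ.* (k ℤ.+ + 1) ℤ.- + 1
  1+even = solve-∀
  1+odd : ∀ k → + 1 ℤ.+ (+ 2 ℤ.* k ℤ.- + 1) ≡ + 2 ℤ.* k
  1+odd = solve-∀
  nonnegative : ∀ n → (∃ λ k → + n ≡ + 2 ℤ.* k) ⊎ (∃ λ k → + n ≡ + 2 ℤ.* k ℤ.- + 1)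
  nonnegative zero = inj₁ (+ 0 , refl)
  nonnegative (suc n) with nonnegative n
  ... | inj₁ (k , p) = inj₂ (k ℤ.+ + 1 , trans (cong (λ z → + 1 ℤ.+ z) p) (1+even k))
  ... | inj₂ (k , p) = inj₁ (k , trans (cong (λ z → + 1 ℤ.+ z) p) (1+odd k))
parity -[1+ n ] = negative n
  where
  even-1 : ∀ k → ℤ.- + 1 ℤ.+ (+ 2 ℤ.* k) ≡ + 2 ℤ.* k ℤ.- + 1
  even-1 = solve-∀
  odd-1 : ∀ k → ℤ.- + 1 ℤ.+ (+ 2 ℤ.* k ℤ.- + 1) ≡ + 2 ℤ.* (k ℤ.- + 1)
  odd-1 = solve-∀
  negative : ∀ n → (∃ λ k → -[1+ n ] ≡ + 2 ℤ.* k) ⊎ (∃ λ k → -[1+ n ] ≡ + 2 ℤ.* k ℤ.- + 1)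
  negative zero = inj₂ (+ 0 , refl)
  negative (suc n) with negative n
  ... | inj₁ (k , p) = inj₂ (k , trans (cong (λ z → ℤ.- + 1 ℤ.+ z) p) (even-1 k))
  ... | inj₂ (k , p) = inj₁ (k ℤ.- + 1 , trans (cong (λ z → ℤ.- + 1 ℤ.+ z) p) (odd-1 k))

altℤ-pred : ∀ z → altℤ (z ℤ.- + 1) ≡ ℤ.- altℤ z
altℤ-pred (+ zero)   = refl
altℤ-pred (+ suc n)  = sym (ℤₚ.neg-involutive (alt n))
altℤ-pred (-[1+ n ]) = cong (λ k → alt (suc (suc k))) (ℕₚ.+-identityʳ n)

altℤ-even : ∀ k → altℤ (+ 2 ℤ.* k) ≡ + 1
altℤ-even k = trans (cong alt (trans (ℤₚ.abs-* (+ 2) k) (cong (ℤ.∣ k ∣ ℕ.+_) (ℕₚ.+-identityʳ ℤ.∣ k ∣))))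
  (trans (alt-+ ℤ.∣ k ∣ ℤ.∣ k ∣) (alt² ℤ.∣ k ∣))

altℤ-odd : ∀ k → altℤ (+ 2 ℤ.* k ℤ.- + 1) ≡ ℤ.- + 1
altℤ-odd k = trans (altℤ-pred (+ 2 ℤ.* k)) (cong ℤ.-_ (altℤ-even k))

even≢odd : ∀ k l → + 2 ℤ.* k ≢ + 2 ℤ.* l ℤ.- + 1
even≢odd k l p with trans (sym (altℤ-even k)) (trans (cong altℤ p) (altℤ-odd l))
... | ()

1-1-x : ∀ x → + 1 ℤ.- (+ 1 ℤ.- x) ≡ x
1-1-x = solve-∀

×-≡ : {x x′ : A₁} {y y′ : A₂} → x ≡ x′ → y ≡ y′ → (x , y) ≡ (x′ , y′)
×-≡ refl refl = refl

⊎-injective : {f : A₁ ⊎ A₂ → A} → (∀ {a a′} → f (inj₁ a) ≡ f (inj₁ a′) → a ≡ a′) →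
              (∀ {a a′} → f (inj₂ a) ≡ f (inj₂ a′) → a ≡ a′) → (∀ a b → f (inj₁ a) ≢ f (inj₂ b)) →
              ∀ {a b} → f a ≡ f b → a ≡ b
⊎-injective p q r {inj₁ a} {inj₁ b} e = cong inj₁ (p e)
⊎-injective p q r {inj₁ a} {inj₂ b} e = ⊥-elim (r a b e)
⊎-injective p q r {inj₂ a} {inj₁ b} e = ⊥-elim (r b a (sym e))
⊎-injective p q r {inj₂ a} {inj₂ b} e = cong inj₂ (q e)

-- Injectivity of an affine map whose inverse has the denominator k + 1, without fractions.
recover : ∀ k {f : ℤ × ℤ → ℤ × ℤ} (u v : ℤ × ℤ → ℤ) →
          (∀ t s → + suc k ℤ.* t ≡ u (f (t , s))) → (∀ t s → + suc k ℤ.* s ≡ v (f (t , s))) →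
          ∀ {a b} → f a ≡ f b → a ≡ b
recover k u v p q {t , s} {t′ , s′} e = ×-≡
  (ℤₚ.*-cancelˡ-≡ (+ suc k) t t′ (trans (p t s) (trans (cong u e) (sym (p t′ s′)))))
  (ℤₚ.*-cancelˡ-≡ (+ suc k) s s′ (trans (q t s) (trans (cong v e) (sym (q t′ s′)))))

odd² : ∀ t → sq (+ 2 ℤ.* t ℤ.- + 1) ≡ + 1 ℤ.+ + 8 ℤ.* tri t
odd² t = trans (lem₁ t) (trans (cong (λ z → + 1 ℤ.+ + 4 ℤ.* z) (sym (tri-double t))) (lem₂ (tri t)))
  where
  lem₁ : ∀ t → (+ 2 ℤ.* t ℤ.- + 1) ℤ.* (+ 2 ℤ.* t ℤ.- + 1) ≡ + 1 ℤ.+ + 4 ℤ.* (t ℤ.* (t ℤ.- + 1))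
  lem₁ = solve-∀
  lem₂ : ∀ z → + 1 ℤ.+ + 4 ℤ.* (+ 2 ℤ.* z) ≡ + 1 ℤ.+ + 8 ℤ.* z
  lem₂ = solve-∀

tri-unique : ∀ x z → x ℤ.* (x ℤ.- + 1) ≡ + 2 ℤ.* z → tri x ≡ z
tri-unique x z p = ℤₚ.*-cancelˡ-≡ (+ 2) (tri x) z (trans (tri-double x) p)

tri-reflect : ∀ x → tri (+ 1 ℤ.- x) ≡ tri x
tri-reflect x = tri-unique (+ 1 ℤ.- x) (tri x) (trans (lem x) (sym (tri-double x)))
  where
  lem : ∀ x → (+ 1 ℤ.- x) ℤ.* (+ 1 ℤ.- x ℤ.- + 1) ≡ x ℤ.* (x ℤ.- + 1)
  lem = solve-∀

φ-split : φ ≈ dil 4 φ ⊕ xp 1 ⊗ dil 8 Ψ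
φ-split = ≈-trans (θ-reindex (square 0) (graded-⊎ (square 3) (graded-shift 1 (triangle 7))) h level
    (⊎-injective (λ {a} {b} → ℤₚ.*-cancelˡ-≡ (+ 2) a b)
      (λ {a} {b} e → ℤₚ.*-cancelˡ-≡ (+ 2) a b (ℤ+.∙-cancelʳ (ℤ.- + 1) _ _ e)) (λ a b → even≢odd a b))
    surjective 1ᶜ)
  (≈-trans (θ-⊎ (square 3) (graded-shift 1 (triangle 7)) 1ᶜ)
    (⊕-cong (θ-square 3 1ᶜ) (≈-trans (θ-shift 1 (triangle 7) (graded-shift 1 (triangle 7)) (λ _ → refl) 1ᶜ)
      (⊗-congʳ (xp 1) (θ-triangle 7 1ᶜ)))))
  where
  h : ℤ ⊎ ℤ → ℤ
  h = [ (λ x → + 2 ℤ.* x) , (λ x → + 2 ℤ.* x ℤ.- + 1) ]′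
  level : ∀ b → + 1 ℤ.* sq (h b) ≡ [ (λ x → + 4 ℤ.* sq x) , (λ x → + 1 ℤ.+ + 8 ℤ.* tri x) ]′ b
  level (inj₁ x) = lem x
    where
    lem : ∀ x → + 1 ℤ.* ((+ 2 ℤ.* x) ℤ.* (+ 2 ℤ.* x)) ≡ + 4 ℤ.* (x ℤ.* x)
    lem = solve-∀
  level (inj₂ x) = trans (ℤₚ.*-identityˡ _) (odd² x)
  surjective : ∀ a → ∃ λ b → h b ≡ a
  surjective a with parity a
  ... | inj₁ (k , p) = inj₁ k , sym p
  ... | inj₂ (k , p) = inj₂ k , sym p

-- The substitution by half sums and half differences of x and y, separated by the parity of x - y.
φ²-split : φ ⊗ φ ≈ dil 2 φ ⊗ dil 2 φ ⊕ xp 1 ⊗ (dil 4 Ψ ⊗ dil 4 Ψ)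
φ²-split = ≈-trans (≈-sym (θ-× (square 0) (square 0) 1ᶜ 1ᶜ))
  (≈-trans (θ-reindex (graded-× (square 0) (square 0)) (graded-⊎ G₁ (graded-shift 1 G₂)) h level
    (⊎-injective (recover 1 (λ (x , y) → x ℤ.+ y) (λ (x , y) → x ℤ.- y) l₁ l₂)
      (recover 1 (λ (x , y) → x ℤ.+ y ℤ.+ + 1) (λ (x , y) → x ℤ.- y ℤ.+ + 1) l₃ l₄) disjoint)
    surjective 1ᶜ)
  (≈-trans (θ-⊎ G₁ (graded-shift 1 G₂) 1ᶜ)
    (⊕-cong (≈-trans (θ-× (square 1) (square 1) 1ᶜ 1ᶜ) (⊗-cong (θ-square 1 1ᶜ) (θ-square 1 1ᶜ)))
      (≈-trans (θ-shift 1 G₂ (graded-shift 1 G₂) (λ _ → refl) 1ᶜ)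
        (⊗-congʳ (xp 1) (≈-trans (θ-× (triangle 3) (triangle 3) 1ᶜ 1ᶜ) (⊗-cong (θ-triangle 3 1ᶜ) (θ-triangle 3 1ᶜ))))))))
  where
  G₁ = graded-× (square 1) (square 1)
  G₂ = graded-× (triangle 3) (triangle 3)
  h : (ℤ × ℤ) ⊎ (ℤ × ℤ) → ℤ × ℤ
  h = [ (λ (s , t) → s ℤ.+ t , s ℤ.- t) , (λ (s , t) → s ℤ.+ t ℤ.- + 1 , s ℤ.- t) ]′
  l₁ : ∀ s t → + 2 ℤ.* s ≡ s ℤ.+ t ℤ.+ (s ℤ.- t)
  l₁ = solve-∀
  l₂ : ∀ s t → + 2 ℤ.* t ≡ s ℤ.+ t ℤ.- (s ℤ.- t)
  l₂ = solve-∀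
  l₃ : ∀ s t → + 2 ℤ.* s ≡ s ℤ.+ t ℤ.- + 1 ℤ.+ (s ℤ.- t) ℤ.+ + 1
  l₃ = solve-∀
  l₄ : ∀ s t → + 2 ℤ.* t ≡ s ℤ.+ t ℤ.- + 1 ℤ.- (s ℤ.- t) ℤ.+ + 1
  l₄ = solve-∀
  disjoint : ∀ a b → h (inj₁ a) ≢ h (inj₂ b)
  disjoint (s , t) (s′ , t′) e = even≢odd s s′ (trans (l₁ s t) (trans (cong (λ (x , y) → x ℤ.+ y) e) (lem s′ t′)))
    where
    lem : ∀ s t → s ℤ.+ t ℤ.- + 1 ℤ.+ (s ℤ.- t) ≡ + 2 ℤ.* s ℤ.- + 1
    lem = solve-∀
  level : ∀ b → + 1 ℤ.* sq (proj₁ (h b)) ℤ.+ + 1 ℤ.* sq (proj₂ (h b)) ≡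
          [ (λ (s , t) → + 2 ℤ.* sq s ℤ.+ + 2 ℤ.* sq t) , (λ (s , t) → + 1 ℤ.+ (+ 4 ℤ.* tri s ℤ.+ + 4 ℤ.* tri t)) ]′ b
  level (inj₁ (s , t)) = lem s t
    where
    lem : ∀ s t → + 1 ℤ.* ((s ℤ.+ t) ℤ.* (s ℤ.+ t)) ℤ.+ + 1 ℤ.* ((s ℤ.- t) ℤ.* (s ℤ.- t)) ≡ + 2 ℤ.* (s ℤ.* s) ℤ.+ + 2 ℤ.* (t ℤ.* t)
    lem = solve-∀
  level (inj₂ (s , t)) = trans (lem s t) (trans
    (cong₂ (λ a b → + 1 ℤ.+ (+ 2 ℤ.* a ℤ.+ + 2 ℤ.* b)) (sym (tri-double s)) (sym (tri-double t))) (lem′ (tri s) (tri t)))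
    where
    lem : ∀ s t → + 1 ℤ.* ((s ℤ.+ t ℤ.- + 1) ℤ.* (s ℤ.+ t ℤ.- + 1)) ℤ.+ + 1 ℤ.* ((s ℤ.- t) ℤ.* (s ℤ.- t)) ≡
          + 1 ℤ.+ (+ 2 ℤ.* (s ℤ.* (s ℤ.- + 1)) ℤ.+ + 2 ℤ.* (t ℤ.* (t ℤ.- + 1)))
    lem = solve-∀
    lem′ : ∀ a b → + 1 ℤ.+ (+ 2 ℤ.* (+ 2 ℤ.* a) ℤ.+ + 2 ℤ.* (+ 2 ℤ.* b)) ≡ + 1 ℤ.+ (+ 4 ℤ.* a ℤ.+ + 4 ℤ.* b)
    lem′ = solve-∀
  surjective : ∀ a → ∃ λ b → h b ≡ a
  surjective (x , y) with parity (x ℤ.- y)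
  ... | inj₁ (k , p) = inj₁ (y ℤ.+ k , k) , ×-≡ (trans (lem k y) (trans (cong (λ z → y ℤ.+ z) (sym p)) (lem′ x y))) (lem″ k y)
    where
    lem : ∀ k y → y ℤ.+ k ℤ.+ k ≡ y ℤ.+ + 2 ℤ.* k
    lem = solve-∀
    lem′ : ∀ x y → y ℤ.+ (x ℤ.- y) ≡ x
    lem′ = solve-∀
    lem″ : ∀ k y → y ℤ.+ k ℤ.- k ≡ y
    lem″ = solve-∀
  ... | inj₂ (k , p) = inj₂ (y ℤ.+ k , k) , ×-≡ (trans (lem k y) (trans (cong (λ z → y ℤ.+ z) (sym p)) (lem′ x y))) (lem″ k y)
    where
    lem : ∀ k y → y ℤ.+ k ℤ.+ k ℤ.- + 1 ≡ y ℤ.+ (+ 2 ℤ.* k ℤ.- + 1)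
    lem = solve-∀
    lem′ : ∀ x y → y ℤ.+ (x ℤ.- y) ≡ x
    lem′ = solve-∀
    lem″ : ∀ k y → y ℤ.+ k ℤ.- k ≡ y
    lem″ = solve-∀

-- With X = 2x - 1 and Y = 2y - 1, every pair of odd numbers is X = a + 3b, Y = ±(a - b) for a unique
-- (a , b) with a + b odd and a unique sign, and then X² + 3Y² = 4(a² + 3b²).
-- piece₁ and piece₂ have (a , b) = (2t - 1 , ± 2s), piece₃ and piece₄ have (a , b) = (2s , ± (2t - 1)).
piece₁ piece₂ piece₃ piece₄ : ℤ × ℤ → ℤ × ℤ
piece₁ (t , s) = t ℤ.+ + 3 ℤ.* s , t ℤ.- s
piece₃ (t , s) = s ℤ.+ + 3 ℤ.* t ℤ.- + 1 , s ℤ.- t ℤ.+ + 1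
reflect₂ : ℤ × ℤ → ℤ × ℤ
reflect₂ (x , y) = x , + 1 ℤ.- y
piece₂ (t , s) = reflect₂ (piece₁ (t , ℤ.- s))
piece₄ (t , s) = reflect₂ (piece₃ (+ 1 ℤ.- t , s))

-- The values of `near` are the pairs with x ≡ y modulo 2. Since Y ↦ -Y is y ↦ 1 - y, which changes
-- the parity of y, `far` covers the other pairs.
near far pieces : _ → ℤ × ℤ
near = [ piece₁ , piece₃ ]′
far  = [ piece₂ , piece₄ ]′
pieces = [ near , far ]′

-- This is b ↦ -b. With it built into `piece₂` and `piece₄`, the terms in ab of a quadratic weight
-- cancel when the two pieces over one (a , b) are added.
flip : (ℤ × ℤ) ⊎ (ℤ × ℤ) → (ℤ × ℤ) ⊎ (ℤ × ℤ)
flip (inj₁ (t , s)) = inj₁ (t , ℤ.- s)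
flip (inj₂ (t , s)) = inj₂ (+ 1 ℤ.- t , s)

flip-flip : ∀ b → flip (flip b) ≡ b
flip-flip (inj₁ (t , s)) = cong (λ z → inj₁ (t , z)) (ℤₚ.neg-involutive s)
flip-flip (inj₂ (t , s)) = cong (λ z → inj₂ (z , s)) (1-1-x t)

far-near : ∀ b → far b ≡ reflect₂ (near (flip b))
far-near (inj₁ _) = refl
far-near (inj₂ _) = refl

reflect₂-involutive : ∀ a → reflect₂ (reflect₂ a) ≡ a
reflect₂-involutive (x , y) = cong (x ,_) (1-1-x y)

near-injective : ∀ {a b} → near a ≡ near b → a ≡ b
near-injective = ⊎-injective
  (recover 3 (λ (x , y) → x ℤ.+ + 3 ℤ.* y) (λ (x , y) → x ℤ.- y) l₁ l₂)
  (recover 3 (λ (x , y) → x ℤ.- y ℤ.+ + 2) (λ (x , y) → x ℤ.+ + 3 ℤ.* y ℤ.- + 2) l₃ l₄) disjoint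
  where
  l₁ : ∀ t s → + 4 ℤ.* t ≡ t ℤ.+ + 3 ℤ.* s ℤ.+ + 3 ℤ.* (t ℤ.- s)
  l₁ = solve-∀
  l₂ : ∀ t s → + 4 ℤ.* s ≡ t ℤ.+ + 3 ℤ.* s ℤ.- (t ℤ.- s)
  l₂ = solve-∀
  l₃ : ∀ t s → + 4 ℤ.* t ≡ s ℤ.+ + 3 ℤ.* t ℤ.- + 1 ℤ.- (s ℤ.- t ℤ.+ + 1) ℤ.+ + 2
  l₃ = solve-∀
  l₄ : ∀ t s → + 4 ℤ.* s ≡ s ℤ.+ + 3 ℤ.* t ℤ.- + 1 ℤ.+ + 3 ℤ.* (s ℤ.- t ℤ.+ + 1) ℤ.- + 2
  l₄ = solve-∀
  disjoint : ∀ a b → piece₁ a ≢ piece₃ b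
  disjoint (t , s) (t′ , s′) e = even≢odd s t′ (ℤₚ.*-cancelˡ-≡ (+ 2) _ _
    (trans (d₁ t s) (trans (cong (λ (x , y) → x ℤ.- y) e) (d₂ t′ s′))))
    where
    d₁ : ∀ t s → + 2 ℤ.* (+ 2 ℤ.* s) ≡ t ℤ.+ + 3 ℤ.* s ℤ.- (t ℤ.- s)
    d₁ = solve-∀
    d₂ : ∀ t s → s ℤ.+ + 3 ℤ.* t ℤ.- + 1 ℤ.- (s ℤ.- t ℤ.+ + 1) ≡ + 2 ℤ.* (+ 2 ℤ.* t ℤ.- + 1)
    d₂ = solve-∀

near-even : ∀ b → ∃ λ k → proj₁ (near b) ≡ + 2 ℤ.* k ℤ.+ proj₂ (near b)
near-even (inj₁ (t , s)) = + 2 ℤ.* s , lem t s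
  where
  lem : ∀ t s → t ℤ.+ + 3 ℤ.* s ≡ + 2 ℤ.* (+ 2 ℤ.* s) ℤ.+ (t ℤ.- s)
  lem = solve-∀
near-even (inj₂ (t , s)) = + 2 ℤ.* t ℤ.- + 1 , lem t s
  where
  lem : ∀ t s → s ℤ.+ + 3 ℤ.* t ℤ.- + 1 ≡ + 2 ℤ.* (+ 2 ℤ.* t ℤ.- + 1) ℤ.+ (s ℤ.- t ℤ.+ + 1)
  lem = solve-∀

far-odd : ∀ b → ∃ λ k → proj₁ (far b) ≡ + 2 ℤ.* k ℤ.- + 1 ℤ.+ proj₂ (far b)
far-odd b with near (flip b) | near-even (flip b) | far b | far-near b
... | x , y | k , p | .(x , + 1 ℤ.- y) | refl = k ℤ.+ y , trans p (lem k y)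
  where
  lem : ∀ k y → + 2 ℤ.* k ℤ.+ y ≡ + 2 ℤ.* (k ℤ.+ y) ℤ.- + 1 ℤ.+ (+ 1 ℤ.- y)
  lem = solve-∀

near-surjective : ∀ x y k → x ≡ + 2 ℤ.* k ℤ.+ y → ∃ λ b → near b ≡ (x , y)
near-surjective x y k p with parity k
... | inj₁ (s , refl) = inj₁ (y ℤ.+ s , s) , ×-≡ (trans (lem s y) (sym p)) (lem′ s y)
  where
  lem : ∀ s y → y ℤ.+ s ℤ.+ + 3 ℤ.* s ≡ + 2 ℤ.* (+ 2 ℤ.* s) ℤ.+ y
  lem = solve-∀
  lem′ : ∀ s y → y ℤ.+ s ℤ.- s ≡ y
  lem′ = solve-∀
... | inj₂ (t , refl) = inj₂ (t , y ℤ.+ t ℤ.- + 1) , ×-≡ (trans (lem t y) (sym p)) (lem′ t y)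
  where
  lem : ∀ t y → y ℤ.+ t ℤ.- + 1 ℤ.+ + 3 ℤ.* t ℤ.- + 1 ≡ + 2 ℤ.* (+ 2 ℤ.* t ℤ.- + 1) ℤ.+ y
  lem = solve-∀
  lem′ : ∀ t y → y ℤ.+ t ℤ.- + 1 ℤ.- t ℤ.+ + 1 ≡ y
  lem′ = solve-∀

pieces-injective : ∀ {a b} → pieces a ≡ pieces b → a ≡ b
pieces-injective = ⊎-injective near-injective far-injective disjoint
  where
  far-injective : ∀ {a b} → far a ≡ far b → a ≡ b
  far-injective {a} {b} e = trans (sym (flip-flip a)) (trans (cong flip (near-injective
    (trans (sym (reflect₂-involutive _)) (trans (cong reflect₂ (trans (sym (far-near a)) (trans e (far-near b))))
      (reflect₂-involutive _))))) (flip-flip b))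
  disjoint : ∀ a b → near a ≢ far b
  disjoint a b e with near-even a | far-odd b
  ... | k , p | l , q = even≢odd k l (ℤ+.∙-cancelʳ (proj₂ (near a)) _ _
        (trans (sym p) (trans (cong proj₁ e) (trans q (cong (λ z → + 2 ℤ.* l ℤ.- + 1 ℤ.+ proj₂ z) (sym e))))))

pieces-surjective : ∀ a → ∃ λ b → pieces b ≡ a
pieces-surjective (x , y) with parity (x ℤ.- y)
... | inj₁ (k , p) with near-surjective x y k (trans (lem x y) (cong (ℤ._+ y) p))
  where
  lem : ∀ x y → x ≡ x ℤ.- y ℤ.+ y
  lem = solve-∀
...   | b , q = inj₁ b , q
pieces-surjective (x , y) | inj₂ (k , p) with near-surjective x (+ 1 ℤ.- y) (k ℤ.+ y ℤ.- + 1) (trans (lem x y) (trans (cong (ℤ._+ y) p) (lem′ k y)))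
  where
  lem : ∀ x y → x ≡ x ℤ.- y ℤ.+ y
  lem = solve-∀
  lem′ : ∀ k y → + 2 ℤ.* k ℤ.- + 1 ℤ.+ y ≡ + 2 ℤ.* (k ℤ.+ y ℤ.- + 1) ℤ.+ (+ 1 ℤ.- y)
  lem′ = solve-∀
...   | b , q = inj₂ (flip b) , trans (far-near (flip b)) (trans (cong (λ c → reflect₂ (near c)) (flip-flip b))
        (trans (cong reflect₂ q) (reflect₂-involutive (x , y))))

form : ℤ × ℤ → ℤ
form (x , y) = tri x ℤ.+ + 3 ℤ.* tri y

form₁ form₂ : ℤ × ℤ → ℤ
form₁ (t , s) = + 4 ℤ.* tri t ℤ.+ + 6 ℤ.* sq s
form₂ (t , s) = + 1 ℤ.+ (+ 12 ℤ.* tri t ℤ.+ + 2 ℤ.* sq s)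

form-double : ∀ x y → + 2 ℤ.* form (x , y) ≡ x ℤ.* (x ℤ.- + 1) ℤ.+ + 3 ℤ.* (y ℤ.* (y ℤ.- + 1))
form-double x y = trans (lem (tri x) (tri y)) (cong₂ (λ a b → a ℤ.+ + 3 ℤ.* b) (tri-double x) (tri-double y))
  where
  lem : ∀ a b → + 2 ℤ.* (a ℤ.+ + 3 ℤ.* b) ≡ + 2 ℤ.* a ℤ.+ + 3 ℤ.* (+ 2 ℤ.* b)
  lem = solve-∀

form-piece₁ : ∀ a → form (piece₁ a) ≡ form₁ a
form-piece₁ (t , s) = ℤₚ.*-cancelˡ-≡ (+ 2) _ _ (trans (form-double (t ℤ.+ + 3 ℤ.* s) (t ℤ.- s))
  (trans (lem₁ t s) (trans (cong (λ z → + 4 ℤ.* z ℤ.+ + 12 ℤ.* (s ℤ.* s)) (sym (tri-double t))) (lem₂ (tri t) s))))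
  where
  lem₁ : ∀ t s → (t ℤ.+ + 3 ℤ.* s) ℤ.* (t ℤ.+ + 3 ℤ.* s ℤ.- + 1) ℤ.+ + 3 ℤ.* ((t ℤ.- s) ℤ.* (t ℤ.- s ℤ.- + 1)) ≡
         + 4 ℤ.* (t ℤ.* (t ℤ.- + 1)) ℤ.+ + 12 ℤ.* (s ℤ.* s)
  lem₁ = solve-∀
  lem₂ : ∀ a s → + 4 ℤ.* (+ 2 ℤ.* a) ℤ.+ + 12 ℤ.* (s ℤ.* s) ≡ + 2 ℤ.* (+ 4 ℤ.* a ℤ.+ + 6 ℤ.* (s ℤ.* s))
  lem₂ = solve-∀

form-piece₃ : ∀ a → form (piece₃ a) ≡ form₂ a
form-piece₃ (t , s) = ℤₚ.*-cancelˡ-≡ (+ 2) _ _ (trans (form-double (s ℤ.+ + 3 ℤ.* t ℤ.- + 1) (s ℤ.- t ℤ.+ + 1))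
  (trans (lem₁ t s) (trans (cong (λ z → + 2 ℤ.+ (+ 12 ℤ.* z ℤ.+ + 4 ℤ.* (s ℤ.* s))) (sym (tri-double t))) (lem₂ (tri t) s))))
  where
  lem₁ : ∀ t s → (s ℤ.+ + 3 ℤ.* t ℤ.- + 1) ℤ.* (s ℤ.+ + 3 ℤ.* t ℤ.- + 1 ℤ.- + 1) ℤ.+
           + 3 ℤ.* ((s ℤ.- t ℤ.+ + 1) ℤ.* (s ℤ.- t ℤ.+ + 1 ℤ.- + 1)) ≡
         + 2 ℤ.+ (+ 12 ℤ.* (t ℤ.* (t ℤ.- + 1)) ℤ.+ + 4 ℤ.* (s ℤ.* s))
  lem₁ = solve-∀
  lem₂ : ∀ a s → + 2 ℤ.+ (+ 12 ℤ.* (+ 2 ℤ.* a) ℤ.+ + 4 ℤ.* (s ℤ.* s)) ≡ + 2 ℤ.* (+ 1 ℤ.+ (+ 12 ℤ.* a ℤ.+ + 2 ℤ.* (s ℤ.* s)))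
  lem₂ = solve-∀

form-reflect₂ : ∀ a → form (reflect₂ a) ≡ form a
form-reflect₂ (x , y) = cong (λ z → tri x ℤ.+ + 3 ℤ.* z) (tri-reflect y)

form-pieces : ∀ b → form (pieces b) ≡ [ [ form₁ , form₂ ]′ , [ form₁ , form₂ ]′ ]′ b
form-pieces (inj₁ (inj₁ a)) = form-piece₁ a
form-pieces (inj₁ (inj₂ a)) = form-piece₃ a
form-pieces (inj₂ (inj₁ (t , s))) = trans (form-reflect₂ (piece₁ (t , ℤ.- s)))
  (trans (form-piece₁ (t , ℤ.- s)) (cong (λ z → + 4 ℤ.* tri t ℤ.+ + 6 ℤ.* z) (lem s)))
  where
  lem : ∀ s → (ℤ.- s) ℤ.* (ℤ.- s) ≡ s ℤ.* s
  lem = solve-∀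
form-pieces (inj₂ (inj₂ (t , s))) = trans (form-reflect₂ (piece₃ (+ 1 ℤ.- t , s)))
  (trans (form-piece₃ (+ 1 ℤ.- t , s)) (cong (λ z → + 1 ℤ.+ (+ 12 ℤ.* z ℤ.+ + 2 ℤ.* sq s)) (tri-reflect t)))

-- The parameters (m , k) are (0 , 1) for Ψ Ψ₃, (4 , 8) for the odd-odd part of x² + 3y², and (1 ,
-- 2) for q times the product of 𝒥 at q² and at q⁶.
θ-pieces : ∀ m k {e e₁ e₂ : ℤ × ℤ → ℤ} (G : Graded e) (G₁ : Graded e₁) (G₂ : Graded e₂) →
  (∀ a → e a ≡ m ℤ.+ k ℤ.* form a) → (∀ a → e₁ a ≡ m ℤ.+ k ℤ.* form₁ a) → (∀ a → e₂ a ≡ m ℤ.+ k ℤ.* form₂ a) → ∀ c →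
  θ G c ≈ θ G₁ (λ a → c (piece₁ a) ℤ.+ c (piece₂ a)) ⊕ θ G₂ (λ a → c (piece₃ a) ℤ.+ c (piece₄ a))
θ-pieces m k {e} {e₁} {e₂} G G₁ G₂ p p₁ p₂ c = ≈-trans
  (θ-reindex G (graded-⊎ (graded-⊎ G₁ G₂) (graded-⊎ G₁ G₂)) pieces level pieces-injective pieces-surjective c)
  (≈-trans (θ-⊎ (graded-⊎ G₁ G₂) (graded-⊎ G₁ G₂) (λ b → c (pieces b)))
  (≈-trans (⊕-cong (θ-⊎ G₁ G₂ (λ b → c (near b))) (θ-⊎ G₁ G₂ (λ b → c (far b))))
  (≈-trans (solve 4 (λ a b c d → (a :+ b) :+ (c :+ d) := (a :+ c) :+ (b :+ d)) ≈-refl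
      (θ G₁ (λ a → c (piece₁ a))) (θ G₂ (λ a → c (piece₃ a))) (θ G₁ (λ a → c (piece₂ a))) (θ G₂ (λ a → c (piece₄ a))))
    (⊕-cong (≈-sym (θ-+ G₁ (λ a → c (piece₁ a)) (λ a → c (piece₂ a)))) (≈-sym (θ-+ G₂ (λ a → c (piece₃ a)) (λ a → c (piece₄ a))))))))
  where
  level : ∀ b → e (pieces b) ≡ [ [ e₁ , e₂ ]′ , [ e₁ , e₂ ]′ ]′ b
  level b = trans (p (pieces b)) (trans (cong (λ z → m ℤ.+ k ℤ.* z) (form-pieces b)) (lem b))
    where
    lem : ∀ b → m ℤ.+ k ℤ.* [ [ form₁ , form₂ ]′ , [ form₁ , form₂ ]′ ]′ b ≡ [ [ e₁ , e₂ ]′ , [ e₁ , e₂ ]′ ]′ b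
    lem (inj₁ (inj₁ a)) = sym (p₁ a)
    lem (inj₁ (inj₂ a)) = sym (p₂ a)
    lem (inj₂ (inj₁ a)) = sym (p₁ a)
    lem (inj₂ (inj₂ a)) = sym (p₂ a)

ΨΨ₃-split : Ψ ⊗ dil 3 Ψ ≈ C (+ 2) ⊗ (dil 4 Ψ ⊗ dil 6 φ ⊕ xp 1 ⊗ (dil 12 Ψ ⊗ dil 2 φ))
ΨΨ₃-split = begin
  Ψ ⊗ dil 3 Ψ
    ≈⟨ ⊗-congʳ Ψ (≈-sym (θ-triangle 2 1ᶜ)) ⟩
  Ψ ⊗ θ (triangle 2) 1ᶜ
    ≈⟨ ≈-sym (θ-× (triangle 0) (triangle 2) 1ᶜ 1ᶜ) ⟩
  θ (graded-× (triangle 0) (triangle 2)) 1ᶜ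
    ≈⟨ θ-pieces (+ 0) (+ 1) (graded-× (triangle 0) (triangle 2)) G₁ (graded-shift 1 G₂)
         (λ (x , y) → l₀ (tri x) (tri y)) (λ (t , s) → l₁ (tri t) (sq s)) (λ (t , s) → l₂ (tri t) (sq s)) 1ᶜ ⟩
  θ G₁ (λ _ → + 2) ⊕ θ (graded-shift 1 G₂) (λ _ → + 2)
    ≈⟨ ⊕-cong (θ-* G₁ (+ 2) 1ᶜ) (≈-trans (θ-shift 1 G₂ (graded-shift 1 G₂) (λ _ → refl) (λ _ → + 2))
         (⊗-congʳ (xp 1) (θ-* G₂ (+ 2) 1ᶜ))) ⟩
  C (+ 2) ⊗ θ G₁ 1ᶜ ⊕ xp 1 ⊗ (C (+ 2) ⊗ θ G₂ 1ᶜ)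
    ≈⟨ solve 3 (λ x a b → con (+ 2) :* a :+ x :* (con (+ 2) :* b) := con (+ 2) :* (a :+ x :* b)) ≈-refl (xp 1) (θ G₁ 1ᶜ) (θ G₂ 1ᶜ) ⟩
  C (+ 2) ⊗ (θ G₁ 1ᶜ ⊕ xp 1 ⊗ θ G₂ 1ᶜ)
    ≈⟨ ⊗-congʳ (C (+ 2)) (⊕-cong
         (≈-trans (θ-× (triangle 3) (square 5) 1ᶜ 1ᶜ) (⊗-cong (θ-triangle 3 1ᶜ) (θ-square 5 1ᶜ)))
         (⊗-congʳ (xp 1) (≈-trans (θ-× (triangle 11) (square 1) 1ᶜ 1ᶜ) (⊗-cong (θ-triangle 11 1ᶜ) (θ-square 1 1ᶜ))))) ⟩
  C (+ 2) ⊗ (dil 4 Ψ ⊗ dil 6 φ ⊕ xp 1 ⊗ (dil 12 Ψ ⊗ dil 2 φ)) ∎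
  where
  open ≈-Reasoning
  G₁ = graded-× (triangle 3) (square 5)
  G₂ = graded-× (triangle 11) (square 1)
  l₀ : ∀ a b → + 1 ℤ.* a ℤ.+ + 3 ℤ.* b ≡ + 0 ℤ.+ + 1 ℤ.* (a ℤ.+ + 3 ℤ.* b)
  l₀ = solve-∀
  l₁ : ∀ a b → + 4 ℤ.* a ℤ.+ + 6 ℤ.* b ≡ + 0 ℤ.+ + 1 ℤ.* (+ 4 ℤ.* a ℤ.+ + 6 ℤ.* b)
  l₁ = solve-∀
  l₂ : ∀ a b → + 1 ℤ.+ (+ 12 ℤ.* a ℤ.+ + 2 ℤ.* b) ≡ + 0 ℤ.+ + 1 ℤ.* (+ 1 ℤ.+ (+ 12 ℤ.* a ℤ.+ + 2 ℤ.* b))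
  l₂ = solve-∀

-- The Wronskian as a theta series

odd : ℤ → ℤ
odd x = + 2 ℤ.* x ℤ.- + 1

altℤ-⊖ : ∀ i n → altℤ (i ℤ.⊖ n) ≡ alt n ℤ.* alt i
altℤ-⊖ i       zero    = sym (ℤₚ.*-identityˡ (alt i))
altℤ-⊖ zero    (suc n) = sym (ℤₚ.*-identityʳ (alt (suc n)))
altℤ-⊖ (suc i) (suc n) = trans (cong altℤ (ℤₚ.[1+m]⊖[1+n]≡m⊖n i n)) (trans (altℤ-⊖ i n) (lem (alt n) (alt i)))
  where
  lem : ∀ a b → a ℤ.* b ≡ (ℤ.- a) ℤ.* (ℤ.- b)
  lem = solve-∀

altℤ-reflect : ∀ x → altℤ (+ 1 ℤ.- x) ≡ ℤ.- altℤ x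
altℤ-reflect x = trans (cong altℤ (lem x)) (trans (cong alt (ℤₚ.∣-i∣≡∣i∣ (x ℤ.- + 1))) (altℤ-pred x))
  where
  lem : ∀ x → + 1 ℤ.- x ≡ ℤ.- (x ℤ.- + 1)
  lem = solve-∀

altℤ-same : ∀ k y → altℤ (+ 2 ℤ.* k ℤ.+ y) ≡ altℤ y
altℤ-same k y with parity y
... | inj₁ (m , refl) = trans (cong altℤ (lem k m)) (trans (altℤ-even (k ℤ.+ m)) (sym (altℤ-even m)))
  where
  lem : ∀ k m → + 2 ℤ.* k ℤ.+ + 2 ℤ.* m ≡ + 2 ℤ.* (k ℤ.+ m)
  lem = solve-∀
... | inj₂ (m , refl) = trans (cong altℤ (lem k m)) (trans (altℤ-odd (k ℤ.+ m)) (sym (altℤ-odd m)))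
  where
  lem : ∀ k m → + 2 ℤ.* k ℤ.+ (+ 2 ℤ.* m ℤ.- + 1) ≡ + 2 ℤ.* (k ℤ.+ m) ℤ.- + 1
  lem = solve-∀

altℤ² : ∀ x → altℤ x ℤ.* altℤ x ≡ + 1
altℤ² x = alt² ℤ.∣ x ∣

altOdd : ℤ → ℤ
altOdd x = altℤ x ℤ.* odd x

𝒥 : Series
𝒥 = θ (triangle 0) altOdd

triangle-reflect : ∀ c → θ (triangle 0) c ≈ θ (triangle 0) (λ x → c (+ 1 ℤ.- x))
triangle-reflect = θ-reindex (triangle 0) (triangle 0) (λ x → + 1 ℤ.- x)
  (λ x → cong (λ z → + 1 ℤ.* z) (tri-reflect x))
  (λ {x} {y} e → trans (sym (1-1-x x)) (trans (cong (λ z → + 1 ℤ.- z) e) (1-1-x y)))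
  (λ x → + 1 ℤ.- x , 1-1-x x)

-- The weight (-1)^x (2x - 1) is c(x) + c(1 - x) for c(x) = (-1)^x x, and both parts give the series
-- of `E³-series`.
𝒥≈-2E³ : 𝒥 ≈ ⊖ (C (+ 2) ⊗ (E ⊗ E ⊗ E))
𝒥≈-2E³ = begin
  θ (triangle 0) altOdd
    ≈⟨ θ-cong (triangle 0) (λ x → trans (lem (altℤ x) x) (cong (λ a → c x ℤ.+ a ℤ.* (+ 1 ℤ.- x)) (sym (altℤ-reflect x)))) ⟩
  θ (triangle 0) (λ x → c x ℤ.+ c (+ 1 ℤ.- x))
    ≈⟨ ≈-trans (θ-+ (triangle 0) c (λ x → c (+ 1 ℤ.- x))) (⊕-congʳ (θ (triangle 0) c) (≈-sym (triangle-reflect c))) ⟩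
  θ (triangle 0) c ⊕ θ (triangle 0) c
    ≈⟨ ⊕-cong cube cube ⟩
  ⊖ (E ⊗ E ⊗ E) ⊕ ⊖ (E ⊗ E ⊗ E)
    ≈⟨ solve 1 (λ x → :- x :+ :- x := :- (con (+ 2) :* x)) ≈-refl (E ⊗ E ⊗ E) ⟩
  ⊖ (C (+ 2) ⊗ (E ⊗ E ⊗ E)) ∎
  where
  open ≈-Reasoning
  c : ℤ → ℤ
  c x = altℤ x ℤ.* x
  lem : ∀ a x → a ℤ.* (+ 2 ℤ.* x ℤ.- + 1) ≡ a ℤ.* x ℤ.+ (ℤ.- a) ℤ.* (+ 1 ℤ.- x)
  lem = solve-∀
  cube : θ (triangle 0) c ≈ ⊖ (E ⊗ E ⊗ E)
  cube = E³-series (θ (triangle 0) c) (λ n → []-trans (θ-triangle-window c n)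
    (≈⇒≈[] (anti-cong (suc (n ℕ.+ n)) 0 refl (λ p i _ → ⊗-congˡ (xp (triAt n i)) (C-cong
      (trans (cong₂ ℤ._*_ (altℤ-⊖ i n) (sym (ℤₚ.m-n≡m⊖n i n))) (ℤₚ.*-assoc (alt n) (alt i) (+ i ℤ.- + n))))))))

ΨE≈2E₂² : Ψ ⊗ E ≈ C (+ 2) ⊗ (dil 2 E ⊗ dil 2 E)
ΨE≈2E₂² = Ψ-product Ψ (θ-triangle-window 1ᶜ)

-- The real part of (x + y√-3)².
Re² : ℤ → ℤ → ℤ
Re² x y = sq x ℤ.- + 3 ℤ.* sq y

-- The grading of ℤ² by x² + 3y² and its restrictions along ee, oo, oe and eo below.
G-all = graded-× (square 0) (square 2)
G-ee  = graded-× (square 3) (square 11)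
G-oo  = graded-shift 4 (graded-× (triangle 7) (triangle 23))
G-oe  = graded-shift 1 (graded-× (triangle 7) (square 11))
G-eo  = graded-shift 3 (graded-× (triangle 23) (square 3))

ee oo oe eo : ℤ × ℤ → ℤ × ℤ
ee (t , s) = + 2 ℤ.* t , + 2 ℤ.* s
oo (t , s) = odd t , odd s
oe (t , s) = odd t , + 2 ℤ.* s
eo (t , s) = + 2 ℤ.* s , odd t

parity-classes : ∀ c → θ G-all c ≈
  (θ G-ee (λ a → c (ee a)) ⊕ θ G-oo (λ a → c (oo a))) ⊕ (θ G-oe (λ a → c (oe a)) ⊕ θ G-eo (λ a → c (eo a)))
parity-classes c = ≈-trans
  (θ-reindex G-all (graded-⊎ (graded-⊎ G-ee G-oo) (graded-⊎ G-oe G-eo)) h level injective surjective c)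
  (≈-trans (θ-⊎ (graded-⊎ G-ee G-oo) (graded-⊎ G-oe G-eo) (λ b → c (h b)))
    (⊕-cong (θ-⊎ G-ee G-oo (λ b → c (h (inj₁ b)))) (θ-⊎ G-oe G-eo (λ b → c (h (inj₂ b))))))
  where
  h : ((ℤ × ℤ) ⊎ (ℤ × ℤ)) ⊎ ((ℤ × ℤ) ⊎ (ℤ × ℤ)) → ℤ × ℤ
  h = [ [ ee , oo ]′ , [ oe , eo ]′ ]′
  level : ∀ b → + 1 ℤ.* sq (proj₁ (h b)) ℤ.+ + 3 ℤ.* sq (proj₂ (h b)) ≡
    [ [ (λ (t , s) → + 4 ℤ.* sq t ℤ.+ + 12 ℤ.* sq s) , (λ (t , s) → + 4 ℤ.+ (+ 8 ℤ.* tri t ℤ.+ + 24 ℤ.* tri s)) ]′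
    , [ (λ (t , s) → + 1 ℤ.+ (+ 8 ℤ.* tri t ℤ.+ + 12 ℤ.* sq s)) , (λ (t , s) → + 3 ℤ.+ (+ 24 ℤ.* tri t ℤ.+ + 4 ℤ.* sq s)) ]′ ]′ b
  level (inj₁ (inj₁ (t , s))) = lem t s
    where
    lem : ∀ t s → + 1 ℤ.* ((+ 2 ℤ.* t) ℤ.* (+ 2 ℤ.* t)) ℤ.+ + 3 ℤ.* ((+ 2 ℤ.* s) ℤ.* (+ 2 ℤ.* s)) ≡ + 4 ℤ.* (t ℤ.* t) ℤ.+ + 12 ℤ.* (s ℤ.* s)
    lem = solve-∀
  level (inj₁ (inj₂ (t , s))) = trans (cong₂ (λ a b → + 1 ℤ.* a ℤ.+ + 3 ℤ.* b) (odd² t) (odd² s)) (lem (tri t) (tri s))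
    where
    lem : ∀ a b → + 1 ℤ.* (+ 1 ℤ.+ + 8 ℤ.* a) ℤ.+ + 3 ℤ.* (+ 1 ℤ.+ + 8 ℤ.* b) ≡ + 4 ℤ.+ (+ 8 ℤ.* a ℤ.+ + 24 ℤ.* b)
    lem = solve-∀
  level (inj₂ (inj₁ (t , s))) = trans (cong (λ a → + 1 ℤ.* a ℤ.+ + 3 ℤ.* sq (+ 2 ℤ.* s)) (odd² t)) (lem (tri t) s)
    where
    lem : ∀ a s → + 1 ℤ.* (+ 1 ℤ.+ + 8 ℤ.* a) ℤ.+ + 3 ℤ.* ((+ 2 ℤ.* s) ℤ.* (+ 2 ℤ.* s)) ≡ + 1 ℤ.+ (+ 8 ℤ.* a ℤ.+ + 12 ℤ.* (s ℤ.* s))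
    lem = solve-∀
  level (inj₂ (inj₂ (t , s))) = trans (cong (λ a → + 1 ℤ.* sq (+ 2 ℤ.* s) ℤ.+ + 3 ℤ.* a) (odd² t)) (lem (tri t) s)
    where
    lem : ∀ a s → + 1 ℤ.* ((+ 2 ℤ.* s) ℤ.* (+ 2 ℤ.* s)) ℤ.+ + 3 ℤ.* (+ 1 ℤ.+ + 8 ℤ.* a) ≡ + 3 ℤ.+ (+ 24 ℤ.* a ℤ.+ + 4 ℤ.* (s ℤ.* s))
    lem = solve-∀
  twice : ∀ t → + 2 ℤ.* t ≡ odd t ℤ.+ + 1
  twice = l
    where
    l : ∀ t → + 2 ℤ.* t ≡ + 2 ℤ.* t ℤ.- + 1 ℤ.+ + 1
    l = solve-∀
  injective : ∀ {a b} → h a ≡ h b → a ≡ b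
  injective = ⊎-injective
    (⊎-injective (recover 1 proj₁ proj₂ (λ _ _ → refl) (λ _ _ → refl))
      (recover 1 (λ (x , y) → x ℤ.+ + 1) (λ (x , y) → y ℤ.+ + 1) (λ t s → twice t) (λ t s → twice s))
      (λ (t , s) (t′ , s′) e → even≢odd t t′ (cong proj₁ e)))
    (⊎-injective (recover 1 (λ (x , y) → x ℤ.+ + 1) proj₂ (λ t s → twice t) (λ _ _ → refl))
      (recover 1 (λ (x , y) → y ℤ.+ + 1) proj₁ (λ t s → twice t) (λ _ _ → refl))
      (λ (t , s) (t′ , s′) e → even≢odd s′ t (sym (cong proj₁ e))))
    λ { (inj₁ (t , s)) (inj₁ (t′ , s′)) e → even≢odd t t′ (cong proj₁ e)
      ; (inj₁ (t , s)) (inj₂ (t′ , s′)) e → even≢odd s t′ (cong proj₂ e)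
      ; (inj₂ (t , s)) (inj₁ (t′ , s′)) e → even≢odd s′ s (sym (cong proj₂ e))
      ; (inj₂ (t , s)) (inj₂ (t′ , s′)) e → even≢odd s′ t (sym (cong proj₁ e)) }
  surjective : ∀ a → ∃ λ b → h b ≡ a
  surjective (x , y) with parity x | parity y
  ... | inj₁ (k , refl) | inj₁ (l , refl) = inj₁ (inj₁ (k , l)) , refl
  ... | inj₂ (k , refl) | inj₂ (l , refl) = inj₁ (inj₂ (k , l)) , refl
  ... | inj₂ (k , refl) | inj₁ (l , refl) = inj₂ (inj₁ (k , l)) , refl
  ... | inj₁ (k , refl) | inj₂ (l , refl) = inj₂ (inj₂ (l , k)) , refl

Re²′ : ℤ × ℤ → ℤ
Re²′ (x , y) = Re² x y

-- The parts of the theta series of the Wronskian with x + y odd (`V`) and even (`W`); the sign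
-- (-1)^(x + y) turns the weight -Re (x + y√-3)² into Re (x + y√-3)² in the first.
V V-oe V-eo W : Series
V-oe = θ G-oe (λ a → Re²′ (oe a))
V-eo = θ G-eo (λ a → Re²′ (eo a))
V = V-oe ⊕ V-eo
W = θ G-ee (λ a → ℤ.- Re²′ (ee a)) ⊕ θ G-oo (λ a → ℤ.- Re²′ (oo a))

θ-neg : ∀ {A : Set} {e : A → ℤ} (G : Graded e) c → θ G (λ a → ℤ.- c a) ≈ ⊖ θ G c
θ-neg G c = ≈-trans (θ-cong G (λ a → sym (ℤₚ.-1*i≡-i (c a)))) (≈-trans (θ-* G (ℤ.- + 1) c)
  (solve 1 (λ x → con (ℤ.- + 1) :* x := :- x) ≈-refl (θ G c)))

θ-v-even : θ G-ee (λ a → ℤ.- Re²′ (ee a)) ≈ C (+ 4) ⊗ dil 4 (θ G-all (λ a → ℤ.- Re²′ a))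
θ-v-even = ≈-trans (θ-cong G-ee (λ (t , s) → lem t s)) (≈-trans (θ-* G-ee (+ 4) (λ a → ℤ.- Re²′ a))
  (⊗-congʳ (C (+ 4)) (θ-dil 3 G-all G-ee (λ (t , s) → lem′ (sq t) (sq s)) (λ a → ℤ.- Re²′ a))))
  where
  lem : ∀ t s → ℤ.- ((+ 2 ℤ.* t) ℤ.* (+ 2 ℤ.* t) ℤ.- + 3 ℤ.* ((+ 2 ℤ.* s) ℤ.* (+ 2 ℤ.* s))) ≡ + 4 ℤ.* (ℤ.- (t ℤ.* t ℤ.- + 3 ℤ.* (s ℤ.* s)))
  lem = solve-∀
  lem′ : ∀ a b → + 4 ℤ.* a ℤ.+ + 12 ℤ.* b ≡ + 4 ℤ.* (+ 1 ℤ.* a ℤ.+ + 3 ℤ.* b)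
  lem′ = solve-∀

-- Over one (a , b) the two pieces have X + Y√-3 = (a - b√-3)(1 ± √-3). The squares of (1 ± √-3)/2
-- are the nontrivial cube roots of unity, whose sum is -1, so the two values of (X + Y√-3)² add up
-- to -4 (a - b√-3)².
θ-v-odd : θ G-oo (λ a → ℤ.- Re²′ (oo a)) ≈ C (+ 4) ⊗ dil 4 V
θ-v-odd = begin
  θ G-oo (λ a → ℤ.- Re²′ (oo a))
    ≈⟨ θ-pieces (+ 4) (+ 8) G-oo G₁ G₂ (λ (x , y) → l₀ (tri x) (tri y)) (λ (t , s) → l₁ (tri t) (sq s)) (λ (t , s) → l₂ (tri t) (sq s)) (λ a → ℤ.- Re²′ (oo a)) ⟩
  θ G₁ (λ a → ℤ.- Re²′ (oo (piece₁ a)) ℤ.+ ℤ.- Re²′ (oo (piece₂ a))) ⊕ θ G₂ (λ a → ℤ.- Re²′ (oo (piece₃ a)) ℤ.+ ℤ.- Re²′ (oo (piece₄ a)))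
    ≈⟨ ⊕-cong (θ-cong G₁ (λ (t , s) → w₁ t s)) (θ-cong G₂ (λ (t , s) → w₂ t s)) ⟩
  θ G₁ (λ a → + 4 ℤ.* Re²′ (oe a)) ⊕ θ G₂ (λ a → + 4 ℤ.* Re²′ (eo a))
    ≈⟨ ⊕-cong (≈-trans (θ-* G₁ (+ 4) (λ a → Re²′ (oe a))) (⊗-congʳ (C (+ 4)) (θ-dil 3 G-oe G₁ (λ (t , s) → d₁ (tri t) (sq s)) (λ a → Re²′ (oe a)))))
         (≈-trans (θ-* G₂ (+ 4) (λ a → Re²′ (eo a))) (⊗-congʳ (C (+ 4)) (θ-dil 3 G-eo G₂ (λ (t , s) → d₂ (tri t) (sq s)) (λ a → Re²′ (eo a))))) ⟩
  C (+ 4) ⊗ dil 4 V-oe ⊕ C (+ 4) ⊗ dil 4 V-eo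
    ≈⟨ solve 3 (λ c a b → c :* a :+ c :* b := c :* (a :+ b)) ≈-refl (C (+ 4)) (dil 4 V-oe) (dil 4 V-eo) ⟩
  C (+ 4) ⊗ (dil 4 V-oe ⊕ dil 4 V-eo)
    ≈⟨ ⊗-congʳ (C (+ 4)) (≈-sym (dil-⊕ 3 V-oe V-eo)) ⟩
  C (+ 4) ⊗ dil 4 V ∎
  where
  open ≈-Reasoning
  -- The grades of `G-oe` and `G-eo` multiplied by 4.
  G₁ = graded-shift 4 (graded-× (triangle 31) (square 47))
  G₂ = graded-shift 12 (graded-× (triangle 95) (square 15))
  l₀ : ∀ a b → + 4 ℤ.+ (+ 8 ℤ.* a ℤ.+ + 24 ℤ.* b) ≡ + 4 ℤ.+ + 8 ℤ.* (a ℤ.+ + 3 ℤ.* b)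
  l₀ = solve-∀
  l₁ : ∀ a b → + 4 ℤ.+ (+ 32 ℤ.* a ℤ.+ + 48 ℤ.* b) ≡ + 4 ℤ.+ + 8 ℤ.* (+ 4 ℤ.* a ℤ.+ + 6 ℤ.* b)
  l₁ = solve-∀
  l₂ : ∀ a b → + 12 ℤ.+ (+ 96 ℤ.* a ℤ.+ + 16 ℤ.* b) ≡ + 4 ℤ.+ + 8 ℤ.* (+ 1 ℤ.+ (+ 12 ℤ.* a ℤ.+ + 2 ℤ.* b))
  l₂ = solve-∀
  d₁ : ∀ a b → + 4 ℤ.+ (+ 32 ℤ.* a ℤ.+ + 48 ℤ.* b) ≡ + 4 ℤ.* (+ 1 ℤ.+ (+ 8 ℤ.* a ℤ.+ + 12 ℤ.* b))
  d₁ = solve-∀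
  d₂ : ∀ a b → + 12 ℤ.+ (+ 96 ℤ.* a ℤ.+ + 16 ℤ.* b) ≡ + 4 ℤ.* (+ 3 ℤ.+ (+ 24 ℤ.* a ℤ.+ + 4 ℤ.* b))
  d₂ = solve-∀
  w₁ : ∀ t s →
       ℤ.- ((+ 2 ℤ.* (t ℤ.+ + 3 ℤ.* s) ℤ.- + 1) ℤ.* (+ 2 ℤ.* (t ℤ.+ + 3 ℤ.* s) ℤ.- + 1) ℤ.-
            + 3 ℤ.* ((+ 2 ℤ.* (t ℤ.- s) ℤ.- + 1) ℤ.* (+ 2 ℤ.* (t ℤ.- s) ℤ.- + 1))) ℤ.+
       ℤ.- ((+ 2 ℤ.* (t ℤ.+ + 3 ℤ.* (ℤ.- s)) ℤ.- + 1) ℤ.* (+ 2 ℤ.* (t ℤ.+ + 3 ℤ.* (ℤ.- s)) ℤ.- + 1) ℤ.-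
            + 3 ℤ.* ((+ 2 ℤ.* (+ 1 ℤ.- (t ℤ.- (ℤ.- s))) ℤ.- + 1) ℤ.* (+ 2 ℤ.* (+ 1 ℤ.- (t ℤ.- (ℤ.- s))) ℤ.- + 1))) ≡
       + 4 ℤ.* ((+ 2 ℤ.* t ℤ.- + 1) ℤ.* (+ 2 ℤ.* t ℤ.- + 1) ℤ.- + 3 ℤ.* ((+ 2 ℤ.* s) ℤ.* (+ 2 ℤ.* s)))
  w₁ = solve-∀
  w₂ : ∀ t s →
       ℤ.- ((+ 2 ℤ.* (s ℤ.+ + 3 ℤ.* t ℤ.- + 1) ℤ.- + 1) ℤ.* (+ 2 ℤ.* (s ℤ.+ + 3 ℤ.* t ℤ.- + 1) ℤ.- + 1) ℤ.-
            + 3 ℤ.* ((+ 2 ℤ.* (s ℤ.- t ℤ.+ + 1) ℤ.- + 1) ℤ.* (+ 2 ℤ.* (s ℤ.- t ℤ.+ + 1) ℤ.- + 1))) ℤ.+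
       ℤ.- ((+ 2 ℤ.* (s ℤ.+ + 3 ℤ.* (+ 1 ℤ.- t) ℤ.- + 1) ℤ.- + 1) ℤ.* (+ 2 ℤ.* (s ℤ.+ + 3 ℤ.* (+ 1 ℤ.- t) ℤ.- + 1) ℤ.- + 1) ℤ.-
            + 3 ℤ.* ((+ 2 ℤ.* (+ 1 ℤ.- (s ℤ.- (+ 1 ℤ.- t) ℤ.+ + 1)) ℤ.- + 1) ℤ.* (+ 2 ℤ.* (+ 1 ℤ.- (s ℤ.- (+ 1 ℤ.- t) ℤ.+ + 1)) ℤ.- + 1))) ≡
       + 4 ℤ.* ((+ 2 ℤ.* s) ℤ.* (+ 2 ℤ.* s) ℤ.- + 3 ℤ.* ((+ 2 ℤ.* t ℤ.- + 1) ℤ.* (+ 2 ℤ.* t ℤ.- + 1)))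
  w₂ = solve-∀

-- Descent: the coefficient at n > 0 is 0 or 4 times the one at n/4, and f₀ = 4 f₀.
fixed-by-4dil₄ : ∀ f → f ≈ C (+ 4) ⊗ dil 4 f → f ≈ C (+ 0)
fixed-by-4dil₄ f p = pointwise λ n → trans (go (suc n) n ℕₚ.≤-refl) (0≡ n)
  where
  0≡ : ∀ n → + 0 ≡ C (+ 0) n
  0≡ zero    = refl
  0≡ (suc n) = refl
  step : ∀ n → f n ≡ + 4 ℤ.* dil 4 f n
  step n = trans (at p n) (C-⊗-at (+ 4) (dil 4 f) n)
  go : ∀ N n → n ℕ.< N → f n ≡ + 0
  go (suc N) zero q = ℤₚ.*-cancelˡ-≡ (+ 3) (f 0) (+ 0)
    (trans (lem (f 0)) (trans (cong (ℤ._- f 0) (sym (step 0))) (ℤₚ.+-inverseʳ (f 0))))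
    where
    lem : ∀ x → + 3 ℤ.* x ≡ + 4 ℤ.* x ℤ.- x
    lem = solve-∀
  go (suc N) (suc n) q with 4 ∣? suc n
  ... | no 4∤ = trans (step (suc n)) (cong (λ z → + 4 ℤ.* z) (dil-at-∤ 3 f (suc n) 4∤))
  ... | yes (divides (suc i) e) = trans (step (suc n)) (cong (λ z → + 4 ℤ.* z)
        (trans (cong (dil 4 f) e) (trans (dil-at-multiple 3 f (suc i)) (go N (suc i) (smaller e)))))
    where
    smaller : suc n ≡ suc i ℕ.* 4 → suc i ℕ.< N
    smaller e = ℕₚ.<-≤-trans (ℕₚ.≤-trans (ℕₚ.m<m*n (suc i) 4 (ℕ.s≤s (ℕ.s≤s ℕ.z≤n))) (ℕₚ.≤-reflexive (sym e))) (ℕₚ.≤-pred q)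

-- W is the part x ≡ y (mod 2). Its even-even part is a copy of the whole sum in q⁴, and its odd-odd part
-- splits by θ-pieces into copies of the mixed part in q⁴; together they give W(q) = 4 W(q⁴), so W = 0.
W≈0 : W ≈ C (+ 0)
W≈0 = fixed-by-4dil₄ W (begin
  W
    ≈⟨ ⊕-cong θ-v-even θ-v-odd ⟩
  C (+ 4) ⊗ dil 4 Z ⊕ C (+ 4) ⊗ dil 4 V
    ≈⟨ solve 3 (λ c a b → c :* a :+ c :* b := c :* (a :+ b)) ≈-refl (C (+ 4)) (dil 4 Z) (dil 4 V) ⟩
  C (+ 4) ⊗ (dil 4 Z ⊕ dil 4 V)
    ≈⟨ ⊗-congʳ (C (+ 4)) (≈-trans (≈-sym (dil-⊕ 3 Z V)) (dil-cong 4 Z⊕V)) ⟩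
  C (+ 4) ⊗ dil 4 W ∎)
  where
  open ≈-Reasoning
  Z : Series
  Z = θ G-all (λ a → ℤ.- Re²′ a)
  Z⊕V : Z ⊕ V ≈ W
  Z⊕V = ≈-trans (⊕-congˡ V (≈-trans (parity-classes (λ a → ℤ.- Re²′ a))
      (⊕-congʳ W (⊕-cong (θ-neg G-oe (λ a → Re²′ (oe a))) (θ-neg G-eo (λ a → Re²′ (eo a)))))))
    (solve 3 (λ w a b → (w :+ (:- a :+ :- b)) :+ (a :+ b) := w) ≈-refl W V-oe V-eo)

altℤ-sq : ∀ x → altℤ (+ 1 ℤ.* sq x) ≡ altℤ x
altℤ-sq x with parity x
... | inj₁ (k , refl) = trans (cong altℤ (lem k)) (trans (altℤ-even (+ 2 ℤ.* (k ℤ.* k))) (sym (altℤ-even k)))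
  where
  lem : ∀ k → + 1 ℤ.* ((+ 2 ℤ.* k) ℤ.* (+ 2 ℤ.* k)) ≡ + 2 ℤ.* (+ 2 ℤ.* (k ℤ.* k))
  lem = solve-∀
... | inj₂ (k , refl) = trans (cong altℤ (lem k)) (trans (altℤ-odd (+ 2 ℤ.* (k ℤ.* k) ℤ.- + 2 ℤ.* k ℤ.+ + 1)) (sym (altℤ-odd k)))
  where
  lem : ∀ k → + 1 ℤ.* ((+ 2 ℤ.* k ℤ.- + 1) ℤ.* (+ 2 ℤ.* k ℤ.- + 1)) ≡ + 2 ℤ.* (+ 2 ℤ.* (k ℤ.* k) ℤ.- + 2 ℤ.* k ℤ.+ + 1) ℤ.- + 1
  lem = solve-∀

altℤ-3sq : ∀ x → altℤ (+ 3 ℤ.* sq x) ≡ altℤ x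
altℤ-3sq x = trans (cong altℤ (lem (sq x))) (trans (altℤ-same (sq x) (+ 1 ℤ.* sq x)) (altℤ-sq x))
  where
  lem : ∀ z → + 3 ℤ.* z ≡ + 2 ℤ.* z ℤ.+ + 1 ℤ.* z
  lem = solve-∀

φ⁻ : Series
φ⁻ = sgn φ

-- D multiplies each term by its exponent, so the weight of (x , y) is (-1)^(x + y) (3y² - x²). The
-- terms with even x + y form `W`, which vanishes.
wronskian : φ⁻ ⊗ D (dil 3 φ⁻) ⊕ ⊖ (D φ⁻ ⊗ dil 3 φ⁻) ≈ V
wronskian = begin
  φ⁻ ⊗ D (dil 3 φ⁻) ⊕ ⊖ (D φ⁻ ⊗ dil 3 φ⁻)
    ≈⟨ ⊕-cong (⊗-cong p₀ (≈-trans (D-cong p₂) (θ-D (square 2) altℤ)))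
         (⊖-cong (⊗-cong (≈-trans (D-cong p₀) (θ-D (square 0) altℤ)) p₂)) ⟩
  θ (square 0) altℤ ⊗ θ (square 2) c₂ ⊕ ⊖ (θ (square 0) c₀ ⊗ θ (square 2) altℤ)
    ≈⟨ ⊕-cong (≈-sym (θ-× (square 0) (square 2) altℤ c₂)) (≈-trans (⊖-cong (≈-sym (θ-× (square 0) (square 2) c₀ altℤ)))
         (≈-sym (θ-neg G-all (λ (x , y) → c₀ x ℤ.* altℤ y)))) ⟩
  θ G-all (λ (x , y) → altℤ x ℤ.* c₂ y) ⊕ θ G-all (λ (x , y) → ℤ.- (c₀ x ℤ.* altℤ y))
    ≈⟨ ≈-sym (θ-+ G-all (λ (x , y) → altℤ x ℤ.* c₂ y) (λ (x , y) → ℤ.- (c₀ x ℤ.* altℤ y))) ⟩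
  θ G-all (λ (x , y) → altℤ x ℤ.* c₂ y ℤ.+ ℤ.- (c₀ x ℤ.* altℤ y))
    ≈⟨ θ-cong G-all (λ (x , y) → lem (altℤ x) (altℤ y) (sq x) (sq y)) ⟩
  θ G-all w
    ≈⟨ parity-classes w ⟩
  (θ G-ee (λ a → w (ee a)) ⊕ θ G-oo (λ a → w (oo a))) ⊕ (θ G-oe (λ a → w (oe a)) ⊕ θ G-eo (λ a → w (eo a)))
    ≈⟨ ⊕-cong
         (⊕-cong (θ-cong G-ee (λ (t , s) → plus (altℤ-even t) (altℤ-even s) refl)) (θ-cong G-oo (λ (t , s) → plus (altℤ-odd t) (altℤ-odd s) refl)))
         (⊕-cong (θ-cong G-oe (λ (t , s) → minus (altℤ-odd t) (altℤ-even s) refl)) (θ-cong G-eo (λ (t , s) → minus (altℤ-even s) (altℤ-odd t) refl))) ⟩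
  W ⊕ V
    ≈⟨ ⊕-congˡ V W≈0 ⟩
  C (+ 0) ⊕ V
    ≈⟨ solve 1 (λ x → con (+ 0) :+ x := x) ≈-refl V ⟩
  V ∎
  where
  open ≈-Reasoning
  c₀ c₂ : ℤ → ℤ
  c₀ x = + 1 ℤ.* sq x ℤ.* altℤ x
  c₂ y = + 3 ℤ.* sq y ℤ.* altℤ y
  w : ℤ × ℤ → ℤ
  w (x , y) = altℤ x ℤ.* altℤ y ℤ.* (ℤ.- Re² x y)
  p₀ : φ⁻ ≈ θ (square 0) altℤ
  p₀ = ≈-trans (θ-sgn (square 0) 1ᶜ) (θ-cong (square 0) (λ x → trans (ℤₚ.*-identityʳ _) (altℤ-sq x)))
  p₂ : dil 3 φ⁻ ≈ θ (square 2) altℤ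
  p₂ = ≈-trans (≈-sym (sgn-dil-3 φ)) (≈-trans (sgn-cong (≈-sym (θ-square 2 1ᶜ))) (≈-trans (θ-sgn (square 2) 1ᶜ)
    (θ-cong (square 2) (λ x → trans (ℤₚ.*-identityʳ _) (altℤ-3sq x)))))
  lem : ∀ a b x y → a ℤ.* (+ 3 ℤ.* y ℤ.* b) ℤ.+ ℤ.- (+ 1 ℤ.* x ℤ.* a ℤ.* b) ≡ a ℤ.* b ℤ.* (ℤ.- (x ℤ.- + 3 ℤ.* y))
  lem = solve-∀
  plus : ∀ {a b z s} → a ≡ s → b ≡ s → s ℤ.* s ≡ + 1 → a ℤ.* b ℤ.* z ≡ z
  plus {z = z} refl refl e = trans (cong (ℤ._* z) e) (ℤₚ.*-identityˡ z)
  minus : ∀ {a b z s t} → a ≡ s → b ≡ t → s ℤ.* t ≡ ℤ.- + 1 → a ℤ.* b ℤ.* (ℤ.- z) ≡ z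
  minus {z = z} refl refl e = trans (cong (ℤ._* (ℤ.- z)) e) (trans (ℤₚ.-1*i≡-i (ℤ.- z)) (ℤₚ.neg-involutive z))

-- The weight is (-1)^(x + y) XY. Over one (a , b) it is (a + 3b)(a - b) on one piece and (a - 3b)(a
-- + b) on the other, with the sum 2 (a² - 3b²).
𝒥-product : xp 1 ⊗ (dil 2 𝒥 ⊗ dil 6 𝒥) ≈ C (+ 2) ⊗ V
𝒥-product = begin
  xp 1 ⊗ (dil 2 𝒥 ⊗ dil 6 𝒥)
    ≈⟨ ⊗-congʳ (xp 1) (⊗-cong (≈-sym (θ-triangle 1 altOdd)) (≈-sym (θ-triangle 5 altOdd))) ⟩
  xp 1 ⊗ (θ (triangle 1) altOdd ⊗ θ (triangle 5) altOdd)
    ≈⟨ ⊗-congʳ (xp 1) (≈-sym (θ-× (triangle 1) (triangle 5) altOdd altOdd)) ⟩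
  xp 1 ⊗ θ (graded-× (triangle 1) (triangle 5)) (λ (x , y) → altOdd x ℤ.* altOdd y)
    ≈⟨ ≈-sym (θ-shift 1 (graded-× (triangle 1) (triangle 5)) G (λ _ → refl) jj) ⟩
  θ G jj
    ≈⟨ θ-pieces (+ 1) (+ 2) G G-oe G-eo (λ (x , y) → l₀ (tri x) (tri y)) (λ (t , s) → l₁ (tri t) (sq s)) (λ (t , s) → l₂ (tri t) (sq s)) jj ⟩
  θ G-oe (λ a → jj (piece₁ a) ℤ.+ jj (piece₂ a)) ⊕ θ G-eo (λ a → jj (piece₃ a) ℤ.+ jj (piece₄ a))
    ≈⟨ ⊕-cong (θ-cong G-oe (λ (t , s) → trans (cong₂ ℤ._+_ (near-sign (inj₁ (t , s))) (far-sign (inj₁ (t , s)))) (w₁ t s)))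
         (θ-cong G-eo (λ (t , s) → trans (cong₂ ℤ._+_ (near-sign (inj₂ (t , s))) (far-sign (inj₂ (t , s)))) (w₂ t s))) ⟩
  θ G-oe (λ a → + 2 ℤ.* Re²′ (oe a)) ⊕ θ G-eo (λ a → + 2 ℤ.* Re²′ (eo a))
    ≈⟨ ⊕-cong (θ-* G-oe (+ 2) (λ a → Re²′ (oe a))) (θ-* G-eo (+ 2) (λ a → Re²′ (eo a))) ⟩
  C (+ 2) ⊗ V-oe ⊕ C (+ 2) ⊗ V-eo
    ≈⟨ solve 3 (λ c a b → c :* a :+ c :* b := c :* (a :+ b)) ≈-refl (C (+ 2)) V-oe V-eo ⟩
  C (+ 2) ⊗ V ∎
  where
  open ≈-Reasoning
  G = graded-shift 1 (graded-× (triangle 1) (triangle 5))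
  jj : ℤ × ℤ → ℤ
  jj (x , y) = altOdd x ℤ.* altOdd y
  l₀ : ∀ a b → + 1 ℤ.+ (+ 2 ℤ.* a ℤ.+ + 6 ℤ.* b) ≡ + 1 ℤ.+ + 2 ℤ.* (a ℤ.+ + 3 ℤ.* b)
  l₀ = solve-∀
  l₁ : ∀ a b → + 1 ℤ.+ (+ 8 ℤ.* a ℤ.+ + 12 ℤ.* b) ≡ + 1 ℤ.+ + 2 ℤ.* (+ 4 ℤ.* a ℤ.+ + 6 ℤ.* b)
  l₁ = solve-∀
  l₂ : ∀ a b → + 3 ℤ.+ (+ 24 ℤ.* a ℤ.+ + 4 ℤ.* b) ≡ + 1 ℤ.+ + 2 ℤ.* (+ 1 ℤ.+ (+ 12 ℤ.* a ℤ.+ + 2 ℤ.* b))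
  l₂ = solve-∀
  near-sign : ∀ b → jj (near b) ≡ odd (proj₁ (near b)) ℤ.* odd (proj₂ (near b))
  near-sign b with near b | near-even b
  ... | .(+ 2 ℤ.* k ℤ.+ y) , y | k , refl = trans (cong (λ z → z ℤ.* odd (+ 2 ℤ.* k ℤ.+ y) ℤ.* altOdd y) (altℤ-same k y))
        (trans (lem (altℤ y) (odd (+ 2 ℤ.* k ℤ.+ y)) (odd y)) (trans (cong (ℤ._* (odd (+ 2 ℤ.* k ℤ.+ y) ℤ.* odd y)) (altℤ² y)) (ℤₚ.*-identityˡ _)))
    where
    lem : ∀ a x y → a ℤ.* x ℤ.* (a ℤ.* y) ≡ (a ℤ.* a) ℤ.* (x ℤ.* y)
    lem = solve-∀
  far-sign : ∀ b → jj (far b) ≡ ℤ.- (odd (proj₁ (far b)) ℤ.* odd (proj₂ (far b)))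
  far-sign b with far b | far-odd b
  ... | .(+ 2 ℤ.* k ℤ.- + 1 ℤ.+ y) , y | k , refl = trans (cong (λ z → z ℤ.* x ℤ.* altOdd y) sign)
        (trans (lem (altℤ y) x (odd y)) (trans (cong (λ z → ℤ.- (z ℤ.* (x ℤ.* odd y))) (altℤ² y)) (cong ℤ.-_ (ℤₚ.*-identityˡ (x ℤ.* odd y)))))
    where
    x : ℤ
    x = odd (+ 2 ℤ.* k ℤ.- + 1 ℤ.+ y)
    assoc : ∀ k y → + 2 ℤ.* k ℤ.- + 1 ℤ.+ y ≡ + 2 ℤ.* k ℤ.+ y ℤ.- + 1
    assoc = solve-∀
    sign : altℤ (+ 2 ℤ.* k ℤ.- + 1 ℤ.+ y) ≡ ℤ.- altℤ y
    sign = trans (cong altℤ (assoc k y)) (trans (altℤ-pred (+ 2 ℤ.* k ℤ.+ y)) (cong ℤ.-_ (altℤ-same k y)))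
    lem : ∀ a x y → (ℤ.- a) ℤ.* x ℤ.* (a ℤ.* y) ≡ ℤ.- ((a ℤ.* a) ℤ.* (x ℤ.* y))
    lem = solve-∀
  w₁ : ∀ t s →
       (+ 2 ℤ.* (t ℤ.+ + 3 ℤ.* s) ℤ.- + 1) ℤ.* (+ 2 ℤ.* (t ℤ.- s) ℤ.- + 1) ℤ.+
       ℤ.- ((+ 2 ℤ.* (t ℤ.+ + 3 ℤ.* (ℤ.- s)) ℤ.- + 1) ℤ.* (+ 2 ℤ.* (+ 1 ℤ.- (t ℤ.- (ℤ.- s))) ℤ.- + 1)) ≡
       + 2 ℤ.* ((+ 2 ℤ.* t ℤ.- + 1) ℤ.* (+ 2 ℤ.* t ℤ.- + 1) ℤ.- + 3 ℤ.* ((+ 2 ℤ.* s) ℤ.* (+ 2 ℤ.* s)))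
  w₁ = solve-∀
  w₂ : ∀ t s →
       (+ 2 ℤ.* (s ℤ.+ + 3 ℤ.* t ℤ.- + 1) ℤ.- + 1) ℤ.* (+ 2 ℤ.* (s ℤ.- t ℤ.+ + 1) ℤ.- + 1) ℤ.+
       ℤ.- ((+ 2 ℤ.* (s ℤ.+ + 3 ℤ.* (+ 1 ℤ.- t) ℤ.- + 1) ℤ.- + 1) ℤ.* (+ 2 ℤ.* (+ 1 ℤ.- (s ℤ.- (+ 1 ℤ.- t) ℤ.+ + 1)) ℤ.- + 1)) ≡
       + 2 ℤ.* ((+ 2 ℤ.* s) ℤ.* (+ 2 ℤ.* s) ℤ.- + 3 ℤ.* ((+ 2 ℤ.* t ℤ.- + 1) ℤ.* (+ 2 ℤ.* t ℤ.- + 1)))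
  w₂ = solve-∀

wronskian-𝒥 : C (+ 2) ⊗ (φ⁻ ⊗ D (dil 3 φ⁻) ⊕ ⊖ (D φ⁻ ⊗ dil 3 φ⁻)) ≈ xp 1 ⊗ (dil 2 𝒥 ⊗ dil 6 𝒥)
wronskian-𝒥 = ≈-trans (⊗-congʳ (C (+ 2)) wronskian) (≈-sym 𝒥-product)

-- Identities between φ, Ψ and E

infixl 6 _⟨⊕⟩_
infixl 7 _⟨⊗⟩_

-- Expressions on which q ↦ q^(k + 1) acts by multiplying the dilation factors; ⟨dil⟩ j f is f(q^(j + 1)).
data Expr : Set where
  ⟨_⟩      : Series → Expr
  ⟨dil⟩    : ℕ → Series → Expr
  ⟨xp⟩     : ℕ → Expr
  ⟨C⟩      : ℤ → Expr
  _⟨⊕⟩_ _⟨⊗⟩_ : Expr → Expr → Expr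

⟦_⟧ᵉ : Expr → Series
⟦ ⟨ f ⟩ ⟧ᵉ     = f
⟦ ⟨dil⟩ j f ⟧ᵉ = dil (suc j) f
⟦ ⟨xp⟩ m ⟧ᵉ    = xp m
⟦ ⟨C⟩ c ⟧ᵉ     = C c
⟦ s ⟨⊕⟩ t ⟧ᵉ   = ⟦ s ⟧ᵉ ⊕ ⟦ t ⟧ᵉ
⟦ s ⟨⊗⟩ t ⟧ᵉ   = ⟦ s ⟧ᵉ ⊗ ⟦ t ⟧ᵉ

dilate : ℕ → Expr → Expr
dilate k ⟨ f ⟩       = ⟨dil⟩ k f
dilate k (⟨dil⟩ j f) = ⟨dil⟩ (k ℕ.+ j ℕ.* suc k) f
dilate k (⟨xp⟩ m)    = ⟨xp⟩ (m ℕ.* suc k)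
dilate k (⟨C⟩ c)     = ⟨C⟩ c
dilate k (s ⟨⊕⟩ t)   = dilate k s ⟨⊕⟩ dilate k t
dilate k (s ⟨⊗⟩ t)   = dilate k s ⟨⊗⟩ dilate k t

dil-expr : ∀ k s → dil (suc k) ⟦ s ⟧ᵉ ≈ ⟦ dilate k s ⟧ᵉ
dil-expr k ⟨ f ⟩       = ≈-refl
dil-expr k (⟨dil⟩ j f) = dil-dil k j f
dil-expr k (⟨xp⟩ m)    = dil-xp k m
dil-expr k (⟨C⟩ c)     = dil-C k c
dil-expr k (s ⟨⊕⟩ t)   = ≈-trans (dil-⊕ k ⟦ s ⟧ᵉ ⟦ t ⟧ᵉ) (⊕-cong (dil-expr k s) (dil-expr k t))
dil-expr k (s ⟨⊗⟩ t)   = ≈-trans (dil-⊗ k ⟦ s ⟧ᵉ ⟦ t ⟧ᵉ) (⊗-cong (dil-expr k s) (dil-expr k t))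

dilate-≈ : ∀ k s t → ⟦ s ⟧ᵉ ≈ ⟦ t ⟧ᵉ → ⟦ dilate k s ⟧ᵉ ≈ ⟦ dilate k t ⟧ᵉ
dilate-≈ k s t p = ≈-trans (≈-sym (dil-expr k s)) (≈-trans (dil-cong (suc k) p) (dil-expr k t))

dil-injective : ∀ k {f g} → dil (suc k) f ≈ dil (suc k) g → f ≈ g
dil-injective k {f} {g} p = pointwise λ n → trans (sym (dil-at-multiple k f n)) (trans (at p (n ℕ.* suc k)) (dil-at-multiple k g n))

sgn-dil-even : ∀ i f → sgn (dil (suc i ℕ.* 2) f) ≈ dil (suc i ℕ.* 2) f
sgn-dil-even i f = ≈-trans (sgn-cong (≈-sym (dil-dil 1 i f))) (≈-trans (sgn-dil-2 (dil (suc i) f)) (dil-dil 1 i f))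

sgn-xp₁ : sgn (xp 1) ≈ ⊖ xp 1
sgn-xp₁ = pointwise λ { zero → refl ; (suc zero) → refl ; (suc (suc n)) → cong ℤ.-_ (at (sgn-C (+ 1)) (suc n)) }

sgn-xp₁-⊗ : ∀ f → sgn (xp 1 ⊗ f) ≈ ⊖ (xp 1 ⊗ sgn f)
sgn-xp₁-⊗ f = ≈-trans (sgn-⊗ (xp 1) f) (≈-trans (⊗-congˡ (sgn f) sgn-xp₁)
  (solve 2 (λ x f → (:- x) :* f := :- (x :* f)) ≈-refl (xp 1) (sgn f)))

φ⁻²-split : φ⁻ ⊗ φ⁻ ≈ dil 2 φ ⊗ dil 2 φ ⊕ ⊖ (xp 1 ⊗ (dil 4 Ψ ⊗ dil 4 Ψ))
φ⁻²-split = ≈-trans (≈-sym (sgn-⊗ φ φ)) (≈-trans (sgn-cong φ²-split) (≈-trans (sgn-⊕ (dil 2 φ ⊗ dil 2 φ) (xp 1 ⊗ (dil 4 Ψ ⊗ dil 4 Ψ)))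
  (⊕-cong (≈-trans (sgn-⊗ (dil 2 φ) (dil 2 φ)) (⊗-cong (sgn-dil-2 φ) (sgn-dil-2 φ)))
    (≈-trans (sgn-xp₁-⊗ (dil 4 Ψ ⊗ dil 4 Ψ)) (⊖-cong (⊗-congʳ (xp 1)
      (≈-trans (sgn-⊗ (dil 4 Ψ) (dil 4 Ψ)) (⊗-cong (sgn-dil-even 1 Ψ) (sgn-dil-even 1 Ψ)))))))))

φ⁻-split : φ⁻ ≈ dil 4 φ ⊕ ⊖ (xp 1 ⊗ dil 8 Ψ)
φ⁻-split = ≈-trans (sgn-cong φ-split) (≈-trans (sgn-⊕ (dil 4 φ) (xp 1 ⊗ dil 8 Ψ))
  (⊕-cong (sgn-dil-even 1 φ) (≈-trans (sgn-xp₁-⊗ (dil 8 Ψ)) (⊖-cong (⊗-congʳ (xp 1) (sgn-dil-even 3 Ψ))))))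

C≢0-cancel : ∀ {k f g} → k ≢ + 0 → C k ⊗ f ≈ C k ⊗ g → f ≈ g
C≢0-cancel {k} p = ⊗-cancelˡ (C k) p

-- The odd part of φ² is 2q φ₄ Ψ₈ by `φ-split` and q Ψ₄² by `φ²-split`; then q⁴ is replaced by q.
2φΨ₂≈Ψ² : C (+ 2) ⊗ (φ ⊗ dil 2 Ψ) ≈ Ψ ⊗ Ψ
2φΨ₂≈Ψ² = dil-injective 3 (≈-trans (dil-expr 3 (⟨C⟩ (+ 2) ⟨⊗⟩ (⟨ φ ⟩ ⟨⊗⟩ ⟨dil⟩ 1 Ψ)))
  (≈-trans (xp-cancel 1 (C≢0-cancel {+ 2} (λ ()) doubled)) (≈-sym (dil-⊗ 3 Ψ Ψ))))
  where
  open ≈-Reasoning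
  doubled : C (+ 2) ⊗ (xp 1 ⊗ (C (+ 2) ⊗ (dil 4 φ ⊗ dil 8 Ψ))) ≈ C (+ 2) ⊗ (xp 1 ⊗ (dil 4 Ψ ⊗ dil 4 Ψ))
  doubled = begin
    C (+ 2) ⊗ (xp 1 ⊗ (C (+ 2) ⊗ (dil 4 φ ⊗ dil 8 Ψ)))
      ≈⟨ solve 3 (λ x f p → con (+ 2) :* (x :* (con (+ 2) :* (f :* p))) :=
           (f :+ x :* p) :* (f :+ x :* p) :+ :- ((f :+ :- (x :* p)) :* (f :+ :- (x :* p)))) ≈-refl (xp 1) (dil 4 φ) (dil 8 Ψ) ⟩
    (dil 4 φ ⊕ xp 1 ⊗ dil 8 Ψ) ⊗ (dil 4 φ ⊕ xp 1 ⊗ dil 8 Ψ) ⊕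
      ⊖ ((dil 4 φ ⊕ ⊖ (xp 1 ⊗ dil 8 Ψ)) ⊗ (dil 4 φ ⊕ ⊖ (xp 1 ⊗ dil 8 Ψ)))
      ≈⟨ ⊕-cong (⊗-cong (≈-sym φ-split) (≈-sym φ-split)) (⊖-cong (⊗-cong (≈-sym φ⁻-split) (≈-sym φ⁻-split))) ⟩
    φ ⊗ φ ⊕ ⊖ (φ⁻ ⊗ φ⁻)
      ≈⟨ ⊕-cong φ²-split (⊖-cong φ⁻²-split) ⟩
    (dil 2 φ ⊗ dil 2 φ ⊕ xp 1 ⊗ (dil 4 Ψ ⊗ dil 4 Ψ)) ⊕ ⊖ (dil 2 φ ⊗ dil 2 φ ⊕ ⊖ (xp 1 ⊗ (dil 4 Ψ ⊗ dil 4 Ψ)))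
      ≈⟨ solve 2 (λ a b → (a :+ b) :+ :- (a :+ :- b) := con (+ 2) :* b) ≈-refl (dil 2 φ ⊗ dil 2 φ) (xp 1 ⊗ (dil 4 Ψ ⊗ dil 4 Ψ)) ⟩
    C (+ 2) ⊗ (xp 1 ⊗ (dil 4 Ψ ⊗ dil 4 Ψ)) ∎

⟨⊖⟩_ : Expr → Expr
⟨⊖⟩ s = ⟨C⟩ (ℤ.- + 1) ⟨⊗⟩ s

-1⊗ : ∀ f → C (ℤ.- + 1) ⊗ f ≈ ⊖ f
-1⊗ = solve 1 (λ f → con (ℤ.- + 1) :* f := :- f) ≈-refl

-- Both sides are φ₄² - q² Ψ₈², the right one by `φ⁻²-split` at q².
φφ⁻≈φ⁻₂² : φ ⊗ φ⁻ ≈ dil 2 φ⁻ ⊗ dil 2 φ⁻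
φφ⁻≈φ⁻₂² = begin
  φ ⊗ φ⁻
    ≈⟨ ⊗-cong φ-split φ⁻-split ⟩
  (dil 4 φ ⊕ xp 1 ⊗ dil 8 Ψ) ⊗ (dil 4 φ ⊕ ⊖ (xp 1 ⊗ dil 8 Ψ))
    ≈⟨ solve 3 (λ x f p → (f :+ x :* p) :* (f :+ :- (x :* p)) := f :* f :+ con (ℤ.- + 1) :* ((x :* x) :* (p :* p))) ≈-refl (xp 1) (dil 4 φ) (dil 8 Ψ) ⟩
  dil 4 φ ⊗ dil 4 φ ⊕ C (ℤ.- + 1) ⊗ ((xp 1 ⊗ xp 1) ⊗ (dil 8 Ψ ⊗ dil 8 Ψ))
    ≈⟨ ⊕-congʳ (dil 4 φ ⊗ dil 4 φ) (⊗-congʳ (C (ℤ.- + 1)) (⊗-congˡ (dil 8 Ψ ⊗ dil 8 Ψ) (≈-sym (xp-+ 1 1)))) ⟩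
  dil 4 φ ⊗ dil 4 φ ⊕ C (ℤ.- + 1) ⊗ (xp 2 ⊗ (dil 8 Ψ ⊗ dil 8 Ψ))
    ≈⟨ ≈-sym (dilate-≈ 1 (⟨ φ⁻ ⟩ ⟨⊗⟩ ⟨ φ⁻ ⟩) (⟨dil⟩ 1 φ ⟨⊗⟩ ⟨dil⟩ 1 φ ⟨⊕⟩ ⟨⊖⟩ (⟨xp⟩ 1 ⟨⊗⟩ (⟨dil⟩ 3 Ψ ⟨⊗⟩ ⟨dil⟩ 3 Ψ)))
         (≈-trans φ⁻²-split (⊕-congʳ (dil 2 φ ⊗ dil 2 φ) (≈-sym (-1⊗ (xp 1 ⊗ (dil 4 Ψ ⊗ dil 4 Ψ))))))) ⟩
  dil 2 φ⁻ ⊗ dil 2 φ⁻ ∎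
  where open ≈-Reasoning

Ψ₂E₂≈2E₄² : dil 2 Ψ ⊗ dil 2 E ≈ C (+ 2) ⊗ (dil 4 E ⊗ dil 4 E)
Ψ₂E₂≈2E₄² = dilate-≈ 1 (⟨ Ψ ⟩ ⟨⊗⟩ ⟨ E ⟩) (⟨C⟩ (+ 2) ⟨⊗⟩ (⟨dil⟩ 1 E ⟨⊗⟩ ⟨dil⟩ 1 E)) ΨE≈2E₂²

E₂⁵ : Series
E₂⁵ = dil 2 E ⊗ dil 2 E ⊗ dil 2 E ⊗ dil 2 E ⊗ dil 2 E

-- The product formula of φ, from φ = Ψ² / (2 Ψ₂) and the product formula of Ψ.
φE²E₄²≈E₂⁵ : φ ⊗ (E ⊗ E) ⊗ (dil 4 E ⊗ dil 4 E) ≈ E₂⁵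
φE²E₄²≈E₂⁵ = C≢0-cancel {+ 4} (λ ()) (begin
  C (+ 4) ⊗ (φ ⊗ (E ⊗ E) ⊗ (dil 4 E ⊗ dil 4 E))
    ≈⟨ solve 3 (λ f e g → con (+ 4) :* (f :* (e :* e) :* (g :* g)) := con (+ 2) :* f :* (e :* e) :* (con (+ 2) :* (g :* g))) ≈-refl φ E (dil 4 E) ⟩
  C (+ 2) ⊗ φ ⊗ (E ⊗ E) ⊗ (C (+ 2) ⊗ (dil 4 E ⊗ dil 4 E))
    ≈⟨ ⊗-congʳ (C (+ 2) ⊗ φ ⊗ (E ⊗ E)) (≈-sym Ψ₂E₂≈2E₄²) ⟩
  C (+ 2) ⊗ φ ⊗ (E ⊗ E) ⊗ (dil 2 Ψ ⊗ dil 2 E)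
    ≈⟨ solve 4 (λ f e p d → con (+ 2) :* f :* (e :* e) :* (p :* d) := con (+ 2) :* (f :* p) :* (e :* e) :* d) ≈-refl φ E (dil 2 Ψ) (dil 2 E) ⟩
  C (+ 2) ⊗ (φ ⊗ dil 2 Ψ) ⊗ (E ⊗ E) ⊗ dil 2 E
    ≈⟨ ⊗-congˡ (dil 2 E) (⊗-congˡ (E ⊗ E) 2φΨ₂≈Ψ²) ⟩
  Ψ ⊗ Ψ ⊗ (E ⊗ E) ⊗ dil 2 E
    ≈⟨ solve 3 (λ p e d → p :* p :* (e :* e) :* d := (p :* e) :* (p :* e) :* d) ≈-refl Ψ E (dil 2 E) ⟩
  (Ψ ⊗ E) ⊗ (Ψ ⊗ E) ⊗ dil 2 E
    ≈⟨ ⊗-congˡ (dil 2 E) (⊗-cong ΨE≈2E₂² ΨE≈2E₂²) ⟩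
  (C (+ 2) ⊗ (dil 2 E ⊗ dil 2 E)) ⊗ (C (+ 2) ⊗ (dil 2 E ⊗ dil 2 E)) ⊗ dil 2 E
    ≈⟨ solve 1 (λ d → (con (+ 2) :* (d :* d)) :* (con (+ 2) :* (d :* d)) :* d := con (+ 4) :* (d :* d :* d :* d :* d)) ≈-refl (dil 2 E) ⟩
  C (+ 4) ⊗ E₂⁵ ∎)
  where open ≈-Reasoning

E⁻ : Series
E⁻ = sgn E

sgn-⊗-cong : ∀ f g {f′ g′} → sgn f ≈ f′ → sgn g ≈ g′ → sgn (f ⊗ g) ≈ f′ ⊗ g′
sgn-⊗-cong f g p q = ≈-trans (sgn-⊗ f g) (⊗-cong p q)

E₂⁵≢0 : E₂⁵ 0 ≢ + 0
E₂⁵≢0 ()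

-- Gauss's product for φ(-q): `φE²E₄²≈E₂⁵` at -q, with E(-q) eliminated by `E-sgn`.
φ⁻E₂≈E² : φ⁻ ⊗ dil 2 E ≈ E ⊗ E
φ⁻E₂≈E² = ⊗-cancelˡ E₂⁵ E₂⁵≢0 (begin
  E₂⁵ ⊗ (φ⁻ ⊗ dil 2 E)
    ≈⟨ solve 2 (λ f d → d :* d :* d :* d :* d :* (f :* d) := f :* ((d :* d :* d) :* (d :* d :* d))) ≈-refl φ⁻ (dil 2 E) ⟩
  φ⁻ ⊗ ((dil 2 E ⊗ dil 2 E ⊗ dil 2 E) ⊗ (dil 2 E ⊗ dil 2 E ⊗ dil 2 E))
    ≈⟨ ⊗-congʳ φ⁻ (⊗-cong (≈-sym E-sgn) (≈-sym E-sgn)) ⟩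
  φ⁻ ⊗ ((E⁻ ⊗ E ⊗ dil 4 E) ⊗ (E⁻ ⊗ E ⊗ dil 4 E))
    ≈⟨ solve 4 (λ f m e g → f :* ((m :* e :* g) :* (m :* e :* g)) := f :* (m :* m) :* (g :* g) :* (e :* e)) ≈-refl φ⁻ E⁻ E (dil 4 E) ⟩
  φ⁻ ⊗ (E⁻ ⊗ E⁻) ⊗ (dil 4 E ⊗ dil 4 E) ⊗ (E ⊗ E)
    ≈⟨ ⊗-congˡ (E ⊗ E) signed ⟩
  E₂⁵ ⊗ (E ⊗ E) ∎)
  where
  open ≈-Reasoning
  d : Series
  d = dil 2 E
  signed : φ⁻ ⊗ (E⁻ ⊗ E⁻) ⊗ (dil 4 E ⊗ dil 4 E) ≈ E₂⁵
  signed = begin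
    φ⁻ ⊗ (E⁻ ⊗ E⁻) ⊗ (dil 4 E ⊗ dil 4 E)
      ≈⟨ ≈-sym (sgn-⊗-cong (φ ⊗ (E ⊗ E)) (dil 4 E ⊗ dil 4 E) (sgn-⊗-cong φ (E ⊗ E) ≈-refl (sgn-⊗ E E))
           (sgn-⊗-cong (dil 4 E) (dil 4 E) (sgn-dil-even 1 E) (sgn-dil-even 1 E))) ⟩
    sgn (φ ⊗ (E ⊗ E) ⊗ (dil 4 E ⊗ dil 4 E))
      ≈⟨ sgn-cong φE²E₄²≈E₂⁵ ⟩
    sgn E₂⁵
      ≈⟨ sgn-⊗-cong (d ⊗ d ⊗ d ⊗ d) d (sgn-⊗-cong (d ⊗ d ⊗ d) d (sgn-⊗-cong (d ⊗ d) d (sgn-⊗-cong d d s s) s) s) s ⟩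
    E₂⁵ ∎
    where
    s : sgn d ≈ d
    s = sgn-dil-2 E

Ψ⁻ : Series
Ψ⁻ = sgn Ψ

φ⁻₂E₄≈E₂² : dil 2 φ⁻ ⊗ dil 4 E ≈ dil 2 E ⊗ dil 2 E
φ⁻₂E₄≈E₂² = dilate-≈ 1 (⟨ φ⁻ ⟩ ⟨⊗⟩ ⟨dil⟩ 1 E) (⟨ E ⟩ ⟨⊗⟩ ⟨ E ⟩) φ⁻E₂≈E²

Ψ⁻E₂≈2EE₄ : Ψ⁻ ⊗ dil 2 E ≈ C (+ 2) ⊗ (E ⊗ dil 4 E)
Ψ⁻E₂≈2EE₄ = ⊗-cancelˡ (d ⊗ d) (λ ()) (begin
  d ⊗ d ⊗ (Ψ⁻ ⊗ d)
    ≈⟨ solve 2 (λ p d → d :* d :* (p :* d) := p :* (d :* d :* d)) ≈-refl Ψ⁻ d ⟩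
  Ψ⁻ ⊗ (d ⊗ d ⊗ d)
    ≈⟨ ⊗-congʳ Ψ⁻ (≈-sym E-sgn) ⟩
  Ψ⁻ ⊗ (E⁻ ⊗ E ⊗ dil 4 E)
    ≈⟨ solve 4 (λ p m e g → p :* (m :* e :* g) := (p :* m) :* (e :* g)) ≈-refl Ψ⁻ E⁻ E (dil 4 E) ⟩
  (Ψ⁻ ⊗ E⁻) ⊗ (E ⊗ dil 4 E)
    ≈⟨ ⊗-congˡ (E ⊗ dil 4 E) (≈-trans (≈-sym (sgn-⊗ Ψ E)) (≈-trans (sgn-cong ΨE≈2E₂²)
         (sgn-⊗-cong (C (+ 2)) (d ⊗ d) (sgn-C (+ 2)) (sgn-⊗-cong d d (sgn-dil-2 E) (sgn-dil-2 E))))) ⟩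
  (C (+ 2) ⊗ (d ⊗ d)) ⊗ (E ⊗ dil 4 E)
    ≈⟨ solve 3 (λ d e g → (con (+ 2) :* (d :* d)) :* (e :* g) := d :* d :* (con (+ 2) :* (e :* g))) ≈-refl d E (dil 4 E) ⟩
  d ⊗ d ⊗ (C (+ 2) ⊗ (E ⊗ dil 4 E)) ∎)
  where
  open ≈-Reasoning
  d : Series
  d = dil 2 E

Ψ⁻φ⁻₂≈2EE₂ : Ψ⁻ ⊗ dil 2 φ⁻ ≈ C (+ 2) ⊗ (E ⊗ dil 2 E)
Ψ⁻φ⁻₂≈2EE₂ = ⊗-cancelˡ (dil 2 E ⊗ dil 4 E) (λ ()) (begin
  dil 2 E ⊗ dil 4 E ⊗ (Ψ⁻ ⊗ dil 2 φ⁻)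
    ≈⟨ solve 4 (λ d g p f → d :* g :* (p :* f) := (p :* d) :* (f :* g)) ≈-refl (dil 2 E) (dil 4 E) Ψ⁻ (dil 2 φ⁻) ⟩
  (Ψ⁻ ⊗ dil 2 E) ⊗ (dil 2 φ⁻ ⊗ dil 4 E)
    ≈⟨ ⊗-cong Ψ⁻E₂≈2EE₄ φ⁻₂E₄≈E₂² ⟩
  (C (+ 2) ⊗ (E ⊗ dil 4 E)) ⊗ (dil 2 E ⊗ dil 2 E)
    ≈⟨ solve 3 (λ e g d → (con (+ 2) :* (e :* g)) :* (d :* d) := d :* g :* (con (+ 2) :* (e :* d))) ≈-refl E (dil 4 E) (dil 2 E) ⟩
  dil 2 E ⊗ dil 4 E ⊗ (C (+ 2) ⊗ (E ⊗ dil 2 E)) ∎)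
  where open ≈-Reasoning

-- Replacing Ψ² by 2 φ Ψ₂ creates φ φ⁻ = φ⁻₂², and all remaining factors are series in q² with known
-- products.
φ⁻Ψ²≈4E₂³ : φ⁻ ⊗ (Ψ ⊗ Ψ) ≈ C (+ 4) ⊗ (dil 2 E ⊗ dil 2 E ⊗ dil 2 E)
φ⁻Ψ²≈4E₂³ = ⊗-cancelˡ (dil 4 E ⊗ dil 4 E ⊗ dil 2 E) (λ ()) (begin
  dil 4 E ⊗ dil 4 E ⊗ dil 2 E ⊗ (φ⁻ ⊗ (Ψ ⊗ Ψ))
    ≈⟨ ⊗-congʳ (dil 4 E ⊗ dil 4 E ⊗ dil 2 E) (⊗-congʳ φ⁻ (≈-sym 2φΨ₂≈Ψ²)) ⟩
  dil 4 E ⊗ dil 4 E ⊗ dil 2 E ⊗ (φ⁻ ⊗ (C (+ 2) ⊗ (φ ⊗ dil 2 Ψ)))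
    ≈⟨ solve 5 (λ g d m f p → g :* g :* d :* (m :* (con (+ 2) :* (f :* p))) := con (+ 2) :* ((f :* m) :* (g :* g)) :* (p :* d)) ≈-refl
         (dil 4 E) (dil 2 E) φ⁻ φ (dil 2 Ψ) ⟩
  C (+ 2) ⊗ ((φ ⊗ φ⁻) ⊗ (dil 4 E ⊗ dil 4 E)) ⊗ (dil 2 Ψ ⊗ dil 2 E)
    ≈⟨ ⊗-cong (⊗-congʳ (C (+ 2)) (⊗-congˡ (dil 4 E ⊗ dil 4 E) φφ⁻≈φ⁻₂²)) Ψ₂E₂≈2E₄² ⟩
  C (+ 2) ⊗ ((dil 2 φ⁻ ⊗ dil 2 φ⁻) ⊗ (dil 4 E ⊗ dil 4 E)) ⊗ (C (+ 2) ⊗ (dil 4 E ⊗ dil 4 E))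
    ≈⟨ solve 2 (λ f g → con (+ 2) :* ((f :* f) :* (g :* g)) :* (con (+ 2) :* (g :* g)) := con (+ 4) :* ((f :* g) :* (f :* g)) :* (g :* g)) ≈-refl (dil 2 φ⁻) (dil 4 E) ⟩
  C (+ 4) ⊗ ((dil 2 φ⁻ ⊗ dil 4 E) ⊗ (dil 2 φ⁻ ⊗ dil 4 E)) ⊗ (dil 4 E ⊗ dil 4 E)
    ≈⟨ ⊗-congˡ (dil 4 E ⊗ dil 4 E) (⊗-congʳ (C (+ 4)) (⊗-cong φ⁻₂E₄≈E₂² φ⁻₂E₄≈E₂²)) ⟩
  C (+ 4) ⊗ ((dil 2 E ⊗ dil 2 E) ⊗ (dil 2 E ⊗ dil 2 E)) ⊗ (dil 4 E ⊗ dil 4 E)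
    ≈⟨ solve 2 (λ d g → con (+ 4) :* ((d :* d) :* (d :* d)) :* (g :* g) := g :* g :* d :* (con (+ 4) :* (d :* d :* d))) ≈-refl (dil 2 E) (dil 4 E) ⟩
  dil 4 E ⊗ dil 4 E ⊗ dil 2 E ⊗ (C (+ 4) ⊗ (dil 2 E ⊗ dil 2 E ⊗ dil 2 E)) ∎)
  where open ≈-Reasoning

-- Logarithmic derivatives and the Lambert series

D-dil-E : D (dil 2 E) ≈ ⊖ (C (+ 2) ⊗ (dil 2 E ⊗ dil 2 S))
D-dil-E = ≈-trans (D-dil 1 E) (≈-trans (⊗-congʳ (C (+ 2)) (≈-trans (dil-cong 2 D-E) (≈-trans (dil-⊖ 1 (E ⊗ S)) (⊖-cong (dil-⊗ 1 E S)))))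
  (solve 2 (λ e s → con (+ 2) :* (:- (e :* s)) := :- (con (+ 2) :* (e :* s))) ≈-refl (dil 2 E) (dil 2 S)))

-- In φ⁻ = E² / E₂ the numerator contributes -2S and the denominator 2 S(q²).
D-φ⁻ : D φ⁻ ≈ φ⁻ ⊗ (C (+ 2) ⊗ (dil 2 S ⊕ ⊖ S))
D-φ⁻ = ⊗-cancelˡ (dil 2 E) (λ ()) (begin
  dil 2 E ⊗ D φ⁻
    ≈⟨ solve 3 (λ d x y → d :* x := (x :* d :+ y) :+ :- y) ≈-refl (dil 2 E) (D φ⁻) (φ⁻ ⊗ D (dil 2 E)) ⟩
  (D φ⁻ ⊗ dil 2 E ⊕ φ⁻ ⊗ D (dil 2 E)) ⊕ ⊖ (φ⁻ ⊗ D (dil 2 E))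
    ≈⟨ ⊕-cong (≈-trans (≈-sym (D-⊗ φ⁻ (dil 2 E))) (≈-trans (D-cong φ⁻E₂≈E²) (≈-trans (D-⊗ E E)
         (⊕-cong (⊗-congˡ E D-E) (⊗-congʳ E D-E))))) (⊖-cong (⊗-congʳ φ⁻ D-dil-E)) ⟩
  (⊖ (E ⊗ S) ⊗ E ⊕ E ⊗ (⊖ (E ⊗ S))) ⊕ ⊖ (φ⁻ ⊗ (⊖ (C (+ 2) ⊗ (dil 2 E ⊗ dil 2 S))))
    ≈⟨ solve 5 (λ e s f d t → ((:- (e :* s)) :* e :+ e :* (:- (e :* s))) :+ :- (f :* (:- (con (+ 2) :* (d :* t)))) :=
         con (+ 2) :* (f :* d :* t :+ :- (e :* e :* s))) ≈-refl E S φ⁻ (dil 2 E) (dil 2 S) ⟩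
  C (+ 2) ⊗ (φ⁻ ⊗ dil 2 E ⊗ dil 2 S ⊕ ⊖ (E ⊗ E ⊗ S))
    ≈⟨ ⊗-congʳ (C (+ 2)) (⊕-congʳ (φ⁻ ⊗ dil 2 E ⊗ dil 2 S) (⊖-cong (⊗-congˡ S (≈-sym φ⁻E₂≈E²)))) ⟩
  C (+ 2) ⊗ (φ⁻ ⊗ dil 2 E ⊗ dil 2 S ⊕ ⊖ (φ⁻ ⊗ dil 2 E ⊗ S))
    ≈⟨ solve 4 (λ f d t s → con (+ 2) :* (f :* d :* t :+ :- (f :* d :* s)) := d :* (f :* (con (+ 2) :* (t :+ :- s)))) ≈-refl φ⁻ (dil 2 E) (dil 2 S) S ⟩
  dil 2 E ⊗ (φ⁻ ⊗ (C (+ 2) ⊗ (dil 2 S ⊕ ⊖ S))) ∎)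
  where open ≈-Reasoning

D-φ⁻₃ : D (dil 3 φ⁻) ≈ dil 3 φ⁻ ⊗ (C (+ 6) ⊗ (dil 6 S ⊕ ⊖ dil 3 S))
D-φ⁻₃ = begin
  D (dil 3 φ⁻)
    ≈⟨ D-dil 2 φ⁻ ⟩
  C (+ 3) ⊗ dil 3 (D φ⁻)
    ≈⟨ ⊗-congʳ (C (+ 3)) (≈-trans (dil-cong 3 (≈-trans D-φ⁻ (⊗-congʳ φ⁻ (⊗-congʳ (C (+ 2)) (⊕-congʳ (dil 2 S) (≈-sym (-1⊗ S)))))))
         (dil-expr 2 (⟨ φ⁻ ⟩ ⟨⊗⟩ (⟨C⟩ (+ 2) ⟨⊗⟩ (⟨dil⟩ 1 S ⟨⊕⟩ ⟨⊖⟩ ⟨ S ⟩))))) ⟩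
  C (+ 3) ⊗ (dil 3 φ⁻ ⊗ (C (+ 2) ⊗ (dil 6 S ⊕ C (ℤ.- + 1) ⊗ dil 3 S)))
    ≈⟨ solve 3 (λ f t s → con (+ 3) :* (f :* (con (+ 2) :* (t :+ con (ℤ.- + 1) :* s))) := f :* (con (+ 6) :* (t :+ :- s))) ≈-refl (dil 3 φ⁻) (dil 6 S) (dil 3 S) ⟩
  dil 3 φ⁻ ⊗ (C (+ 6) ⊗ (dil 6 S ⊕ ⊖ dil 3 S)) ∎
  where open ≈-Reasoning

-- The Lambert series of q ψ(q)² ψ(q³)², where Ψ = 2ψ.
lambert : C (+ 16) ⊗ (S ⊕ ⊖ (C (+ 3) ⊗ dil 3 S) ⊕ ⊖ dil 2 S ⊕ C (+ 3) ⊗ dil 6 S) ≈ xp 1 ⊗ ((Ψ ⊗ Ψ) ⊗ (dil 3 Ψ ⊗ dil 3 Ψ))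
lambert = ⊗-cancelˡ (φ⁻ ⊗ dil 3 φ⁻) (λ ()) (begin
  φ⁻ ⊗ dil 3 φ⁻ ⊗ (C (+ 16) ⊗ (S ⊕ ⊖ (C (+ 3) ⊗ dil 3 S) ⊕ ⊖ dil 2 S ⊕ C (+ 3) ⊗ dil 6 S))
    -- The second factor is 8 times the logarithmic derivative of φ⁻₃/φ⁻, so the product with φ⁻ φ⁻₃
    -- is 8 times the Wronskian.
    ≈⟨ solve 6 (λ f g s₁ s₂ s₃ s₆ → f :* g :* (con (+ 16) :* (s₁ :+ :- (con (+ 3) :* s₃) :+ :- s₂ :+ con (+ 3) :* s₆)) :=
         con (+ 4) :* (con (+ 2) :* (f :* (g :* (con (+ 6) :* (s₆ :+ :- s₃))) :+ :- (f :* (con (+ 2) :* (s₂ :+ :- s₁)) :* g)))) ≈-refl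
         φ⁻ (dil 3 φ⁻) S (dil 2 S) (dil 3 S) (dil 6 S) ⟩
  C (+ 4) ⊗ (C (+ 2) ⊗ (φ⁻ ⊗ (dil 3 φ⁻ ⊗ (C (+ 6) ⊗ (dil 6 S ⊕ ⊖ dil 3 S))) ⊕ ⊖ (φ⁻ ⊗ (C (+ 2) ⊗ (dil 2 S ⊕ ⊖ S)) ⊗ dil 3 φ⁻)))
    ≈⟨ ⊗-congʳ (C (+ 4)) (⊗-congʳ (C (+ 2)) (⊕-cong (⊗-congʳ φ⁻ (≈-sym D-φ⁻₃)) (⊖-cong (⊗-congˡ (dil 3 φ⁻) (≈-sym D-φ⁻))))) ⟩
  C (+ 4) ⊗ (C (+ 2) ⊗ (φ⁻ ⊗ D (dil 3 φ⁻) ⊕ ⊖ (D φ⁻ ⊗ dil 3 φ⁻)))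
    ≈⟨ ⊗-congʳ (C (+ 4)) wronskian-𝒥 ⟩
  C (+ 4) ⊗ (xp 1 ⊗ (dil 2 𝒥 ⊗ dil 6 𝒥))
    ≈⟨ ⊗-congʳ (C (+ 4)) (⊗-congʳ (xp 1) (⊗-cong
         (dilate-≈ 1 ⟨ 𝒥 ⟩ cubes 𝒥≈) (dilate-≈ 5 ⟨ 𝒥 ⟩ cubes 𝒥≈))) ⟩
  C (+ 4) ⊗ (xp 1 ⊗ ((C (ℤ.- + 2) ⊗ (dil 2 E ⊗ dil 2 E ⊗ dil 2 E)) ⊗ (C (ℤ.- + 2) ⊗ (dil 6 E ⊗ dil 6 E ⊗ dil 6 E))))
    ≈⟨ solve 3 (λ x a b → con (+ 4) :* (x :* ((con (ℤ.- + 2) :* a) :* (con (ℤ.- + 2) :* b))) := x :* ((con (+ 4) :* a) :* (con (+ 4) :* b))) ≈-refl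
         (xp 1) (dil 2 E ⊗ dil 2 E ⊗ dil 2 E) (dil 6 E ⊗ dil 6 E ⊗ dil 6 E) ⟩
  xp 1 ⊗ ((C (+ 4) ⊗ (dil 2 E ⊗ dil 2 E ⊗ dil 2 E)) ⊗ (C (+ 4) ⊗ (dil 6 E ⊗ dil 6 E ⊗ dil 6 E)))
    ≈⟨ ⊗-congʳ (xp 1) (⊗-cong (≈-sym φ⁻Ψ²≈4E₂³) (≈-sym (dilate-≈ 2 (⟨ φ⁻ ⟩ ⟨⊗⟩ (⟨ Ψ ⟩ ⟨⊗⟩ ⟨ Ψ ⟩))
         (⟨C⟩ (+ 4) ⟨⊗⟩ (⟨dil⟩ 1 E ⟨⊗⟩ ⟨dil⟩ 1 E ⟨⊗⟩ ⟨dil⟩ 1 E)) φ⁻Ψ²≈4E₂³))) ⟩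
  xp 1 ⊗ ((φ⁻ ⊗ (Ψ ⊗ Ψ)) ⊗ (dil 3 φ⁻ ⊗ (dil 3 Ψ ⊗ dil 3 Ψ)))
    ≈⟨ solve 5 (λ x f g p r → x :* ((f :* p) :* (g :* r)) := f :* g :* (x :* (p :* r))) ≈-refl (xp 1) φ⁻ (dil 3 φ⁻) (Ψ ⊗ Ψ) (dil 3 Ψ ⊗ dil 3 Ψ) ⟩
  φ⁻ ⊗ dil 3 φ⁻ ⊗ (xp 1 ⊗ ((Ψ ⊗ Ψ) ⊗ (dil 3 Ψ ⊗ dil 3 Ψ))) ∎)
  where
  open ≈-Reasoning
  cubes : Expr
  cubes = ⟨C⟩ (ℤ.- + 2) ⟨⊗⟩ (⟨ E ⟩ ⟨⊗⟩ ⟨ E ⟩ ⟨⊗⟩ ⟨ E ⟩)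
  𝒥≈ : 𝒥 ≈ ⟦ cubes ⟧ᵉ
  𝒥≈ = ≈-trans 𝒥≈-2E³ (solve 1 (λ x → :- (con (+ 2) :* x) := con (ℤ.- + 2) :* x) ≈-refl (E ⊗ E ⊗ E))

-- Dissection modulo 8

-- Powers of q as products of `xp 1`, so that the solver sees a single variable.
xpow : ℕ → Series
xpow zero    = C (+ 1)
xpow (suc m) = xp 1 ⊗ xpow m

xp≈xpow : ∀ m → xp m ≈ xpow m
xp≈xpow zero    = ≈-refl
xp≈xpow (suc m) = ≈-trans (xp-+ 1 m) (⊗-congʳ (xp 1) (xp≈xpow m))

Ψ²-split : ∀ k → dil (suc k) Ψ ⊗ dil (suc k) Ψ ≈ C (+ 2) ⊗ ((dil (suc (k ℕ.+ 3 ℕ.* suc k)) φ ⊕ xp (1 ℕ.* suc k) ⊗ dil (suc (k ℕ.+ 7 ℕ.* suc k)) Ψ) ⊗ dil (suc (k ℕ.+ 1 ℕ.* suc k)) Ψ)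
Ψ²-split k = dilate-≈ k (⟨ Ψ ⟩ ⟨⊗⟩ ⟨ Ψ ⟩) (⟨C⟩ (+ 2) ⟨⊗⟩ ((⟨dil⟩ 3 φ ⟨⊕⟩ ⟨xp⟩ 1 ⟨⊗⟩ ⟨dil⟩ 7 Ψ) ⟨⊗⟩ ⟨dil⟩ 1 Ψ))
  (≈-trans (≈-sym 2φΨ₂≈Ψ²) (⊗-congʳ (C (+ 2)) (⊗-congˡ (dil 2 Ψ) φ-split)))

φ²-split-dil : ∀ k → dil (suc k) φ ⊗ dil (suc k) φ ≈ dil (suc (k ℕ.+ 1 ℕ.* suc k)) φ ⊗ dil (suc (k ℕ.+ 1 ℕ.* suc k)) φ ⊕
               xp (1 ℕ.* suc k) ⊗ (dil (suc (k ℕ.+ 3 ℕ.* suc k)) Ψ ⊗ dil (suc (k ℕ.+ 3 ℕ.* suc k)) Ψ)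
φ²-split-dil k = dilate-≈ k (⟨ φ ⟩ ⟨⊗⟩ ⟨ φ ⟩) (⟨dil⟩ 1 φ ⟨⊗⟩ ⟨dil⟩ 1 φ ⟨⊕⟩ ⟨xp⟩ 1 ⟨⊗⟩ (⟨dil⟩ 3 Ψ ⟨⊗⟩ ⟨dil⟩ 3 Ψ)) φ²-split

-- 8 Y(k) is the coefficient of q^(8k + 3) in q Ψ² Ψ₃²: the other terms of lambert-dissection avoid 3 mod 8.
Y : Series
Y = xp 1 ⊗ (dil 3 Ψ ⊗ dil 3 Ψ ⊗ dil 4 Ψ ⊗ Ψ) ⊕ φ ⊗ φ ⊗ dil 6 φ ⊗ dil 3 Ψ ⊕ xp 2 ⊗ (dil 2 Ψ ⊗ dil 2 Ψ ⊗ dil 12 Ψ ⊗ dil 3 Ψ)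

Yᵉ R₄ᵉ R₂ᵉ R₈ᵉ : Expr
Yᵉ  = ⟨xp⟩ 1 ⟨⊗⟩ (⟨dil⟩ 2 Ψ ⟨⊗⟩ ⟨dil⟩ 2 Ψ ⟨⊗⟩ ⟨dil⟩ 3 Ψ ⟨⊗⟩ ⟨ Ψ ⟩) ⟨⊕⟩ ⟨ φ ⟩ ⟨⊗⟩ ⟨ φ ⟩ ⟨⊗⟩ ⟨dil⟩ 5 φ ⟨⊗⟩ ⟨dil⟩ 2 Ψ ⟨⊕⟩ ⟨xp⟩ 2 ⟨⊗⟩ (⟨dil⟩ 1 Ψ ⟨⊗⟩ ⟨dil⟩ 1 Ψ ⟨⊗⟩ ⟨dil⟩ 11 Ψ ⟨⊗⟩ ⟨dil⟩ 2 Ψ)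
R₄ᵉ = ⟨C⟩ (+ 4) ⟨⊗⟩ (⟨dil⟩ 2 φ ⟨⊗⟩ ⟨dil⟩ 2 φ ⟨⊗⟩ (⟨ Ψ ⟩ ⟨⊗⟩ ⟨ Ψ ⟩) ⟨⊕⟩ ⟨xp⟩ 1 ⟨⊗⟩ (⟨dil⟩ 1 Ψ ⟨⊗⟩ ⟨dil⟩ 1 Ψ ⟨⊗⟩ (⟨dil⟩ 2 Ψ ⟨⊗⟩ ⟨dil⟩ 2 Ψ)))
R₂ᵉ = ⟨C⟩ (+ 8) ⟨⊗⟩ (⟨dil⟩ 2 φ ⟨⊗⟩ ⟨dil⟩ 1 Ψ ⟨⊗⟩ ⟨ φ ⟩ ⟨⊗⟩ ⟨dil⟩ 5 Ψ)
R₈ᵉ = ⟨C⟩ (+ 8) ⟨⊗⟩ (⟨dil⟩ 2 Ψ ⟨⊗⟩ ⟨dil⟩ 2 Ψ ⟨⊗⟩ ⟨dil⟩ 1 φ ⟨⊗⟩ ⟨ Ψ ⟩ ⟨⊕⟩ ⟨xp⟩ 1 ⟨⊗⟩ (⟨ φ ⟩ ⟨⊗⟩ ⟨ φ ⟩ ⟨⊗⟩ ⟨dil⟩ 11 Ψ ⟨⊗⟩ ⟨dil⟩ 2 Ψ) ⟨⊕⟩ ⟨dil⟩ 1 Ψ ⟨⊗⟩ ⟨dil⟩ 1 Ψ ⟨⊗⟩ ⟨dil⟩ 5 φ ⟨⊗⟩ ⟨dil⟩ 2 Ψ)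

square-of-split : xp 1 ⊗ ((Ψ ⊗ Ψ) ⊗ (dil 3 Ψ ⊗ dil 3 Ψ)) ≈
  C (+ 4) ⊗ (xp 1 ⊗ ((dil 6 φ ⊗ dil 6 φ) ⊗ (dil 4 Ψ ⊗ dil 4 Ψ)) ⊕ xp 3 ⊗ ((dil 2 φ ⊗ dil 2 φ) ⊗ (dil 12 Ψ ⊗ dil 12 Ψ)))
  ⊕ xp 2 ⊗ (C (+ 8) ⊗ (dil 6 φ ⊗ dil 4 Ψ ⊗ dil 2 φ ⊗ dil 12 Ψ))
square-of-split = begin
  x ⊗ ((Ψ ⊗ Ψ) ⊗ (dil 3 Ψ ⊗ dil 3 Ψ))
    ≈⟨ solve 3 (λ x a b → x :* ((a :* a) :* (b :* b)) := x :* ((a :* b) :* (a :* b))) ≈-refl x Ψ (dil 3 Ψ) ⟩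
  x ⊗ ((Ψ ⊗ dil 3 Ψ) ⊗ (Ψ ⊗ dil 3 Ψ))
    ≈⟨ ⊗-congʳ x (⊗-cong ΨΨ₃-split ΨΨ₃-split) ⟩
  x ⊗ ((C (+ 2) ⊗ (dil 4 Ψ ⊗ dil 6 φ ⊕ x ⊗ (dil 12 Ψ ⊗ dil 2 φ))) ⊗ (C (+ 2) ⊗ (dil 4 Ψ ⊗ dil 6 φ ⊕ x ⊗ (dil 12 Ψ ⊗ dil 2 φ))))
    ≈⟨ solve 5 (λ x p f q g → x :* ((con (+ 2) :* (p :* f :+ x :* (q :* g))) :* (con (+ 2) :* (p :* f :+ x :* (q :* g)))) :=
         con (+ 4) :* (x :* ((f :* f) :* (p :* p)) :+ (x :* (x :* (x :* con (+ 1)))) :* ((g :* g) :* (q :* q))) :+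
         (x :* (x :* con (+ 1))) :* (con (+ 8) :* (f :* p :* g :* q))) ≈-refl x (dil 4 Ψ) (dil 6 φ) (dil 12 Ψ) (dil 2 φ) ⟩
  C (+ 4) ⊗ (x ⊗ ((dil 6 φ ⊗ dil 6 φ) ⊗ (dil 4 Ψ ⊗ dil 4 Ψ)) ⊕ xpow 3 ⊗ ((dil 2 φ ⊗ dil 2 φ) ⊗ (dil 12 Ψ ⊗ dil 12 Ψ)))
    ⊕ xpow 2 ⊗ (C (+ 8) ⊗ (dil 6 φ ⊗ dil 4 Ψ ⊗ dil 2 φ ⊗ dil 12 Ψ))
    ≈⟨ ≈-sym (⊕-cong (⊗-congʳ (C (+ 4)) (⊕-congʳ (x ⊗ ((dil 6 φ ⊗ dil 6 φ) ⊗ (dil 4 Ψ ⊗ dil 4 Ψ)))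
         (⊗-congˡ ((dil 2 φ ⊗ dil 2 φ) ⊗ (dil 12 Ψ ⊗ dil 12 Ψ)) (xp≈xpow 3))))
         (⊗-congˡ (C (+ 8) ⊗ (dil 6 φ ⊗ dil 4 Ψ ⊗ dil 2 φ ⊗ dil 12 Ψ)) (xp≈xpow 2))) ⟩
  C (+ 4) ⊗ (x ⊗ ((dil 6 φ ⊗ dil 6 φ) ⊗ (dil 4 Ψ ⊗ dil 4 Ψ)) ⊕ xp 3 ⊗ ((dil 2 φ ⊗ dil 2 φ) ⊗ (dil 12 Ψ ⊗ dil 12 Ψ)))
    ⊕ xp 2 ⊗ (C (+ 8) ⊗ (dil 6 φ ⊗ dil 4 Ψ ⊗ dil 2 φ ⊗ dil 12 Ψ)) ∎
  where
  open ≈-Reasoning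
  x : Series
  x = xp 1

-- The summand with φ₁₂² Ψ₄² has only exponents ≡ 1 modulo 4 and stays whole; in the other one Ψ₄²
-- is split to separate 7 from 3 modulo 8.
first-term : xp 1 ⊗ ((dil 6 φ ⊗ dil 6 φ) ⊗ (dil 4 Ψ ⊗ dil 4 Ψ)) ≈
  xp 1 ⊗ (dil 12 φ ⊗ dil 12 φ ⊗ (dil 4 Ψ ⊗ dil 4 Ψ)) ⊕ xp 7 ⊗ (dil 24 Ψ ⊗ dil 24 Ψ ⊗ (C (+ 2) ⊗ (dil 16 φ ⊗ dil 8 Ψ)))
  ⊕ xp 11 ⊗ (dil 24 Ψ ⊗ dil 24 Ψ ⊗ (C (+ 2) ⊗ (dil 32 Ψ ⊗ dil 8 Ψ)))
first-term = begin
  x ⊗ ((dil 6 φ ⊗ dil 6 φ) ⊗ p²)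
    ≈⟨ ⊗-congʳ x (⊗-congˡ p² (φ²-split-dil 5)) ⟩
  x ⊗ ((f² ⊕ xp 6 ⊗ r²) ⊗ p²)
    ≈⟨ solve 5 (λ x f y r p → x :* ((f :+ y :* r) :* p) := x :* (f :* p) :+ x :* y :* (r :* p)) ≈-refl x f² (xp 6) r² p² ⟩
  x ⊗ (f² ⊗ p²) ⊕ x ⊗ xp 6 ⊗ (r² ⊗ p²)
    ≈⟨ ⊕-congʳ (x ⊗ (f² ⊗ p²)) (⊗-cong (≈-sym (xp-+ 1 6)) (⊗-congʳ r² (Ψ²-split 3))) ⟩
  x ⊗ (f² ⊗ p²) ⊕ xp 7 ⊗ (r² ⊗ (C (+ 2) ⊗ ((dil 16 φ ⊕ xp 4 ⊗ dil 32 Ψ) ⊗ dil 8 Ψ)))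
    ≈⟨ solve 7 (λ a x r g y s t → a :+ x :* (r :* (con (+ 2) :* ((g :+ y :* s) :* t))) :=
         a :+ x :* (r :* (con (+ 2) :* (g :* t))) :+ x :* y :* (r :* (con (+ 2) :* (s :* t)))) ≈-refl
         (x ⊗ (f² ⊗ p²)) (xp 7) r² (dil 16 φ) (xp 4) (dil 32 Ψ) (dil 8 Ψ) ⟩
  x ⊗ (f² ⊗ p²) ⊕ xp 7 ⊗ (r² ⊗ (C (+ 2) ⊗ (dil 16 φ ⊗ dil 8 Ψ))) ⊕ xp 7 ⊗ xp 4 ⊗ (r² ⊗ (C (+ 2) ⊗ (dil 32 Ψ ⊗ dil 8 Ψ)))
    ≈⟨ ⊕-congʳ (x ⊗ (f² ⊗ p²) ⊕ xp 7 ⊗ (r² ⊗ (C (+ 2) ⊗ (dil 16 φ ⊗ dil 8 Ψ)))) (⊗-congˡ (r² ⊗ (C (+ 2) ⊗ (dil 32 Ψ ⊗ dil 8 Ψ))) (≈-sym (xp-+ 7 4))) ⟩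
  x ⊗ (f² ⊗ p²) ⊕ xp 7 ⊗ (r² ⊗ (C (+ 2) ⊗ (dil 16 φ ⊗ dil 8 Ψ))) ⊕ xp 11 ⊗ (r² ⊗ (C (+ 2) ⊗ (dil 32 Ψ ⊗ dil 8 Ψ))) ∎
  where
  open ≈-Reasoning
  x f² p² r² : Series
  x = xp 1
  f² = dil 12 φ ⊗ dil 12 φ
  p² = dil 4 Ψ ⊗ dil 4 Ψ
  r² = dil 24 Ψ ⊗ dil 24 Ψ

-- The summand with q⁵ has only exponents ≡ 1 modulo 4 and stays whole; the other one is split into
-- series in q⁸ times powers of q.
second-term : xp 3 ⊗ ((dil 2 φ ⊗ dil 2 φ) ⊗ (dil 12 Ψ ⊗ dil 12 Ψ)) ≈
  xp 5 ⊗ (dil 8 Ψ ⊗ dil 8 Ψ ⊗ (dil 12 Ψ ⊗ dil 12 Ψ)) ⊕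
  xp 3 ⊗ ((dil 8 φ ⊗ dil 8 φ ⊕ xp 4 ⊗ (dil 16 Ψ ⊗ dil 16 Ψ)) ⊗ (C (+ 2) ⊗ ((dil 48 φ ⊕ xp 12 ⊗ dil 96 Ψ) ⊗ dil 24 Ψ)))
second-term = begin
  y ⊗ ((dil 2 φ ⊗ dil 2 φ) ⊗ p²)
    ≈⟨ ⊗-congʳ y (⊗-congˡ p² (φ²-split-dil 1)) ⟩
  y ⊗ ((dil 4 φ ⊗ dil 4 φ ⊕ xp 2 ⊗ r²) ⊗ p²)
    ≈⟨ solve 5 (λ y f z r p → y :* ((f :+ z :* r) :* p) := y :* z :* (r :* p) :+ y :* (f :* p)) ≈-refl y (dil 4 φ ⊗ dil 4 φ) (xp 2) r² p² ⟩
  y ⊗ xp 2 ⊗ (r² ⊗ p²) ⊕ y ⊗ ((dil 4 φ ⊗ dil 4 φ) ⊗ p²)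
    ≈⟨ ⊕-cong (⊗-congˡ (r² ⊗ p²) (≈-sym (xp-+ 3 2))) (⊗-congʳ y (⊗-cong (φ²-split-dil 3) (Ψ²-split 11))) ⟩
  xp 5 ⊗ (r² ⊗ p²) ⊕ y ⊗ ((dil 8 φ ⊗ dil 8 φ ⊕ xp 4 ⊗ (dil 16 Ψ ⊗ dil 16 Ψ)) ⊗ (C (+ 2) ⊗ ((dil 48 φ ⊕ xp 12 ⊗ dil 96 Ψ) ⊗ dil 24 Ψ))) ∎
  where
  open ≈-Reasoning
  y p² r² : Series
  y = xp 3
  p² = dil 12 Ψ ⊗ dil 12 Ψ
  r² = dil 8 Ψ ⊗ dil 8 Ψ

lambert-dissection : xp 1 ⊗ ((Ψ ⊗ Ψ) ⊗ (dil 3 Ψ ⊗ dil 3 Ψ)) ≈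
  xp 1 ⊗ dil 4 ⟦ R₄ᵉ ⟧ᵉ ⊕ xp 2 ⊗ dil 2 ⟦ R₂ᵉ ⟧ᵉ ⊕ xp 7 ⊗ dil 8 ⟦ R₈ᵉ ⟧ᵉ ⊕ C (+ 8) ⊗ (xp 3 ⊗ dil 8 Y)
lambert-dissection = begin
  xp 1 ⊗ ((Ψ ⊗ Ψ) ⊗ (dil 3 Ψ ⊗ dil 3 Ψ))
    ≈⟨ square-of-split ⟩
  C (+ 4) ⊗ (xp 1 ⊗ ((dil 6 φ ⊗ dil 6 φ) ⊗ (dil 4 Ψ ⊗ dil 4 Ψ)) ⊕ xp 3 ⊗ ((dil 2 φ ⊗ dil 2 φ) ⊗ (dil 12 Ψ ⊗ dil 12 Ψ))) ⊕ xp 2 ⊗ ⟦ dilate 1 R₂ᵉ ⟧ᵉ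
    ≈⟨ ⊕-congˡ (xp 2 ⊗ ⟦ dilate 1 R₂ᵉ ⟧ᵉ) (⊗-congʳ (C (+ 4)) (⊕-cong first-term second-term)) ⟩
  C (+ 4) ⊗ (xp 1 ⊗ (f₁₂ ⊗ f₁₂ ⊗ (p₄ ⊗ p₄)) ⊕ xp 7 ⊗ (p₂₄ ⊗ p₂₄ ⊗ (C (+ 2) ⊗ (f₁₆ ⊗ p₈))) ⊕ xp 11 ⊗ (p₂₄ ⊗ p₂₄ ⊗ (C (+ 2) ⊗ (p₃₂ ⊗ p₈)))
    ⊕ (xp 5 ⊗ (p₈ ⊗ p₈ ⊗ (p₁₂ ⊗ p₁₂)) ⊕ xp 3 ⊗ ((f₈ ⊗ f₈ ⊕ xp 4 ⊗ (p₁₆ ⊗ p₁₆)) ⊗ (C (+ 2) ⊗ ((f₄₈ ⊕ xp 12 ⊗ p₉₆) ⊗ p₂₄)))))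
    ⊕ xp 2 ⊗ ⟦ dilate 1 R₂ᵉ ⟧ᵉ
    -- In q¹¹ = q³ q⁸ and q⁵ = q q⁴ the first factor records the residue, and the second one is
    -- absorbed into the dilated series.
    ≈⟨ ⊕-congˡ (xp 2 ⊗ ⟦ dilate 1 R₂ᵉ ⟧ᵉ) (⊗-congʳ (C (+ 4)) (⊕-cong
         (⊕-congʳ (xp 1 ⊗ (f₁₂ ⊗ f₁₂ ⊗ (p₄ ⊗ p₄)) ⊕ xp 7 ⊗ (p₂₄ ⊗ p₂₄ ⊗ (C (+ 2) ⊗ (f₁₆ ⊗ p₈)))) (⊗-congˡ (p₂₄ ⊗ p₂₄ ⊗ (C (+ 2) ⊗ (p₃₂ ⊗ p₈))) (xp-+ 3 8)))
         (⊕-congˡ (xp 3 ⊗ ((f₈ ⊗ f₈ ⊕ xp 4 ⊗ (p₁₆ ⊗ p₁₆)) ⊗ (C (+ 2) ⊗ ((f₄₈ ⊕ xp 12 ⊗ p₉₆) ⊗ p₂₄)))) (⊗-congˡ (p₈ ⊗ p₈ ⊗ (p₁₂ ⊗ p₁₂)) (xp-+ 1 4))))) ⟩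
  C (+ 4) ⊗ (xp 1 ⊗ (f₁₂ ⊗ f₁₂ ⊗ (p₄ ⊗ p₄)) ⊕ xp 7 ⊗ (p₂₄ ⊗ p₂₄ ⊗ (C (+ 2) ⊗ (f₁₆ ⊗ p₈))) ⊕ (xp 3 ⊗ xp 8) ⊗ (p₂₄ ⊗ p₂₄ ⊗ (C (+ 2) ⊗ (p₃₂ ⊗ p₈)))
    ⊕ ((xp 1 ⊗ xp 4) ⊗ (p₈ ⊗ p₈ ⊗ (p₁₂ ⊗ p₁₂)) ⊕ xp 3 ⊗ ((f₈ ⊗ f₈ ⊕ xp 4 ⊗ (p₁₆ ⊗ p₁₆)) ⊗ (C (+ 2) ⊗ ((f₄₈ ⊕ xp 12 ⊗ p₉₆) ⊗ p₂₄)))))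
    ⊕ xp 2 ⊗ ⟦ dilate 1 R₂ᵉ ⟧ᵉ
    ≈⟨ collect (xp 1) (xp 7) (xp 3) (xp 8) (xp 4) (xp 12) f₁₂ p₄ p₂₄ f₁₆ p₈ p₃₂ p₁₂ f₈ p₁₆ f₄₈ p₉₆ (xp 2 ⊗ ⟦ dilate 1 R₂ᵉ ⟧ᵉ) ⟩
  xp 1 ⊗ ⟦ dilate 3 R₄ᵉ ⟧ᵉ ⊕ xp 2 ⊗ ⟦ dilate 1 R₂ᵉ ⟧ᵉ ⊕
    C (+ 8) ⊗ (xp 7 ⊗ (p₂₄ ⊗ p₂₄ ⊗ f₁₆ ⊗ p₈) ⊕ (xp 3 ⊗ xp 12) ⊗ (f₈ ⊗ f₈ ⊗ p₉₆ ⊗ p₂₄) ⊕ (xp 3 ⊗ xp 4) ⊗ (p₁₆ ⊗ p₁₆ ⊗ f₄₈ ⊗ p₂₄)) ⊕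
    C (+ 8) ⊗ (xp 3 ⊗ (xp 8 ⊗ (p₂₄ ⊗ p₂₄ ⊗ p₃₂ ⊗ p₈) ⊕ f₈ ⊗ f₈ ⊗ f₄₈ ⊗ p₂₄ ⊕ (xp 4 ⊗ xp 12) ⊗ (p₁₆ ⊗ p₁₆ ⊗ p₉₆ ⊗ p₂₄)))
    ≈⟨ ⊕-cong (⊕-congʳ (xp 1 ⊗ ⟦ dilate 3 R₄ᵉ ⟧ᵉ ⊕ xp 2 ⊗ ⟦ dilate 1 R₂ᵉ ⟧ᵉ) (⊗-congʳ (C (+ 8)) (⊕-cong
           (⊕-congʳ (xp 7 ⊗ (p₂₄ ⊗ p₂₄ ⊗ f₁₆ ⊗ p₈)) (⊗-congˡ (f₈ ⊗ f₈ ⊗ p₉₆ ⊗ p₂₄) (≈-trans (≈-sym (xp-+ 3 12)) (xp-+ 7 8))))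
           (⊗-congˡ (p₁₆ ⊗ p₁₆ ⊗ f₄₈ ⊗ p₂₄) (≈-sym (xp-+ 3 4))))))
         (⊗-congʳ (C (+ 8)) (⊗-congʳ (xp 3) (⊕-congʳ (xp 8 ⊗ (p₂₄ ⊗ p₂₄ ⊗ p₃₂ ⊗ p₈) ⊕ f₈ ⊗ f₈ ⊗ f₄₈ ⊗ p₂₄)
           (⊗-congˡ (p₁₆ ⊗ p₁₆ ⊗ p₉₆ ⊗ p₂₄) (≈-sym (xp-+ 4 12)))))) ⟩
  xp 1 ⊗ ⟦ dilate 3 R₄ᵉ ⟧ᵉ ⊕ xp 2 ⊗ ⟦ dilate 1 R₂ᵉ ⟧ᵉ ⊕
    C (+ 8) ⊗ (xp 7 ⊗ (p₂₄ ⊗ p₂₄ ⊗ f₁₆ ⊗ p₈) ⊕ (xp 7 ⊗ xp 8) ⊗ (f₈ ⊗ f₈ ⊗ p₉₆ ⊗ p₂₄) ⊕ xp 7 ⊗ (p₁₆ ⊗ p₁₆ ⊗ f₄₈ ⊗ p₂₄)) ⊕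
    C (+ 8) ⊗ (xp 3 ⊗ ⟦ dilate 7 Yᵉ ⟧ᵉ)
    ≈⟨ ⊕-congˡ (C (+ 8) ⊗ (xp 3 ⊗ ⟦ dilate 7 Yᵉ ⟧ᵉ)) (⊕-congʳ (xp 1 ⊗ ⟦ dilate 3 R₄ᵉ ⟧ᵉ ⊕ xp 2 ⊗ ⟦ dilate 1 R₂ᵉ ⟧ᵉ)
         (solve 5 (λ x y a b c → con (+ 8) :* (x :* a :+ (x :* y) :* b :+ x :* c) := x :* (con (+ 8) :* (a :+ y :* b :+ c))) ≈-refl
           (xp 7) (xp 8) (p₂₄ ⊗ p₂₄ ⊗ f₁₆ ⊗ p₈) (f₈ ⊗ f₈ ⊗ p₉₆ ⊗ p₂₄) (p₁₆ ⊗ p₁₆ ⊗ f₄₈ ⊗ p₂₄))) ⟩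
  xp 1 ⊗ ⟦ dilate 3 R₄ᵉ ⟧ᵉ ⊕ xp 2 ⊗ ⟦ dilate 1 R₂ᵉ ⟧ᵉ ⊕ xp 7 ⊗ ⟦ dilate 7 R₈ᵉ ⟧ᵉ ⊕ C (+ 8) ⊗ (xp 3 ⊗ ⟦ dilate 7 Yᵉ ⟧ᵉ)
    ≈⟨ ≈-sym (⊕-cong (⊕-cong (⊕-cong (⊗-congʳ (xp 1) (dil-expr 3 R₄ᵉ)) (⊗-congʳ (xp 2) (dil-expr 1 R₂ᵉ))) (⊗-congʳ (xp 7) (dil-expr 7 R₈ᵉ)))
         (⊗-congʳ (C (+ 8)) (⊗-congʳ (xp 3) (dil-expr 7 Yᵉ)))) ⟩
  xp 1 ⊗ dil 4 ⟦ R₄ᵉ ⟧ᵉ ⊕ xp 2 ⊗ dil 2 ⟦ R₂ᵉ ⟧ᵉ ⊕ xp 7 ⊗ dil 8 ⟦ R₈ᵉ ⟧ᵉ ⊕ C (+ 8) ⊗ (xp 3 ⊗ dil 8 Y) ∎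
  where
  open ≈-Reasoning
  f₈ f₁₂ f₁₆ f₄₈ p₄ p₈ p₁₂ p₁₆ p₂₄ p₃₂ p₉₆ : Series
  f₈ = dil 8 φ
  f₁₂ = dil 12 φ
  f₁₆ = dil 16 φ
  f₄₈ = dil 48 φ
  p₄ = dil 4 Ψ
  p₈ = dil 8 Ψ
  p₁₂ = dil 12 Ψ
  p₁₆ = dil 16 Ψ
  p₂₄ = dil 24 Ψ
  p₃₂ = dil 32 Ψ
  p₉₆ = dil 96 Ψ
  collect : ∀ x₁ x₇ x₃ x₈ x₄ x₁₂ f₁₂ p₄ p₂₄ f₁₆ p₈ p₃₂ p₁₂ f₈ p₁₆ f₄₈ p₉₆ r →
    C (+ 4) ⊗ (x₁ ⊗ (f₁₂ ⊗ f₁₂ ⊗ (p₄ ⊗ p₄)) ⊕ x₇ ⊗ (p₂₄ ⊗ p₂₄ ⊗ (C (+ 2) ⊗ (f₁₆ ⊗ p₈))) ⊕ (x₃ ⊗ x₈) ⊗ (p₂₄ ⊗ p₂₄ ⊗ (C (+ 2) ⊗ (p₃₂ ⊗ p₈)))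
      ⊕ ((x₁ ⊗ x₄) ⊗ (p₈ ⊗ p₈ ⊗ (p₁₂ ⊗ p₁₂)) ⊕ x₃ ⊗ ((f₈ ⊗ f₈ ⊕ x₄ ⊗ (p₁₆ ⊗ p₁₆)) ⊗ (C (+ 2) ⊗ ((f₄₈ ⊕ x₁₂ ⊗ p₉₆) ⊗ p₂₄))))) ⊕ r
    ≈ x₁ ⊗ (C (+ 4) ⊗ (f₁₂ ⊗ f₁₂ ⊗ (p₄ ⊗ p₄) ⊕ x₄ ⊗ (p₈ ⊗ p₈ ⊗ (p₁₂ ⊗ p₁₂)))) ⊕ r ⊕
      C (+ 8) ⊗ (x₇ ⊗ (p₂₄ ⊗ p₂₄ ⊗ f₁₆ ⊗ p₈) ⊕ (x₃ ⊗ x₁₂) ⊗ (f₈ ⊗ f₈ ⊗ p₉₆ ⊗ p₂₄) ⊕ (x₃ ⊗ x₄) ⊗ (p₁₆ ⊗ p₁₆ ⊗ f₄₈ ⊗ p₂₄)) ⊕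
      C (+ 8) ⊗ (x₃ ⊗ (x₈ ⊗ (p₂₄ ⊗ p₂₄ ⊗ p₃₂ ⊗ p₈) ⊕ f₈ ⊗ f₈ ⊗ f₄₈ ⊗ p₂₄ ⊕ (x₄ ⊗ x₁₂) ⊗ (p₁₆ ⊗ p₁₆ ⊗ p₉₆ ⊗ p₂₄)))
  collect = solve 18 (λ x₁ x₇ x₃ x₈ x₄ x₁₂ f₁₂ p₄ p₂₄ f₁₆ p₈ p₃₂ p₁₂ f₈ p₁₆ f₄₈ p₉₆ r →
    con (+ 4) :* (x₁ :* (f₁₂ :* f₁₂ :* (p₄ :* p₄)) :+ x₇ :* (p₂₄ :* p₂₄ :* (con (+ 2) :* (f₁₆ :* p₈))) :+ (x₃ :* x₈) :* (p₂₄ :* p₂₄ :* (con (+ 2) :* (p₃₂ :* p₈)))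
      :+ ((x₁ :* x₄) :* (p₈ :* p₈ :* (p₁₂ :* p₁₂)) :+ x₃ :* ((f₈ :* f₈ :+ x₄ :* (p₁₆ :* p₁₆)) :* (con (+ 2) :* ((f₄₈ :+ x₁₂ :* p₉₆) :* p₂₄))))) :+ r
    := x₁ :* (con (+ 4) :* (f₁₂ :* f₁₂ :* (p₄ :* p₄) :+ x₄ :* (p₈ :* p₈ :* (p₁₂ :* p₁₂)))) :+ r :+
      con (+ 8) :* (x₇ :* (p₂₄ :* p₂₄ :* f₁₆ :* p₈) :+ (x₃ :* x₁₂) :* (f₈ :* f₈ :* p₉₆ :* p₂₄) :+ (x₃ :* x₄) :* (p₁₆ :* p₁₆ :* f₄₈ :* p₂₄)) :+
      con (+ 8) :* (x₃ :* (x₈ :* (p₂₄ :* p₂₄ :* p₃₂ :* p₈) :+ f₈ :* f₈ :* f₄₈ :* p₂₄ :+ (x₄ :* x₁₂) :* (p₁₆ :* p₁₆ :* p₉₆ :* p₂₄)))) ≈-refl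

infixl 4 _⟨+⟩_
_⟨+⟩_ : ∀ {a b c d : ℤ} → a ≡ b → c ≡ d → a ℤ.+ c ≡ b ℤ.+ d
p ⟨+⟩ q = cong₂ ℤ._+_ p q

at-off : ∀ r k f {N} j s → s ℕ.< k → N ≡ r ℕ.+ (j ℕ.* suc k ℕ.+ suc s) → (xp r ⊗ dil (suc k) f) N ≡ + 0
at-off r k f j s s<k refl = trans (xp-⊗-≥ r (dil (suc k) f) _) (dil-at-nonmultiple k f j s s<k)

at-on : ∀ r k f {N} j → N ≡ r ℕ.+ j ℕ.* suc k → (xp r ⊗ dil (suc k) f) N ≡ f j
at-on r k f j refl = trans (xp-⊗-≥ r (dil (suc k) f) _) (dil-at-multiple k f j)

lambert-at : ∀ n → (xp 1 ⊗ ((Ψ ⊗ Ψ) ⊗ (dil 3 Ψ ⊗ dil 3 Ψ))) (8 * n + 11) ≡ + 8 ℤ.* Y (suc n)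
lambert-at n = trans (at lambert-dissection (8 * n + 11)) (trans
  (at-off 1 3 ⟦ R₄ᵉ ⟧ᵉ (2 * n + 2) 1 (ℕ.s≤s (ℕ.s≤s ℕ.z≤n)) (l₁ n)
   ⟨+⟩ at-off 2 1 ⟦ R₂ᵉ ⟧ᵉ (4 * n + 4) 0 (ℕ.s≤s ℕ.z≤n) (l₂ n)
   ⟨+⟩ at-off 7 7 ⟦ R₈ᵉ ⟧ᵉ n 3 (ℕ.s≤s (ℕ.s≤s (ℕ.s≤s (ℕ.s≤s ℕ.z≤n)))) (l₃ n)
   ⟨+⟩ trans (C-⊗-at (+ 8) (xp 3 ⊗ dil 8 Y) (8 * n + 11)) (cong (λ z → + 8 ℤ.* z) (at-on 3 7 Y (suc n) (l₄ n))))
  (ℤₚ.+-identityˡ _))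
  where
  l₁ : ∀ n → 8 * n + 11 ≡ 1 + ((2 * n + 2) * 4 + 2)
  l₁ = ℕ-Solver.solve-∀
  l₂ : ∀ n → 8 * n + 11 ≡ 2 + ((4 * n + 4) * 2 + 1)
  l₂ = ℕ-Solver.solve-∀
  l₃ : ∀ n → 8 * n + 11 ≡ 7 + (n * 8 + 4)
  l₃ = ℕ-Solver.solve-∀
  l₄ : ∀ n → 8 * n + 11 ≡ 3 + (1 + n) * 8
  l₄ = ℕ-Solver.solve-∀

-- The series of a(n) modulo 8

Ψ⁻Ψ⁻₃-split : Ψ⁻ ⊗ dil 3 Ψ⁻ ≈ C (+ 2) ⊗ (dil 4 Ψ ⊗ dil 6 φ ⊕ C (ℤ.- + 1) ⊗ (xp 1 ⊗ (dil 12 Ψ ⊗ dil 2 φ)))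
Ψ⁻Ψ⁻₃-split = ≈-trans (≈-sym (sgn-⊗-cong Ψ (dil 3 Ψ) (≈-refl {Ψ⁻}) (sgn-dil-3 Ψ))) (≈-trans (sgn-cong ΨΨ₃-split)
  (sgn-⊗-cong (C (+ 2)) (dil 4 Ψ ⊗ dil 6 φ ⊕ xp 1 ⊗ (dil 12 Ψ ⊗ dil 2 φ)) (sgn-C (+ 2))
    (≈-trans (sgn-⊕ (dil 4 Ψ ⊗ dil 6 φ) (xp 1 ⊗ (dil 12 Ψ ⊗ dil 2 φ)))
      (⊕-cong (sgn-⊗-cong (dil 4 Ψ) (dil 6 φ) (sgn-dil-even 1 Ψ) (sgn-dil-even 2 φ))
        (≈-trans (sgn-xp₁-⊗ (dil 12 Ψ ⊗ dil 2 φ)) (≈-trans (⊖-cong (⊗-congʳ (xp 1)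
          (sgn-⊗-cong (dil 12 Ψ) (dil 2 φ) (sgn-dil-even 5 Ψ) (sgn-dil-2 φ)))) (≈-sym (-1⊗ (xp 1 ⊗ (dil 12 Ψ ⊗ dil 2 φ))))))))))

-- The parts with exponents 0 modulo 4, 2 modulo 8 and 6 modulo 8. Only `Q₈ᵉ` meets the exponents 8n
-- + 10.
Q₄ᵉ Q₈ᵉ Q₈′ᵉ : Expr
Q₄ᵉ  = ⟨dil⟩ 1 Ψ ⟨⊗⟩ ⟨dil⟩ 2 φ ⟨⊗⟩ (⟨ φ⁻ ⟩ ⟨⊗⟩ ⟨dil⟩ 2 φ⁻)
Q₈ᵉ  = ⟨dil⟩ 2 Ψ ⟨⊗⟩ (⟨ φ⁻ ⟩ ⟨⊗⟩ ⟨ φ⁻ ⟩) ⟨⊗⟩ ⟨dil⟩ 5 φ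
Q₈′ᵉ = ⟨xp⟩ 1 ⟨⊗⟩ (⟨dil⟩ 2 Ψ ⟨⊗⟩ (⟨ φ⁻ ⟩ ⟨⊗⟩ ⟨ φ⁻ ⟩) ⟨⊗⟩ ⟨dil⟩ 11 Ψ)

-- `Ψ⁻Ψ⁻₃-split` at q² separates 0 from 2 modulo 4. In the second part φ₄ φ⁻₄ = φ⁻₈², which leaves
-- φ⁻₁₂ as the only factor that is not a series in q⁸.
eta-dissection : C (+ 2) ⊗ (dil 2 E ⊗ (dil 4 E ⊗ (dil 6 E ⊗ dil 12 E))) ≈
  xp 0 ⊗ dil 4 ⟦ Q₄ᵉ ⟧ᵉ ⊕ ⊖ (xp 2 ⊗ dil 8 ⟦ Q₈ᵉ ⟧ᵉ) ⊕ xp 6 ⊗ dil 8 ⟦ Q₈′ᵉ ⟧ᵉ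
eta-dissection = C≢0-cancel {+ 2} (λ ()) (begin
  C (+ 2) ⊗ (C (+ 2) ⊗ (h₂ ⊗ (h₄ ⊗ (h₆ ⊗ h₁₂))))
    ≈⟨ solve 4 (λ a b c d → con (+ 2) :* (con (+ 2) :* (a :* (b :* (c :* d)))) := (con (+ 2) :* (a :* b)) :* (con (+ 2) :* (c :* d))) ≈-refl h₂ h₄ h₆ h₁₂ ⟩
  (C (+ 2) ⊗ (h₂ ⊗ h₄)) ⊗ (C (+ 2) ⊗ (h₆ ⊗ h₁₂))
    ≈⟨ ≈-sym (⊗-cong (dilate-≈ 1 lhs rhs Ψ⁻φ⁻₂≈2EE₂) (dilate-≈ 5 lhs rhs Ψ⁻φ⁻₂≈2EE₂)) ⟩
  (dil 2 Ψ⁻ ⊗ dil 4 φ⁻) ⊗ (dil 6 Ψ⁻ ⊗ dil 12 φ⁻)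
    ≈⟨ solve 4 (λ a b c d → (a :* b) :* (c :* d) := (a :* c) :* (b :* d)) ≈-refl (dil 2 Ψ⁻) (dil 4 φ⁻) (dil 6 Ψ⁻) (dil 12 φ⁻) ⟩
  (dil 2 Ψ⁻ ⊗ dil 6 Ψ⁻) ⊗ (dil 4 φ⁻ ⊗ dil 12 φ⁻)
    ≈⟨ ⊗-congˡ (dil 4 φ⁻ ⊗ dil 12 φ⁻) (dilate-≈ 1 (⟨ Ψ⁻ ⟩ ⟨⊗⟩ ⟨dil⟩ 2 Ψ⁻)
         (⟨C⟩ (+ 2) ⟨⊗⟩ (⟨dil⟩ 3 Ψ ⟨⊗⟩ ⟨dil⟩ 5 φ ⟨⊕⟩ ⟨⊖⟩ (⟨xp⟩ 1 ⟨⊗⟩ (⟨dil⟩ 11 Ψ ⟨⊗⟩ ⟨dil⟩ 1 φ)))) Ψ⁻Ψ⁻₃-split) ⟩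
  (C (+ 2) ⊗ (dil 8 Ψ ⊗ dil 12 φ ⊕ C (ℤ.- + 1) ⊗ (xp 2 ⊗ (dil 24 Ψ ⊗ dil 4 φ)))) ⊗ (dil 4 φ⁻ ⊗ dil 12 φ⁻)
    ≈⟨ solve 7 (λ p f x q g m n → (con (+ 2) :* (p :* f :+ con (ℤ.- + 1) :* (x :* (q :* g)))) :* (m :* n) :=
         con (+ 2) :* (con (+ 1) :* (p :* f :* (m :* n)) :+ :- (x :* (q :* (g :* m) :* n)))) ≈-refl
         (dil 8 Ψ) (dil 12 φ) (xp 2) (dil 24 Ψ) (dil 4 φ) (dil 4 φ⁻) (dil 12 φ⁻) ⟩
  C (+ 2) ⊗ (xp 0 ⊗ ⟦ dilate 3 Q₄ᵉ ⟧ᵉ ⊕ ⊖ (xp 2 ⊗ (dil 24 Ψ ⊗ (dil 4 φ ⊗ dil 4 φ⁻) ⊗ dil 12 φ⁻)))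
    ≈⟨ ⊗-congʳ (C (+ 2)) (⊕-congʳ (xp 0 ⊗ ⟦ dilate 3 Q₄ᵉ ⟧ᵉ) (⊖-cong (⊗-congʳ (xp 2) (⊗-cong
         (⊗-congʳ (dil 24 Ψ) (dilate-≈ 3 (⟨ φ ⟩ ⟨⊗⟩ ⟨ φ⁻ ⟩) (⟨dil⟩ 1 φ⁻ ⟨⊗⟩ ⟨dil⟩ 1 φ⁻) φφ⁻≈φ⁻₂²))
         (dilate-≈ 11 ⟨ φ⁻ ⟩ (⟨dil⟩ 3 φ ⟨⊕⟩ ⟨⊖⟩ (⟨xp⟩ 1 ⟨⊗⟩ ⟨dil⟩ 7 Ψ))
           (≈-trans φ⁻-split (⊕-congʳ (dil 4 φ) (≈-sym (-1⊗ (xp 1 ⊗ dil 8 Ψ)))))))))) ⟩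
  C (+ 2) ⊗ (xp 0 ⊗ ⟦ dilate 3 Q₄ᵉ ⟧ᵉ ⊕ ⊖ (xp 2 ⊗ (dil 24 Ψ ⊗ (dil 8 φ⁻ ⊗ dil 8 φ⁻) ⊗ (dil 48 φ ⊕ C (ℤ.- + 1) ⊗ (xp 12 ⊗ dil 96 Ψ)))))
    ≈⟨ solve 7 (λ a x p m f y q → con (+ 2) :* (a :+ :- (x :* (p :* (m :* m) :* (f :+ con (ℤ.- + 1) :* (y :* q))))) :=
         con (+ 2) :* (a :+ :- (x :* (p :* (m :* m) :* f)) :+ (x :* y) :* (p :* (m :* m) :* q))) ≈-refl
         (xp 0 ⊗ ⟦ dilate 3 Q₄ᵉ ⟧ᵉ) (xp 2) (dil 24 Ψ) (dil 8 φ⁻) (dil 48 φ) (xp 12) (dil 96 Ψ) ⟩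
  C (+ 2) ⊗ (xp 0 ⊗ ⟦ dilate 3 Q₄ᵉ ⟧ᵉ ⊕ ⊖ (xp 2 ⊗ ⟦ dilate 7 Q₈ᵉ ⟧ᵉ) ⊕ (xp 2 ⊗ xp 12) ⊗ r)
    -- The power q¹⁴ becomes q⁶ q⁸: for n = 0 the exponent 8n + 10 is smaller than 14, so the
    -- residue 6 must stand in front.
    ≈⟨ ⊗-congʳ (C (+ 2)) (⊕-congʳ (xp 0 ⊗ ⟦ dilate 3 Q₄ᵉ ⟧ᵉ ⊕ ⊖ (xp 2 ⊗ ⟦ dilate 7 Q₈ᵉ ⟧ᵉ))
         (≈-trans (⊗-congˡ r (≈-trans (≈-sym (xp-+ 2 12)) (xp-+ 6 8)))
           (solve 3 (λ x y r → (x :* y) :* r := x :* (y :* r)) ≈-refl (xp 6) (xp 8) r))) ⟩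
  C (+ 2) ⊗ (xp 0 ⊗ ⟦ dilate 3 Q₄ᵉ ⟧ᵉ ⊕ ⊖ (xp 2 ⊗ ⟦ dilate 7 Q₈ᵉ ⟧ᵉ) ⊕ xp 6 ⊗ ⟦ dilate 7 Q₈′ᵉ ⟧ᵉ)
    ≈⟨ ⊗-congʳ (C (+ 2)) (≈-sym (⊕-cong (⊕-cong (⊗-congʳ (xp 0) (dil-expr 3 Q₄ᵉ)) (⊖-cong (⊗-congʳ (xp 2) (dil-expr 7 Q₈ᵉ))))
         (⊗-congʳ (xp 6) (dil-expr 7 Q₈′ᵉ)))) ⟩
  C (+ 2) ⊗ (xp 0 ⊗ dil 4 ⟦ Q₄ᵉ ⟧ᵉ ⊕ ⊖ (xp 2 ⊗ dil 8 ⟦ Q₈ᵉ ⟧ᵉ) ⊕ xp 6 ⊗ dil 8 ⟦ Q₈′ᵉ ⟧ᵉ) ∎)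
  where
  open ≈-Reasoning
  h₂ h₄ h₆ h₁₂ r : Series
  h₂ = dil 2 E
  h₄ = dil 4 E
  h₆ = dil 6 E
  h₁₂ = dil 12 E
  r = dil 24 Ψ ⊗ (dil 8 φ⁻ ⊗ dil 8 φ⁻) ⊗ dil 96 Ψ
  lhs rhs : Expr
  lhs = ⟨ Ψ⁻ ⟩ ⟨⊗⟩ ⟨dil⟩ 1 φ⁻
  rhs = ⟨C⟩ (+ 2) ⟨⊗⟩ (⟨ E ⟩ ⟨⊗⟩ ⟨dil⟩ 1 E)

-- The leading q in the series of a(n) lowers 8n + 11 to 8n + 10 = 2 + 8 (n + 1).
a-at : ∀ n → + 2 ℤ.* a (8 * n + 11) ≡ ℤ.- ⟦ Q₈ᵉ ⟧ᵉ (suc n)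
a-at n = trans (cong (λ z → + 2 ℤ.* z) (trans (cong a (l₀ n)) (a≈ (8 * n + 10))))
  (trans (sym (C-⊗-at (+ 2) (dil 2 E ⊗ (dil 4 E ⊗ (dil 6 E ⊗ dil 12 E))) (8 * n + 10)))
  (trans (at eta-dissection (8 * n + 10)) (trans
  (at-off 0 3 ⟦ Q₄ᵉ ⟧ᵉ (2 * n + 2) 1 (ℕ.s≤s (ℕ.s≤s ℕ.z≤n)) (l₁ n)
   ⟨+⟩ cong ℤ.-_ (at-on 2 7 ⟦ Q₈ᵉ ⟧ᵉ (suc n) (l₂ n))
   ⟨+⟩ at-off 6 7 ⟦ Q₈′ᵉ ⟧ᵉ n 3 (ℕ.s≤s (ℕ.s≤s (ℕ.s≤s (ℕ.s≤s ℕ.z≤n)))) (l₃ n))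
  (lem (⟦ Q₈ᵉ ⟧ᵉ (suc n))))))
  where
  l₀ : ∀ n → 8 * n + 11 ≡ 1 + (8 * n + 10)
  l₀ = ℕ-Solver.solve-∀
  l₁ : ∀ n → 8 * n + 10 ≡ 0 + ((2 * n + 2) * 4 + 2)
  l₁ = ℕ-Solver.solve-∀
  l₂ : ∀ n → 8 * n + 10 ≡ 2 + (1 + n) * 8
  l₂ = ℕ-Solver.solve-∀
  l₃ : ∀ n → 8 * n + 10 ≡ 6 + (n * 8 + 4)
  l₃ = ℕ-Solver.solve-∀
  lem : ∀ x → + 0 ℤ.+ ℤ.- x ℤ.+ + 0 ≡ ℤ.- x
  lem = solve-∀

-- The sum of the two dissections

Ψ₂²≈2φ₂Ψ₄ : dil 2 Ψ ⊗ dil 2 Ψ ≈ C (+ 2) ⊗ (dil 2 φ ⊗ dil 4 Ψ)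
Ψ₂²≈2φ₂Ψ₄ = dilate-≈ 1 (⟨ Ψ ⟩ ⟨⊗⟩ ⟨ Ψ ⟩) (⟨C⟩ (+ 2) ⟨⊗⟩ (⟨ φ ⟩ ⟨⊗⟩ ⟨dil⟩ 1 Ψ)) (≈-sym 2φΨ₂≈Ψ²)

-- By φ² - φ⁻² = 2q Ψ₄² and Ψ₂² = 2 φ₂ Ψ₄ every term acquires the factor q Ψ₃ Ψ₄. The cofactor is Ψ
-- Ψ₃ + 2 (Ψ₄ φ₆ + q Ψ₁₂ φ₂), which is 2 Ψ Ψ₃.
combined : Y ⊕ ⊖ ⟦ Q₈ᵉ ⟧ᵉ ≈ C (+ 2) ⊗ (xp 1 ⊗ (Ψ ⊗ dil 3 Ψ ⊗ dil 3 Ψ ⊗ dil 4 Ψ))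
combined = begin
  Y ⊕ ⊖ (p₃ ⊗ (φ⁻ ⊗ φ⁻) ⊗ f₆)
    ≈⟨ ⊕-cong (⊕-cong (⊕-congʳ (x ⊗ (p₃ ⊗ p₃ ⊗ p₄ ⊗ Ψ)) (⊗-congˡ p₃ (⊗-congˡ f₆ φ²-split)))
         (⊗-cong (xp≈xpow 2) (⊗-congˡ p₃ (⊗-congˡ p₁₂ Ψ₂²≈2φ₂Ψ₄))))
         (⊖-cong (⊗-congˡ f₆ (⊗-congʳ p₃ φ⁻²-split))) ⟩
  x ⊗ (p₃ ⊗ p₃ ⊗ p₄ ⊗ Ψ) ⊕ (f₂ ⊗ f₂ ⊕ x ⊗ (p₄ ⊗ p₄)) ⊗ f₆ ⊗ p₃ ⊕ xpow 2 ⊗ (C (+ 2) ⊗ (f₂ ⊗ p₄) ⊗ p₁₂ ⊗ p₃)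
    ⊕ ⊖ (p₃ ⊗ (f₂ ⊗ f₂ ⊕ ⊖ (x ⊗ (p₄ ⊗ p₄))) ⊗ f₆)
    ≈⟨ solve 7 (λ x p₃ p₄ p f₂ f₆ p₁₂ →
         x :* (p₃ :* p₃ :* p₄ :* p) :+ (f₂ :* f₂ :+ x :* (p₄ :* p₄)) :* f₆ :* p₃ :+ (x :* (x :* con (+ 1))) :* (con (+ 2) :* (f₂ :* p₄) :* p₁₂ :* p₃)
           :+ :- (p₃ :* (f₂ :* f₂ :+ :- (x :* (p₄ :* p₄))) :* f₆)
         := x :* (p₃ :* p₃ :* p₄ :* p) :+ x :* (p₃ :* p₄ :* (con (+ 2) :* (p₄ :* f₆ :+ x :* (p₁₂ :* f₂))))) ≈-refl x p₃ p₄ Ψ f₂ f₆ p₁₂ ⟩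
  x ⊗ (p₃ ⊗ p₃ ⊗ p₄ ⊗ Ψ) ⊕ x ⊗ (p₃ ⊗ p₄ ⊗ (C (+ 2) ⊗ (p₄ ⊗ f₆ ⊕ x ⊗ (p₁₂ ⊗ f₂))))
    ≈⟨ ⊕-congʳ (x ⊗ (p₃ ⊗ p₃ ⊗ p₄ ⊗ Ψ)) (⊗-congʳ x (⊗-congʳ (p₃ ⊗ p₄) (≈-sym ΨΨ₃-split))) ⟩
  x ⊗ (p₃ ⊗ p₃ ⊗ p₄ ⊗ Ψ) ⊕ x ⊗ (p₃ ⊗ p₄ ⊗ (Ψ ⊗ p₃))
    ≈⟨ solve 4 (λ x a b c → x :* (a :* a :* b :* c) :+ x :* (a :* b :* (c :* a)) := con (+ 2) :* (x :* (c :* a :* a :* b))) ≈-refl x p₃ p₄ Ψ ⟩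
  C (+ 2) ⊗ (x ⊗ (Ψ ⊗ p₃ ⊗ p₃ ⊗ p₄)) ∎
  where
  open ≈-Reasoning
  x p₃ p₄ p₁₂ f₂ f₆ : Series
  x = xp 1
  p₃ = dil 3 Ψ
  p₄ = dil 4 Ψ
  p₁₂ = dil 12 Ψ
  f₂ = dil 2 φ
  f₆ = dil 6 φ

-- Sums of divisors prime to 3

divisors : ℕ → List ℕ
divisors n = filter (_∣? n) (map suc (upTo n))

divisors-unique : ∀ n → Unique (divisors n)
divisors-unique n = Uniqueₚ.filter⁺ (_∣? n) (Uniqueₚ.map⁺ ℕₚ.suc-injective (Uniqueₚ.upTo⁺ n))

∈-divisors⁻ : ∀ {d} n → d ∈ divisors n → d ∣ n
∈-divisors⁻ n p = proj₂ (∈-filter⁻ (_∣? n) {xs = map suc (upTo n)} p)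

∈-divisors⁺ : ∀ {d} n → d ∣ suc n → d ∈ divisors (suc n)
∈-divisors⁺ {zero}  n (divides q e) with trans e (ℕₚ.*-zeroʳ q)
... | ()
∈-divisors⁺ {suc d} n p = ∈-filter⁺ (_∣? suc n) (∈-map⁺ suc (∈-upTo⁺ (∣⇒≤ p))) p

Σ-pos : ∀ xs → Σ[ +_ ] xs ≡ + sum xs
Σ-pos []       = refl
Σ-pos (x ∷ xs) = cong (λ z → + x ℤ.+ z) (Σ-pos xs)

3∤? : ∀ d → Dec (¬ (3 ∣ d))
3∤? d = ¬? (3 ∣? d)

-- For n ≥ 1 this is σ(n) - 3σ(n/3), the coefficient of S - 3 S(q³), and it does not change under n
-- ↦ 3n.
ρ : ℕ → ℤ
ρ n = Σ[ +_ ] (filter 3∤? (divisors n))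

∤3⇒∣ : ∀ {d m} → ¬ (3 ∣ d) → d ∣ 3 * m → d ∣ m
∤3⇒∣ {d} 3∤d = coprime-divisor {d} {3} coprime
  where
  coprime : Coprime d 3
  coprime (p , q) with prime⇒irreducible (from-yes (prime? 3)) q
  ... | inj₁ e = e
  ... | inj₂ refl = ⊥-elim (3∤d p)

-- A divisor of 3k either is prime to 3 and divides k, or is 3e with e a divisor of k; here k is
-- `suc m`.
σ-3* : ∀ m → + σ (3 * suc m) ≡ ρ (suc m) ℤ.+ + 3 ℤ.* + σ (suc m)
σ-3* m = trans (sym (Σ-pos (divisors (3 * suc m)))) (trans
  (Σ-unique +_ (divisors-unique (3 * suc m)) (Uniqueₚ.++⁺ (Uniqueₚ.filter⁺ 3∤? (divisors-unique (suc m)))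
      (Uniqueₚ.map⁺ (λ {x} {y} → ℕₚ.*-cancelˡ-≡ x y 3) (divisors-unique (suc m)))
      (λ (p , q) → disjoint (∈-filter⁻ 3∤? {xs = divisors (suc m)} p) (∈-map⁻ (3 *_) q)))
    to (λ p → [ from₁ , from₂ ]′ (∈-++⁻ L p)))
  (trans (Σ-++ +_ L (map (3 *_) (divisors (suc m)))) (cong (λ z → ρ (suc m) ℤ.+ z)
    (trans (Σ-map +_ (3 *_) (divisors (suc m))) (trans (Σ-cong (divisors (suc m)) (λ {d} _ → ℤₚ.pos-* 3 d))
      (trans (Σ-* (+ 3) +_ (divisors (suc m))) (cong (λ z → + 3 ℤ.* z) (Σ-pos (divisors (suc m))))))))))
  where
  L : List ℕ
  L = filter 3∤? (divisors (suc m))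
  disjoint : ∀ {d} → d ∈ divisors (suc m) × ¬ (3 ∣ d) → ∃ (λ e → e ∈ divisors (suc m) × d ≡ 3 * e) → _
  disjoint (_ , ∤) (e , _ , refl) = ∤ (m∣m*n e)
  to : ∀ {d} → d ∈ divisors (3 * suc m) → d ∈ L ++ map (3 *_) (divisors (suc m))
  to {d} p with 3 ∣? d
  ... | no ∤ = ∈-++⁺ˡ (∈-filter⁺ 3∤? (∈-divisors⁺ m (∤3⇒∣ ∤ (∈-divisors⁻ (3 * suc m) p))) ∤)
  ... | yes (divides e refl) = ∈-++⁺ʳ L (subst (_∈ map (3 *_) (divisors (suc m))) (ℕₚ.*-comm 3 e)
          (∈-map⁺ (3 *_) {x = e} (∈-divisors⁺ {e} m (*-cancelˡ-∣ 3 (subst (_∣ 3 * suc m) (ℕₚ.*-comm e 3) (∈-divisors⁻ (3 * suc m) p))))))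
  from₁ : ∀ {d} → d ∈ L → d ∈ divisors (3 * suc m)
  from₁ p = ∈-divisors⁺ (m + 2 * suc m) (∣-trans (∈-divisors⁻ (suc m) (proj₁ (∈-filter⁻ 3∤? {xs = divisors (suc m)} p))) (n∣m*n 3))
  from₂ : ∀ {d} → d ∈ map (3 *_) (divisors (suc m)) → d ∈ divisors (3 * suc m)
  from₂ p with ∈-map⁻ (3 *_) p
  ... | e , q , refl = ∈-divisors⁺ {3 * e} (m + 2 * suc m) (*-monoʳ-∣ 3 (∈-divisors⁻ {e} (suc m) q))

ρ-3* : ∀ m → ρ (3 * suc m) ≡ ρ (suc m)
ρ-3* m = Σ-unique +_ (Uniqueₚ.filter⁺ 3∤? (divisors-unique (3 * suc m))) (Uniqueₚ.filter⁺ 3∤? (divisors-unique (suc m)))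
  (λ p → let q , ∤ = ∈-filter⁻ 3∤? {xs = divisors (3 * suc m)} p in
     ∈-filter⁺ 3∤? (∈-divisors⁺ m (∤3⇒∣ ∤ (∈-divisors⁻ (3 * suc m) q))) ∤)
  (λ p → let q , ∤ = ∈-filter⁻ 3∤? {xs = divisors (suc m)} p in
     ∈-filter⁺ 3∤? (∈-divisors⁺ (m + 2 * suc m) (∣-trans (∈-divisors⁻ (suc m) q) (n∣m*n 3))) ∤)

ρ-∤3 : ∀ m → ¬ (3 ∣ suc m) → ρ (suc m) ≡ + σ (suc m)
ρ-∤3 m 3∤ = trans (Σ-unique +_ (Uniqueₚ.filter⁺ 3∤? (divisors-unique (suc m))) (divisors-unique (suc m))
    (λ p → proj₁ (∈-filter⁻ 3∤? {xs = divisors (suc m)} p))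
    (λ p → ∈-filter⁺ 3∤? p (λ q → 3∤ (∣-trans q (∈-divisors⁻ (suc m) p)))))
  (Σ-pos (divisors (suc m)))

ρ-^ : ∀ β m → ¬ (3 ∣ suc m) → ρ (3 ^ β * suc m) ≡ + σ (suc m)
ρ-^ zero    m 3∤ = trans (cong ρ (ℕₚ.*-identityˡ (suc m))) (ρ-∤3 m 3∤)
ρ-^ (suc β) m 3∤ with 3 ^ β * suc m in eq
... | zero  = ⊥-elim (ℕₚ.<-irrefl (sym eq) (ℕₚ.*-mono-≤ (ℕₚ.m^n>0 3 β) (ℕ.s≤s (ℕ.z≤n {m}))))
... | suc k = trans (cong ρ (trans (ℕₚ.*-assoc 3 (3 ^ β) (suc m)) (cong (3 *_) eq)))
      (trans (ρ-3* k) (trans (cong ρ (sym eq)) (ρ-^ β m 3∤)))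

S-3S₃ : ∀ m → S (suc m) ℤ.+ ℤ.- (+ 3 ℤ.* dil 3 S (suc m)) ≡ ρ (suc m)
S-3S₃ m with 3 ∣? suc m
... | no 3∤ = trans (cong (λ z → S (suc m) ℤ.+ ℤ.- (+ 3 ℤ.* z)) (dil-at-∤ 2 S (suc m) 3∤))
        (trans (ℤₚ.+-identityʳ (S (suc m))) (sym (ρ-∤3 m 3∤)))
... | yes (divides (suc k) e) = trans (cong (λ i → S i ℤ.+ ℤ.- (+ 3 ℤ.* dil 3 S i)) e)
        (trans (cong₂ (λ x y → x ℤ.+ ℤ.- (+ 3 ℤ.* y)) (trans (cong S (ℕₚ.*-comm (suc k) 3)) (σ-3* k)) (dil-at-multiple 2 S (suc k)))
          (trans (lem (ρ (suc k)) (+ σ (suc k))) (trans (sym (ρ-3* k)) (cong ρ (trans (ℕₚ.*-comm 3 (suc k)) (sym e))))))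
  where
  lem : ∀ r s → r ℤ.+ + 3 ℤ.* s ℤ.+ ℤ.- (+ 3 ℤ.* s) ≡ r
  lem = solve-∀

-- The exponent is odd, so the series in q² and q⁶ in `lambert` contribute nothing.
lambert-σ : ∀ n → (xp 1 ⊗ ((Ψ ⊗ Ψ) ⊗ (dil 3 Ψ ⊗ dil 3 Ψ))) (8 * n + 11) ≡ + 16 ℤ.* ρ (8 * n + 11)
lambert-σ n = trans (sym (at lambert N)) (trans (C-⊗-at (+ 16) (S ⊕ ⊖ (C (+ 3) ⊗ dil 3 S) ⊕ ⊖ dil 2 S ⊕ C (+ 3) ⊗ dil 6 S) N) (cong (λ z → + 16 ℤ.* z) (trans
  (cong (λ z → S N ℤ.+ ℤ.- z) (C-⊗-at (+ 3) (dil 3 S) N) ⟨+⟩ cong ℤ.-_ (dil-at-∤ 1 S N 2∤)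
    ⟨+⟩ trans (C-⊗-at (+ 3) (dil 6 S) N) (cong (λ z → + 3 ℤ.* z) (dil-at-∤ 5 S N (λ p → 2∤ (∣-trans (divides 3 refl) p)))))
  (trans (trans (ℤₚ.+-identityʳ _) (ℤₚ.+-identityʳ _))
    (subst (λ i → S i ℤ.+ ℤ.- (+ 3 ℤ.* dil 3 S i) ≡ ρ i) (sym (l₀ n)) (S-3S₃ (8 * n + 10)))))))
  where
  N : ℕ
  N = 8 * n + 11
  l₀ : ∀ n → 8 * n + 11 ≡ 1 + (8 * n + 10)
  l₀ = ℕ-Solver.solve-∀
  l₁ : ∀ n → 8 * n + 11 ≡ (4 * n + 5) * 2 + 1
  l₁ = ℕ-Solver.solve-∀
  2∤ : ¬ (2 ∣ N)
  2∤ (divides q e) = ℕₚ.even≢odd q (4 * n + 5) (trans (ℕₚ.*-comm 2 q) (trans (sym e) (trans (l₁ n) (trans (ℕₚ.+-comm _ 1) (cong suc (ℕₚ.*-comm (4 * n + 5) 2))))))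

-- The number of representations

-- The two readings of the Lambert series give 16ρ = 8Y, so ρ and a both occur with the factor 2;
-- the factor 2q in `combined` removes it and lowers the exponent from n + 1 to n.
count : ∀ n → ρ (8 * n + 11) ℤ.+ a (8 * n + 11) ≡ (Ψ ⊗ dil 3 Ψ ⊗ dil 3 Ψ ⊗ dil 4 Ψ) n
count n = ℤₚ.*-cancelˡ-≡ (+ 2) _ _ (begin
  + 2 ℤ.* (ρ N ℤ.+ a N)
    ≡⟨ ℤₚ.*-distribˡ-+ (+ 2) (ρ N) (a N) ⟩
  + 2 ℤ.* ρ N ℤ.+ + 2 ℤ.* a N
    ≡⟨ cong₂ ℤ._+_ 2ρ (a-at n) ⟩
  (Y ⊕ ⊖ ⟦ Q₈ᵉ ⟧ᵉ) (suc n)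
    ≡⟨ at combined (suc n) ⟩
  (C (+ 2) ⊗ (xp 1 ⊗ (Ψ ⊗ dil 3 Ψ ⊗ dil 3 Ψ ⊗ dil 4 Ψ))) (suc n)
    ≡⟨ trans (C-⊗-at (+ 2) (xp 1 ⊗ (Ψ ⊗ dil 3 Ψ ⊗ dil 3 Ψ ⊗ dil 4 Ψ)) (suc n)) (cong (λ z → + 2 ℤ.* z) (xp-⊗-≥ 1 (Ψ ⊗ dil 3 Ψ ⊗ dil 3 Ψ ⊗ dil 4 Ψ) n)) ⟩
  + 2 ℤ.* (Ψ ⊗ dil 3 Ψ ⊗ dil 3 Ψ ⊗ dil 4 Ψ) n ∎)
  where
  open ≡-Reasoning
  N : ℕ
  N = 8 * n + 11
  lem : ∀ x → + 8 ℤ.* (+ 2 ℤ.* x) ≡ + 16 ℤ.* x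
  lem = solve-∀
  2ρ : + 2 ℤ.* ρ N ≡ Y (suc n)
  2ρ = ℤₚ.*-cancelˡ-≡ (+ 8) _ _ (trans (lem (ρ N)) (trans (sym (lambert-σ n)) (lambert-at n)))

-- The grade is literally the sum in `TRep`, with its coefficient 1, so that only the nesting of the
-- tuples differs.
representations : Graded (λ (((x , y) , z) , w) → + 1 ℤ.* tri x ℤ.+ + 3 ℤ.* tri y ℤ.+ + 3 ℤ.* tri z ℤ.+ + 4 ℤ.* tri w)
representations = graded-× (graded-× (graded-× (triangle 0) (triangle 2)) (triangle 2)) (triangle 3)

θ-representations : θ representations 1ᶜ ≈ Ψ ⊗ dil 3 Ψ ⊗ dil 3 Ψ ⊗ dil 4 Ψ
θ-representations = ≈-trans (θ-× (graded-× (graded-× (triangle 0) (triangle 2)) (triangle 2)) (triangle 3) 1ᶜ 1ᶜ)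
  (⊗-cong (≈-trans (θ-× (graded-× (triangle 0) (triangle 2)) (triangle 2) 1ᶜ 1ᶜ)
    (⊗-cong (≈-trans (θ-× (triangle 0) (triangle 2) 1ᶜ 1ᶜ) (⊗-congʳ Ψ (θ-triangle 2 1ᶜ))) (θ-triangle 2 1ᶜ))) (θ-triangle 3 1ᶜ))

TRep-↔ : ∀ n → Fin (length (fiber representations n)) ↔ TRep 1 3 3 4 n
TRep-↔ n = nest ↔-∘ fiber-↔ representations n
  where
  nest : _ ↔ TRep 1 3 3 4 n
  nest = mk↔ₛ′ (λ ((((x , y) , z) , w) , p) → x , y , z , w , p) (λ (x , y , z , w , p) → (((x , y) , z) , w) , p) (λ _ → refl) (λ _ → refl)

theorem4p7 : (n β n₁ : ℕ) → n ≥ 1 → n₁ ≥ 1 → ¬ (3 ∣ n₁) →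
    8 * n + 11 ≡ 3 ^ β * n₁ →
    Σ ℕ λ m → tEquals 1 3 3 4 n m × (+ m ≡ (+ σ n₁) ℤ.+ a (8 * n + 11))
theorem4p7 n β (suc m) _ _ 3∤ e = length (fiber representations n) , TRep-↔ n , (begin
  + length (fiber representations n)          ≡⟨ sym (θ-count representations n) ⟩
  θ representations 1ᶜ n                      ≡⟨ at θ-representations n ⟩
  (Ψ ⊗ dil 3 Ψ ⊗ dil 3 Ψ ⊗ dil 4 Ψ) n         ≡⟨ sym (count n) ⟩
  ρ (8 * n + 11) ℤ.+ a (8 * n + 11)           ≡⟨ cong (λ z → z ℤ.+ a (8 * n + 11)) (trans (cong ρ e) (ρ-^ β m 3∤)) ⟩
  + σ (suc m) ℤ.+ a (8 * n + 11)              ∎)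
  where open ≡-Reasoning
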